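{- For every $\eta>0$ there is $\mathcal{A}=\mathcal{A}(\eta)<\infty$ such that, as $N\to\infty$, $$\#\{\gamma\in\Gamma_{\mathcal{A}}\cap B_N:\ \mathrm{tr}({}^{t}\gamma\,\gamma)^2-4\text{ is square-free}\}\gg N^{2-\eta}.$$
   Context: For an integer $\mathcal{A}\ge 1$, $\Gamma_{\mathcal{A}}$ is the semigroup consisting of all products of even length of the matrices $\begin{pmatrix} a&1\\1&0\end{pmatrix}$, $1\le a\le\mathcal{A}$ (so $\Gamma_{\mathcal{A}}\subset \mathrm{SL}_2(\mathbb{Z})$). For $N>0$, $B_N=\{g=\begin{pmatrix}a&b\\c&d\end{pmatrix}\in\mathrm{SL}_2(\mathbb{R}): a^2+b^2+c^2+d^2<N^2\}$. ${}^{t}\gamma$ denotes the transpose of $\gamma$. -}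

module Defs where

open import Data.Nat using (ℕ; zero; suc; _+_; _*_; _∸_; _^_; _≤_; _<_)
open import Data.Nat.Divisibility using (_∣_)
open import Data.List using (List; []; _∷_; foldr; length)
open import Data.List.Relation.Unary.All using (All)
open import Data.Product using (Σ; ∃; _×_; _,_)
open import Relation.Binary.PropositionalEquality using (_≡_)

-- 2x2 matrices with entries in ℕ (all elements of Γ_A have nonnegative
-- integer entries, being products of nonnegative integer matrices).
record Mat : Set where
  constructor mat
  field
    m11 m12 m21 m22 : ℕ

open Mat public

_·_ : Mat → Mat → Mat
mat a b c d · mat e f g h = mat (a * e + b * g) (a * f + b * h) (c * e + d * g) (c * f + d * h)

I₂ : Mat
I₂ = mat 1 0 0 1

M : ℕ → Mat
M a = mat a 1 1 0

prodWord : List ℕ → Mat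
prodWord = foldr (λ a g → M a · g) I₂

InΓ : ℕ → Mat → Set
InΓ A g = Σ (List ℕ) λ w →
  All (λ a → 1 ≤ a × a ≤ A) w × (∃ λ k → length w ≡ 2 * suc k) × prodWord w ≡ g

-- a² + b² + c² + d², which equals tr(ᵗγ γ)
normSq : Mat → ℕ
normSq (mat a b c d) = a * a + b * b + c * c + d * d

InB : ℕ → Mat → Set
InB N g = normSq g < N * N

SquareFree : ℕ → Set
SquareFree n = ∀ p → p * p ∣ n → p ≡ 1

-- tr(ᵗγ γ)² − 4  (nonnegative since tr(ᵗγ γ) ≥ 2 on SL₂)
disc : Mat → ℕ
disc g = normSq g * normSq g ∸ 4

{-# OPTIONS --safe #-}
module Submission where

-- Write t = tr(ᵗγγ). Then t − 2 = (a − d)² + (b + c)² and t + 2 = (a + d)² + (b − c)², and for odd t the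
-- number t² − 4 is square-free unless p² | t − 2ε for a prime p and a sign ε = ±1.
--
-- Take γ = M_a M_b w, where w is a product of 6m blocks from a finite set T of words of one length with
-- |γ| ≤ X for γ ∈ T and |T| ≥ X^(2 − 1/K). Such T come from the continued fractions of the coprime pairs up
-- to a constant multiple of X, after a pigeonhole on length and residue; passing to a power makes all
-- blocks ≡ 1 modulo a number q divisible by p² for all p ≤ 192. With a ≡ 1, b ≡ 0 mod q this gives
-- t² − 4 ≡ 5 mod q, so no p ≤ 192 is an obstruction. The larger primes are treated in three ranges.
--
-- For p bounded in terms of A, where a, b range over ~A values, t − 2ε is a quadratic in a whose
-- discriminant is −4(|S|² − ε)², S the second row; counting its roots gives O(A²/p²) pairs (a, b).
--
-- For X^s ≤ p < X^(s+1), s < m, let n = p². The products of 3(s+1) blocks are so many that they are almost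
-- equidistributed in SL₂(ℤ/n) in mean square: if x ≡ y mod n, then, after removal of the common prefix,
-- k = ᵗx J y has nonnegative entries, determinant one, and is ≡ J mod n, which forces
-- k₂₁ ≡ k₁₂ + 2 mod n²; as k₁₁k₂₂ = 1 + k₁₂k₂₁, the divisor bound shows that there are few k, and k
-- essentially determines (x, y). By Cauchy–Schwarz the product of two such factors hits every residue
-- class at most about n^(−3) of the time, and O(n²) classes are bad.
--
-- For p ≥ X^m it suffices that t ≡ 2ε mod p² leaves O(N²/p²) values of t, each attained N^o(1) times
-- because the numbers of representations of t ± 2 as sums of two squares are N^o(1).

open import Defs
open import Data.List using (List; []; _∷_; length; map; _++_; filter; cartesianProduct; take; reverse)
open import Data.List.Membership.Propositional using (_∈_)
open import Data.List.Membership.Propositional.Properties using (∈-∃++; ∈-++⁻; ∈-++⁺ˡ; ∈-++⁺ʳ; ∈-filter⁺; ∈-filter⁻; ∈-map⁺; ∈-map⁻; ∈-cartesianProduct⁺; ∈-cartesianProduct⁻)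
open import Data.List.Properties using (length-map; length-++; length-reverse; length-take; reverse-injective; unfold-reverse; ∷-injective; ++-assoc; ++-cancelʳ; ++-identityʳ)
import Data.List.Properties as List
open import Data.List.Relation.Unary.All using (All; []; _∷_)
import Data.List.Relation.Unary.All as All
import Data.List.Relation.Unary.All.Properties as All
open import Data.List.Relation.Unary.AllPairs using ([]; _∷_)
open import Data.List.Relation.Unary.Any using (here; there)
open import Data.List.Relation.Unary.Unique.Propositional using (Unique)
import Data.List.Relation.Unary.Unique.Propositional.Properties as Unique
open import Data.Product using (Σ; ∃; _×_; _,_; proj₁; proj₂; uncurry)
open import Data.Product.Properties using (,-injectiveˡ; ,-injectiveʳ; ≡-dec)
open import Data.Sum using (_⊎_; inj₁; inj₂)
open import Data.Empty using (⊥; ⊥-elim)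
import Data.Integer as ℤ
import Data.Integer.Properties as ℤ
import Data.Integer.Tactic.RingSolver as ℤSolver
import Data.Nat.Divisibility as ℕᵈ
import Data.Nat.Tactic.RingSolver as ℕSolver
open import Relation.Binary.Definitions using (tri<; tri≈; tri>)
open import Relation.Binary.PropositionalEquality using (_≡_; refl; sym; trans; cong; cong₂; subst; subst₂; module ≡-Reasoning)
open import Relation.Nullary using (¬_; Dec; yes; no)
open import Relation.Nullary.Decidable using (_×-dec_; ¬?)

-- All losses are measured in powers of b = X^(1/K): a divisor bound costs a power of b, and the
-- block set satisfies b |T| = X². The sum of 1/p² over p ≥ X^s saves X^s = b^(K s), while the
-- losses at level s are at most b^(14 s), and those for p ≥ X^m at most b^(11 m); K ≥ 15 leaves
-- room for both. The obstacle is that the constant of the collision estimate depends on T, through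
-- |T|² and the largest digit. The estimate therefore gives nothing for primes below some X^s₀ that
-- is known only once T is fixed. The leading digits a and b fill this gap: their range A = X^(2 s₀)
-- is chosen last, so that p² ≤ A for all these primes. The alphabet grows accordingly but does not
-- depend on N. The budget is 1/16 of the family for each sign and each of the three ranges, 6/16 in
-- all, so more than half of the family survives. In the first range the density of bad pairs is at
-- most 12/p², and the sum over p > 192 is at most 12/192 = 1/16; this is the origin of 192.

module Counting where

  open import Data.Nat
  open import Data.Nat.Properties

  private variable
    A B : Set
    P Q : Set

  -- Finite sums over lists, indicators and counting by injections

  ∑ : List A → (A → ℕ) → ℕ
  ∑ [] f = 0
  ∑ (x ∷ xs) f = f x + ∑ xs f

  infixr 8 ∑
  syntax ∑ L (λ x → e) = ∑[ x ∈ L ] e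

  𝟙 : Dec P → ℕ
  𝟙 (yes _) = 1
  𝟙 (no _) = 0

  𝟙-mono : (P? : Dec P) (Q? : Dec Q) → (P → Q) → 𝟙 P? ≤ 𝟙 Q?
  𝟙-mono (yes p) (yes q) h = ≤-refl
  𝟙-mono (yes p) (no ¬q) h = ⊥-elim (¬q (h p))
  𝟙-mono (no _) _ h = z≤n

  𝟙-yes : (P? : Dec P) → P → 𝟙 P? ≡ 1
  𝟙-yes (yes _) p = refl
  𝟙-yes (no ¬p) p = ⊥-elim (¬p p)

  𝟙-no : (P? : Dec P) → ¬ P → 𝟙 P? ≡ 0
  𝟙-no (yes p) ¬p = ⊥-elim (¬p p)
  𝟙-no (no _) ¬p = refl

  𝟙≤1 : (P? : Dec P) → 𝟙 P? ≤ 1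
  𝟙≤1 (yes _) = ≤-refl
  𝟙≤1 (no _) = z≤n

  𝟙≤ : (P? : Dec P) {k : ℕ} → (P → 1 ≤ k) → 𝟙 P? ≤ k
  𝟙≤ (yes p) h = h p
  𝟙≤ (no _) h = z≤n

  ∑-mono-∈ : (L : List A) {f g : A → ℕ} → (∀ x → x ∈ L → f x ≤ g x) → ∑ L f ≤ ∑ L g
  ∑-mono-∈ [] h = z≤n
  ∑-mono-∈ (x ∷ L) h = +-mono-≤ (h x (here refl)) (∑-mono-∈ L λ y y∈ → h y (there y∈))

  ∑-mono : (L : List A) {f g : A → ℕ} → (∀ x → f x ≤ g x) → ∑ L f ≤ ∑ L g
  ∑-mono L h = ∑-mono-∈ L λ x _ → h x

  ∑-cong-∈ : (L : List A) {f g : A → ℕ} → (∀ x → x ∈ L → f x ≡ g x) → ∑ L f ≡ ∑ L g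
  ∑-cong-∈ [] h = refl
  ∑-cong-∈ (x ∷ L) h = cong₂ _+_ (h x (here refl)) (∑-cong-∈ L λ y y∈ → h y (there y∈))

  ∑-cong : (L : List A) {f g : A → ℕ} → (∀ x → f x ≡ g x) → ∑ L f ≡ ∑ L g
  ∑-cong L h = ∑-cong-∈ L λ x _ → h x

  ∑-const : (L : List A) (c : ℕ) → ∑[ _ ∈ L ] c ≡ length L * c
  ∑-const [] c = refl
  ∑-const (x ∷ L) c = cong (c +_) (∑-const L c)

  ∑-bound : (L : List A) {f : A → ℕ} (c : ℕ) → (∀ x → x ∈ L → f x ≤ c) → ∑ L f ≤ length L * c
  ∑-bound L c h = ≤-trans (∑-mono-∈ L h) (≤-reflexive (∑-const L c))

  ∑-+ : (L : List A) (f g : A → ℕ) → ∑[ x ∈ L ] (f x + g x) ≡ ∑ L f + ∑ L g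
  ∑-+ [] f g = refl
  ∑-+ (x ∷ L) f g rewrite ∑-+ L f g = lemma (f x) (g x) (∑ L f) (∑ L g)
    where
    lemma : ∀ a b c d → a + b + (c + d) ≡ a + c + (b + d)
    lemma = ℕSolver.solve-∀

  ∑-*ˡ : (L : List A) (c : ℕ) (f : A → ℕ) → ∑[ x ∈ L ] (c * f x) ≡ c * ∑ L f
  ∑-*ˡ [] c f = sym (*-zeroʳ c)
  ∑-*ˡ (x ∷ L) c f rewrite ∑-*ˡ L c f = sym (*-distribˡ-+ c (f x) (∑ L f))

  ∑-*ʳ : (L : List A) (c : ℕ) (f : A → ℕ) → ∑[ x ∈ L ] (f x * c) ≡ ∑ L f * c
  ∑-*ʳ [] c f = refl
  ∑-*ʳ (x ∷ L) c f rewrite ∑-*ʳ L c f = sym (*-distribʳ-+ c (f x) (∑ L f))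

  ∑-zero : (L : List A) → ∑[ _ ∈ L ] 0 ≡ 0
  ∑-zero L = trans (∑-const L 0) (*-zeroʳ (length L))

  ∑-swap : (L : List A) (K : List B) (f : A → B → ℕ) →
    ∑[ x ∈ L ] ∑[ y ∈ K ] f x y ≡ ∑[ y ∈ K ] ∑[ x ∈ L ] f x y
  ∑-swap [] K f = sym (∑-zero K)
  ∑-swap (x ∷ L) K f =
    trans (cong (∑ K (f x) +_) (∑-swap L K f)) (sym (∑-+ K (f x) λ y → ∑[ x ∈ L ] f x y))

  ∑-++ : (L K : List A) (f : A → ℕ) → ∑ (L ++ K) f ≡ ∑ L f + ∑ K f
  ∑-++ [] K f = refl
  ∑-++ (x ∷ L) K f = trans (cong (f x +_) (∑-++ L K f)) (sym (+-assoc (f x) _ _))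

  ∑-map : (L : List A) (g : A → B) (f : B → ℕ) → ∑ (map g L) f ≡ ∑[ x ∈ L ] f (g x)
  ∑-map [] g f = refl
  ∑-map (x ∷ L) g f = cong (f (g x) +_) (∑-map L g f)

  ∑-cartesianProduct : (L : List A) (K : List B) (f : A × B → ℕ) →
    ∑ (cartesianProduct L K) f ≡ ∑[ x ∈ L ] ∑[ y ∈ K ] f (x , y)
  ∑-cartesianProduct [] K f = refl
  ∑-cartesianProduct (x ∷ L) K f =
    trans (∑-++ (map (x ,_) K) (cartesianProduct L K) f)
      (cong₂ _+_ (∑-map K (x ,_) f) (∑-cartesianProduct L K f))

  ∑-term : (L : List A) (f : A → ℕ) {x : A} → x ∈ L → f x ≤ ∑ L f
  ∑-term (y ∷ L) f (here refl) = m≤m+n _ _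
  ∑-term (y ∷ L) f (there x∈) = ≤-trans (∑-term L f x∈) (m≤n+m _ (f y))

  length-filter : {R : A → Set} (R? : ∀ x → Dec (R x)) (L : List A) →
    length (filter R? L) ≡ ∑[ x ∈ L ] 𝟙 (R? x)
  length-filter R? [] = refl
  length-filter R? (x ∷ L) with R? x
  ... | yes _ = cong suc (length-filter R? L)
  ... | no _ = length-filter R? L

  Unique-⊆-length : (L K : List A) → Unique L → (∀ x → x ∈ L → x ∈ K) → length L ≤ length K
  Unique-⊆-length [] K u h = z≤n
  Unique-⊆-length (x ∷ L) K (x∉ ∷ u) h with ∈-∃++ (h x (here refl))
  ... | K₁ , K₂ , refl = begin
    suc (length L)               ≤⟨ s≤s (Unique-⊆-length L (K₁ ++ K₂) u sub) ⟩
    suc (length (K₁ ++ K₂))      ≡⟨ cong suc (length-++ K₁) ⟩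
    suc (length K₁ + length K₂)  ≡⟨ sym (+-suc _ _) ⟩
    length K₁ + suc (length K₂)  ≡⟨ sym (length-++ K₁) ⟩
    length (K₁ ++ x ∷ K₂)        ∎
    where
    open ≤-Reasoning
    sub : ∀ y → y ∈ L → y ∈ K₁ ++ K₂
    sub y y∈ with ∈-++⁻ K₁ (h y (there y∈))
    ... | inj₁ y∈₁ = ∈-++⁺ˡ y∈₁
    ... | inj₂ (here refl) = ⊥-elim (All.lookup x∉ y∈ refl)
    ... | inj₂ (there y∈₂) = ∈-++⁺ʳ K₁ y∈₂

  Unique-map-∈ : (f : A → B) (L : List A) → Unique L →
    (∀ x y → x ∈ L → y ∈ L → f x ≡ f y → x ≡ y) → Unique (map f L)
  Unique-map-∈ f [] u inj = []
  Unique-map-∈ f (x ∷ L) (x∉ ∷ u) inj =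
    All.map⁺ (All.tabulate λ {y} y∈ eq → All.lookup x∉ y∈ (inj x y (here refl) (there y∈) eq)) ∷
    Unique-map-∈ f L u λ y z y∈ z∈ → inj y z (there y∈) (there z∈)

  count-injection : {R : A → Set} (R? : ∀ x → Dec (R x)) (L : List A) (K : List B) (f : A → B) → Unique L →
    (∀ x → x ∈ L → R x → f x ∈ K) →
    (∀ x y → x ∈ L → y ∈ L → R x → R y → f x ≡ f y → x ≡ y) →
    ∑[ x ∈ L ] 𝟙 (R? x) ≤ length K
  count-injection R? L K f u into inj = begin
    ∑[ x ∈ L ] 𝟙 (R? x)              ≡⟨ sym (length-filter R? L) ⟩
    length (filter R? L)             ≡⟨ sym (length-map f (filter R? L)) ⟩
    length (map f (filter R? L))     ≤⟨ Unique-⊆-length _ K uniq sub ⟩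
    length K                         ∎
    where
    open ≤-Reasoning
    uniq : Unique (map f (filter R? L))
    uniq = Unique-map-∈ f (filter R? L) (Unique.filter⁺ R? u) λ x y x∈ y∈ eq →
      let (x∈L , rx) = ∈-filter⁻ R? {xs = L} x∈
          (y∈L , ry) = ∈-filter⁻ R? {xs = L} y∈ in inj x y x∈L y∈L rx ry eq
    sub : ∀ y → y ∈ map f (filter R? L) → y ∈ K
    sub y y∈ with ∈-map⁻ f y∈
    ... | x , x∈ , refl = let (x∈L , rx) = ∈-filter⁻ R? {xs = L} x∈ in into x x∈L rx

  count-fibres : {R : A → Set} (R? : ∀ x → Dec (R x)) (_≟B_ : (x y : B) → Dec (x ≡ y))
    (L : List A) (K : List B) (f : A → B) (c : ℕ) →
    (∀ x → x ∈ L → R x → f x ∈ K) →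
    (∀ k → k ∈ K → ∑[ x ∈ L ] 𝟙 (R? x ×-dec (f x ≟B k)) ≤ c) →
    ∑[ x ∈ L ] 𝟙 (R? x) ≤ length K * c
  count-fibres R? _≟B_ L K f c into fib = begin
    ∑[ x ∈ L ] 𝟙 (R? x)                                     ≤⟨ ∑-mono-∈ L term ⟩
    ∑[ x ∈ L ] ∑[ k ∈ K ] 𝟙 (R? x ×-dec (f x ≟B k))         ≡⟨ ∑-swap L K _ ⟩
    ∑[ k ∈ K ] ∑[ x ∈ L ] 𝟙 (R? x ×-dec (f x ≟B k))         ≤⟨ ∑-bound K c fib ⟩
    length K * c                                            ∎
    where
    open ≤-Reasoning
    term : ∀ x → x ∈ L → 𝟙 (R? x) ≤ ∑[ k ∈ K ] 𝟙 (R? x ×-dec (f x ≟B k))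
    term x x∈ = 𝟙≤ (R? x) λ r → ≤-trans
      (≤-reflexive (sym (𝟙-yes (R? x ×-dec (f x ≟B f x)) (r , refl))))
      (∑-term K (λ k → 𝟙 (R? x ×-dec (f x ≟B k))) (into x x∈ r))

  pigeonhole-fibre : (_≟B_ : (x y : B) → Dec (x ≡ y)) (L : List A) (K : List B) (f : A → B) (c : ℕ) →
    (∀ x → x ∈ L → f x ∈ K) → length K * c < length L →
    Σ B λ k → c < length (filter (λ x → f x ≟B k) L)
  pigeonhole-fibre _≟B_ L [] f c into lt with L
  ... | x ∷ _ with () ← into x (here refl)
  pigeonhole-fibre {A = A} _≟B_ L (k ∷ K) f c into lt with c <? length (filter (λ x → f x ≟B k) L)
  ... | yes big = k , big
  ... | no small with pigeonhole-fibre _≟B_ L′ K f c into′ lt′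
    where
    no? : ∀ x → Dec (¬ f x ≡ k)
    no? x = ¬? (f x ≟B k)
    L′ = filter no? L
    into′ : ∀ x → x ∈ L′ → f x ∈ K
    into′ x x∈ with ∈-filter⁻ no? {xs = L} x∈
    ... | x∈L , ne with into x x∈L
    ... | here e = ⊥-elim (ne e)
    ... | there i = i
    split : (xs : List A) → length xs ≡ length (filter (λ x → f x ≟B k) xs) + length (filter no? xs)
    split [] = refl
    split (x ∷ xs) with f x ≟B k
    ... | yes _ = cong suc (split xs)
    ... | no _ = trans (cong suc (split xs)) (sym (+-suc _ _))
    lt′ : length K * c < length L′
    lt′ = +-cancelˡ-< c _ _ (≤-trans lt (≤-trans (≤-reflexive (split L)) (+-monoˡ-≤ _ (≮⇒≥ small))))
  ... | k′ , big = k′ , ≤-trans big (sub L)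
    where
    no? : ∀ x → Dec (¬ f x ≡ k)
    no? x = ¬? (f x ≟B k)
    sub : (xs : List A) → length (filter (λ x → f x ≟B k′) (filter no? xs)) ≤ length (filter (λ x → f x ≟B k′) xs)
    sub [] = z≤n
    sub (x ∷ xs) with f x ≟B k
    sub (x ∷ xs) | yes _ with f x ≟B k′
    ... | yes _ = m≤n⇒m≤1+n (sub xs)
    ... | no _ = sub xs
    sub (x ∷ xs) | no _ with f x ≟B k′
    ... | yes _ = s≤s (sub xs)
    ... | no _ = sub xs

  -- Intervals, sums of inverse squares and geometric sums

  interval : ℕ → ℕ → List ℕ
  interval a zero = []
  interval a (suc k) = a ∷ interval (suc a) k

  length-interval : ∀ a k → length (interval a k) ≡ k
  length-interval a zero = refl
  length-interval a (suc k) = cong suc (length-interval (suc a) k)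

  ∈-interval⁺ : ∀ a k {x} → a ≤ x → x < a + k → x ∈ interval a k
  ∈-interval⁺ a zero a≤x x< = ⊥-elim (<-irrefl refl (≤-<-trans a≤x (subst (_ <_) (+-identityʳ a) x<)))
  ∈-interval⁺ a (suc k) {x} a≤x x< with m≤n⇒m<n∨m≡n a≤x
  ... | inj₁ a<x = there (∈-interval⁺ (suc a) k a<x (subst (x <_) (+-suc a k) x<))
  ... | inj₂ refl = here refl

  ∈-interval⁻ : ∀ a k {x} → x ∈ interval a k → a ≤ x × x < a + k
  ∈-interval⁻ a (suc k) (here refl) = ≤-refl , subst (a <_) (sym (+-suc a k)) (s≤s (m≤m+n a k))
  ∈-interval⁻ a (suc k) {x} (there x∈) with ∈-interval⁻ (suc a) k x∈
  ... | a< , x< = <⇒≤ a< , subst (x <_) (sym (+-suc a k)) x<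

  Unique-interval : ∀ a k → Unique (interval a k)
  Unique-interval a zero = []
  Unique-interval a (suc k) =
    All.tabulate (λ x∈ eq → <-irrefl eq (proj₁ (∈-interval⁻ (suc a) k x∈))) ∷ Unique-interval (suc a) k

  -- Σ 1/x² over x > a is at most 1/a.
  ∑-inverse-squares : ∀ a k (c : ℕ → ℕ) V → (∀ x → suc a ≤ x → x < suc a + k → c x * (x * x) ≤ V) →
    a * ∑ (interval (suc a) k) c ≤ V
  ∑-inverse-squares a zero c V h = ≤-trans (≤-reflexive (*-zeroʳ a)) z≤n
  -- This is the telescoping inequality 1/(a+1)² ≤ 1/a - 1/(a+1), cleared of denominators by the
  -- factor a + 1.
  ∑-inverse-squares a (suc k) c V h = *-cancelˡ-≤ (suc a) (begin
    suc a * (a * (c (suc a) + S))                    ≡⟨ eq a (c (suc a)) S ⟩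
    c (suc a) * (a * suc a) + a * (suc a * S)        ≤⟨ +-mono-≤ (*-monoʳ-≤ (c (suc a)) (*-monoˡ-≤ (suc a) (n≤1+n a)))
                                                          (*-monoʳ-≤ a (∑-inverse-squares (suc a) k c V λ x l u → h x (<⇒≤ l) (subst (x <_) (sym (+-suc (suc a) k)) u))) ⟩
    c (suc a) * (suc a * suc a) + a * V              ≤⟨ +-monoˡ-≤ (a * V) (h (suc a) ≤-refl (s≤s (m<m+n a (s≤s z≤n)))) ⟩
    suc a * V                                        ∎)
    where
    open ≤-Reasoning
    S = ∑ (interval (suc (suc a)) k) c
    eq : ∀ a c s → suc a * (a * (c + s)) ≡ c * (a * suc a) + a * (suc a * s)
    eq = ℕSolver.solve-∀

  -- The previous bound gives V/(P - 1), and P ≤ 2(P - 1) for P ≥ 2.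
  ∑-inverse-squares-tail : ∀ P k (c : ℕ → ℕ) V → 2 ≤ P → (∀ p → P ≤ p → p < P + k → c p * (p * p) ≤ V) → P * ∑ (interval P k) c ≤ 2 * V
  ∑-inverse-squares-tail (suc (suc P)) k c V _ h = begin
    suc (suc P) * S                ≤⟨ *-monoˡ-≤ S (≤-trans (+-monoʳ-≤ 2 (m≤n*m P 2)) (≤-reflexive (sym (*-distribˡ-+ 2 1 P)))) ⟩
    2 * suc P * S                  ≡⟨ *-assoc 2 (suc P) S ⟩
    2 * (suc P * S)                ≤⟨ *-monoʳ-≤ 2 (∑-inverse-squares (suc P) k c V h) ⟩
    2 * V                          ∎
    where
    open ≤-Reasoning
    S = ∑ (interval (suc (suc P)) k) c
  ∑-inverse-squares-tail 1 k c V (s≤s ()) h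

  ∑-geometric : ∀ a k (c : ℕ → ℕ) V → (∀ i → a ≤ i → i < a + k → c i * 2 ^ (i ∸ a) ≤ V) →
    ∑ (interval a k) c ≤ 2 * V
  ∑-geometric a zero c V h = z≤n
  ∑-geometric a (suc k) c V h = *-cancelˡ-≤ 2 (begin
    2 * (c a + S)          ≡⟨ *-distribˡ-+ 2 (c a) S ⟩
    2 * c a + 2 * S        ≤⟨ +-mono-≤ (*-monoʳ-≤ 2 ca≤V) rec ⟩
    2 * V + 2 * V          ≡⟨ eq V ⟩
    2 * (2 * V)            ∎)
    where
    open ≤-Reasoning
    S = ∑ (interval (suc a) k) c
    eq : ∀ v → 2 * v + 2 * v ≡ 2 * (2 * v)
    eq = ℕSolver.solve-∀
    ca≤V : c a ≤ V
    ca≤V = ≤-trans (≤-reflexive (trans (sym (*-identityʳ (c a))) (cong (λ z → c a * 2 ^ z) (sym (n∸n≡0 a)))))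
      (h a ≤-refl (m<m+n a (s≤s z≤n)))
    -- Moving the start from a to a + 1 lowers the weight by a factor 2, so the induction hypothesis
    -- applies to 2c with the same V.
    rec : 2 * S ≤ 2 * V
    rec = ≤-trans (≤-reflexive (sym (∑-*ˡ (interval (suc a) k) 2 c)))
      (∑-geometric (suc a) k (λ i → 2 * c i) V λ i l u →
        ≤-trans (≤-reflexive (pw (c i) i l)) (h i (<⇒≤ l) (subst (i <_) (sym (+-suc a k)) u)))
      where
      pw : ∀ y i → suc a ≤ i → 2 * y * 2 ^ (i ∸ suc a) ≡ y * 2 ^ (i ∸ a)
      pw y i l = trans (lem y (2 ^ (i ∸ suc a))) (cong (λ z → y * 2 ^ z) (sym (+-∸-assoc 1 l)))
        where
        lem : ∀ y z → 2 * y * z ≡ y * (2 * z)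
        lem = ℕSolver.solve-∀

  length-fibres : (_≟B_ : (x y : B) → Dec (x ≡ y)) (L : List A) (K : List B) (f : A → B) (c : ℕ) →
    (∀ x → x ∈ L → f x ∈ K) →
    (∀ k → k ∈ K → length (filter (λ x → f x ≟B k) L) ≤ c) →
    length L ≤ length K * c
  length-fibres _≟B_ L K f c into fib = begin
    length L                                       ≡⟨ sym (*-identityʳ _) ⟩
    length L * 1                                   ≡⟨ sym (∑-const L 1) ⟩
    ∑[ x ∈ L ] 1                                   ≤⟨ ∑-mono-∈ L (λ x x∈ → ≤-trans (≤-reflexive (sym (𝟙-yes (f x ≟B f x) refl)))
                                                        (∑-term K (λ k → 𝟙 (f x ≟B k)) (into x x∈))) ⟩
    ∑[ x ∈ L ] ∑[ k ∈ K ] 𝟙 (f x ≟B k)             ≡⟨ ∑-swap L K _ ⟩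
    ∑[ k ∈ K ] ∑[ x ∈ L ] 𝟙 (f x ≟B k)             ≤⟨ ∑-bound K c (λ k k∈ → ≤-trans (≤-reflexive (sym (length-filter (λ x → f x ≟B k) L))) (fib k k∈)) ⟩
    length K * c                                   ∎
    where open ≤-Reasoning

  length-injection : (L : List A) (K : List B) (f : A → B) → Unique L →
    (∀ x → x ∈ L → f x ∈ K) → (∀ x y → x ∈ L → y ∈ L → f x ≡ f y → x ≡ y) → length L ≤ length K
  length-injection L K f u into inj = ≤-trans (≤-reflexive (sym (length-map f L)))
    (Unique-⊆-length (map f L) K (Unique-map-∈ f L u inj) sub)
    where
    sub : ∀ y → y ∈ map f L → y ∈ K
    sub y y∈ with ∈-map⁻ f y∈
    ... | x , x∈ , refl = into x x∈

  length-cartesianProduct : (L : List A) (K : List B) → length (cartesianProduct L K) ≡ length L * length K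
  length-cartesianProduct [] K = refl
  length-cartesianProduct (x ∷ L) K = trans (length-++ (map (x ,_) K))
    (cong₂ _+_ (length-map (x ,_) K) (length-cartesianProduct L K))

-- Congruences and counting in residue classes

module Congruences where

  open Counting
  open import Data.Nat
  open import Data.Nat.Properties
  open import Data.Nat.DivMod
  open import Data.Integer using (ℤ; +_)
  open import Data.Integer.Divisibility.Signed using (_∣_; divides; _∣?_; ∣⇒∣ᵤ; ∣m⇒∣-m; ∣m∣n⇒∣m+n)

  private variable
    A : Set

  -- Taken over ℤ so that differences need no ordering and ring identities apply directly. The
  -- modulus 0 is allowed and means equality.
  Congruent : ℕ → ℕ → ℕ → Set
  Congruent n x y = + n ∣ (+ x ℤ.- + y)

  Congruent-sym : ∀ {n} x y → Congruent n x y → Congruent n y x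
  Congruent-sym {n} x y h = subst (+ n ∣_) (eq (+ x) (+ y)) (∣m⇒∣-m h)
    where
    eq : ∀ x y → ℤ.- (x ℤ.- y) ≡ y ℤ.- x
    eq = ℤSolver.solve-∀

  Congruent-refl : ∀ {n} x → Congruent n x x
  Congruent-refl x = divides (+ 0) (ℤ.+-inverseʳ (+ x))

  Congruent⇒% : ∀ {n} x y .{{_ : NonZero n}} → Congruent n x y → x % n ≡ y % n
  Congruent⇒% {n} x y h with ≤-total y x
  ... | inj₁ y≤x = trans (cong (_% n) (sym (m+[n∸m]≡n y≤x)))
      (%-remove-+ʳ y (subst (λ z → n ℕᵈ.∣ ℤ.∣ z ∣) (trans (ℤ.m-n≡m⊖n x y) (ℤ.⊖-≥ y≤x)) (∣⇒∣ᵤ h)))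
  ... | inj₂ x≤y = sym (trans (cong (_% n) (sym (m+[n∸m]≡n x≤y)))
      (%-remove-+ʳ x (subst (λ z → n ℕᵈ.∣ ℤ.∣ z ∣) (trans (ℤ.m-n≡m⊖n y x) (ℤ.⊖-≥ x≤y)) (∣⇒∣ᵤ (Congruent-sym x y h)))))

  %⇒Congruent : ∀ {n} x y .{{_ : NonZero n}} → x % n ≡ y % n → Congruent n x y
  %⇒Congruent {n} x y e = divides (+ (x / n) ℤ.- + (y / n)) (begin
    + x ℤ.- + y                                                      ≡⟨ cong₂ ℤ._-_ (expand x) (expand y) ⟩
    (+ (x % n) ℤ.+ + (x / n) ℤ.* + n) ℤ.- (+ (y % n) ℤ.+ + (y / n) ℤ.* + n)
                                                                     ≡⟨ cong (λ z → (+ z ℤ.+ + (x / n) ℤ.* + n) ℤ.- (+ (y % n) ℤ.+ + (y / n) ℤ.* + n)) e ⟩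
    (+ (y % n) ℤ.+ + (x / n) ℤ.* + n) ℤ.- (+ (y % n) ℤ.+ + (y / n) ℤ.* + n)
                                                                     ≡⟨ eq (+ (y % n)) (+ (x / n)) (+ (y / n)) (+ n) ⟩
    (+ (x / n) ℤ.- + (y / n)) ℤ.* + n                                ∎)
    where
    open ≡-Reasoning
    expand : ∀ x → + x ≡ + (x % n) ℤ.+ + (x / n) ℤ.* + n
    expand x = trans (cong +_ (m≡m%n+[m/n]*n x n)) (cong (λ z → + (x % n) ℤ.+ z) (ℤ.pos-* (x / n) n))
    eq : ∀ r a b n → (r ℤ.+ a ℤ.* n) ℤ.- (r ℤ.+ b ℤ.* n) ≡ (a ℤ.- b) ℤ.* n
    eq = ℤSolver.solve-∀

  -- Throughout, numbers in a known residue class are counted by their quotients.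
  Congruent-/⇒≡ : ∀ {n} x y .{{_ : NonZero n}} → Congruent n x y → x / n ≡ y / n → x ≡ y
  Congruent-/⇒≡ {n} x y h e = begin
    x                      ≡⟨ m≡m%n+[m/n]*n x n ⟩
    x % n + (x / n) * n    ≡⟨ cong₂ (λ u v → u + v * n) (Congruent⇒% x y h) e ⟩
    y % n + (y / n) * n    ≡⟨ sym (m≡m%n+[m/n]*n y n) ⟩
    y                      ∎
    where open ≡-Reasoning

  search : {R : A → Set} (R? : ∀ x → Dec (R x)) (L : List A) →
    (∃ λ x → x ∈ L × R x) ⊎ (∀ x → x ∈ L → ¬ R x)
  search R? [] = inj₂ λ x ()
  search R? (x ∷ L) with R? x | search R? L
  ... | yes r | _ = inj₁ (x , here refl , r)
  ... | no _ | inj₁ (y , y∈ , r) = inj₁ (y , there y∈ , r)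
  ... | no ¬r | inj₂ none = inj₂ λ { y (here refl) → ¬r ; y (there y∈) → none y y∈ }

  count-none : {R : A → Set} (R? : ∀ x → Dec (R x)) (L : List A) → (∀ x → x ∈ L → ¬ R x) → ∑[ x ∈ L ] 𝟙 (R? x) ≡ 0
  count-none R? L none = trans (∑-cong-∈ L λ x x∈ → 𝟙-no (R? x) (none x x∈)) (∑-zero L)

  count-class : {R : ℕ → Set} (R? : ∀ x → Dec (R x)) (n a k : ℕ) .{{_ : NonZero n}} →
    (∀ x y → R x → R y → Congruent n x y) →
    ∑[ x ∈ interval a k ] 𝟙 (R? x) ≤ suc (k / n)
  count-class {R} R? n a k one = ≤-trans
    (count-injection R? (interval a k) (interval 0 (suc (k / n))) (λ x → (x ∸ a) / n) (Unique-interval a k)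
      (λ x x∈ _ → ∈-interval⁺ 0 (suc (k / n)) z≤n (s≤s (/-monoˡ-≤ n (≤-trans (∸-monoˡ-≤ a (<⇒≤ (proj₂ (∈-interval⁻ a k x∈)))) (≤-reflexive (m+n∸m≡n a k))))))
      (λ x y x∈ y∈ rx ry e → ∸-cancelʳ-≡ (proj₁ (∈-interval⁻ a k x∈)) (proj₁ (∈-interval⁻ a k y∈))
        (Congruent-/⇒≡ (x ∸ a) (y ∸ a) (shift x y (proj₁ (∈-interval⁻ a k x∈)) (proj₁ (∈-interval⁻ a k y∈)) (one x y rx ry)) e)))
    (≤-reflexive (length-interval 0 (suc (k / n))))
    where
    pos-∸ : ∀ x → a ≤ x → + (x ∸ a) ≡ + x ℤ.- + a
    pos-∸ x l = sym (trans (ℤ.m-n≡m⊖n x a) (ℤ.⊖-≥ l))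
    shift : ∀ x y → a ≤ x → a ≤ y → Congruent n x y → Congruent n (x ∸ a) (y ∸ a)
    shift x y lx ly h = subst (+ n ∣_) (sym (trans (cong₂ ℤ._-_ (pos-∸ x lx) (pos-∸ y ly)) (eq (+ x) (+ y) (+ a)))) h
      where
      eq : ∀ x y a → (x ℤ.- a) ℤ.- (y ℤ.- a) ≡ x ℤ.- y
      eq = ℤSolver.solve-∀

  -- "At most two classes" is expressed by saying that among any three solutions two are congruent,
  -- which is the form in which quadratics deliver it. A first solution `x₀` is the pivot: two
  -- solutions not congruent to it must be congruent to each other.
  count-two-classes : {R : ℕ → Set} (R? : ∀ x → Dec (R x)) (n a k : ℕ) .{{_ : NonZero n}} →
    (∀ x y z → R x → R y → R z → Congruent n x y ⊎ Congruent n x z ⊎ Congruent n y z) →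
    ∑[ x ∈ interval a k ] 𝟙 (R? x) ≤ 2 * suc (k / n)
  count-two-classes {R} R? n a k two with search R? (interval a k)
  ... | inj₂ none = ≤-trans (≤-reflexive (count-none R? _ none)) z≤n
  ... | inj₁ (x₀ , _ , r₀) = begin
    ∑[ x ∈ I ] 𝟙 (R? x)                           ≤⟨ ∑-mono I split ⟩
    ∑[ x ∈ I ] (𝟙 (near? x) + 𝟙 (far? x))         ≡⟨ ∑-+ I _ _ ⟩
    ∑[ x ∈ I ] 𝟙 (near? x) + ∑[ x ∈ I ] 𝟙 (far? x) ≤⟨ +-mono-≤
        (count-class near? n a k λ { x y (_ , hx) (_ , hy) → via x y hx hy })
        (count-class far? n a k λ { x y (rx , nx) (ry , ny) → pick x y nx ny (two x₀ x y r₀ rx ry) }) ⟩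
    suc (k / n) + suc (k / n)                     ≡⟨ cong (λ z → suc (k / n) + z) (sym (+-identityʳ _)) ⟩
    2 * suc (k / n)                               ∎
    where
    open ≤-Reasoning
    I = interval a k
    cong? : ∀ x → Dec (Congruent n x₀ x)
    cong? x = + n ∣? _
    near? : ∀ x → Dec (R x × Congruent n x₀ x)
    near? x = R? x ×-dec cong? x
    far? : ∀ x → Dec (R x × ¬ Congruent n x₀ x)
    far? x = R? x ×-dec ¬? (cong? x)
    split : ∀ x → 𝟙 (R? x) ≤ 𝟙 (near? x) + 𝟙 (far? x)
    split x with R? x | cong? x
    ... | yes _ | yes _ = s≤s z≤n
    ... | yes _ | no _ = ≤-refl
    ... | no _ | _ = z≤n
    via : ∀ x y → Congruent n x₀ x → Congruent n x₀ y → Congruent n x y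
    via x y hx hy = subst (+ n ∣_) (eq (+ x) (+ x₀) (+ y)) (∣m∣n⇒∣m+n (Congruent-sym x₀ x hx) hy)
      where
      eq : ∀ x z y → (x ℤ.- z) ℤ.+ (z ℤ.- y) ≡ x ℤ.- y
      eq = ℤSolver.solve-∀
    pick : ∀ x y → ¬ Congruent n x₀ x → ¬ Congruent n x₀ y →
      Congruent n x₀ x ⊎ Congruent n x₀ y ⊎ Congruent n x y → Congruent n x y
    pick x y nx ny (inj₁ h) = ⊥-elim (nx h)
    pick x y nx ny (inj₂ (inj₁ h)) = ⊥-elim (ny h)
    pick x y nx ny (inj₂ (inj₂ h)) = h

  -- A form of Cauchy–Schwarz: R pairs each class with at most one class, and a product
  -- of class sizes is at most the square of the larger one.
  count-partial-matching : {_~_ R : A → A → Set} (_~?_ : ∀ x y → Dec (x ~ y)) (R? : ∀ x y → Dec (R x y)) (L : List A) →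
    (∀ x y z → x ∈ L → y ∈ L → z ∈ L → R x y → R x z → y ~ z) →
    (∀ x y z → x ∈ L → y ∈ L → z ∈ L → R x z → R y z → x ~ y) →
    ∑[ x ∈ L ] ∑[ y ∈ L ] 𝟙 (R? x y) ≤ 2 * ∑[ x ∈ L ] ∑[ y ∈ L ] 𝟙 (x ~? y)
  count-partial-matching {A = A} {_~_} {R} _~?_ R? L right left = begin
    ∑[ x ∈ L ] ∑[ y ∈ L ] 𝟙 (R? x y)
      ≤⟨ ∑-mono L (λ x → ∑-mono L λ y → split x y) ⟩
    ∑[ x ∈ L ] ∑[ y ∈ L ] (𝟙 (R₁? x y) + 𝟙 (R₂? x y))
      ≡⟨ ∑-cong L (λ x → ∑-+ L _ _) ⟩
    ∑[ x ∈ L ] (∑ L (λ y → 𝟙 (R₁? x y)) + ∑ L (λ y → 𝟙 (R₂? x y)))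
      ≡⟨ ∑-+ L _ _ ⟩
    ∑[ x ∈ L ] ∑[ y ∈ L ] 𝟙 (R₁? x y) + ∑[ x ∈ L ] ∑[ y ∈ L ] 𝟙 (R₂? x y)
      ≡⟨ cong (λ z → ∑ L (λ x → ∑ L λ y → 𝟙 (R₁? x y)) + z) (∑-swap L L _) ⟩
    ∑[ x ∈ L ] ∑[ y ∈ L ] 𝟙 (R₁? x y) + ∑[ y ∈ L ] ∑[ x ∈ L ] 𝟙 (R₂? x y)
      ≤⟨ +-mono-≤ (∑-mono-∈ L bound₁) (∑-mono-∈ L bound₂) ⟩
    ∑ L m + ∑ L m
      ≡⟨ cong (λ z → ∑ L m + z) (sym (+-identityʳ _)) ⟩
    2 * ∑ L m ∎
    where
    open ≤-Reasoning
    m : A → ℕ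
    m x = ∑[ y ∈ L ] 𝟙 (x ~? y)
    R₁? : ∀ x y → Dec (R x y × m y ≤ m x)
    R₁? x y = R? x y ×-dec (m y ≤? m x)
    R₂? : ∀ x y → Dec (R x y × m x ≤ m y)
    R₂? x y = R? x y ×-dec (m x ≤? m y)
    split : ∀ x y → 𝟙 (R? x y) ≤ 𝟙 (R₁? x y) + 𝟙 (R₂? x y)
    split x y = 𝟙≤ (R? x y) λ r → go r (≤-total (m y) (m x))
      where
      go : R x y → m y ≤ m x ⊎ m x ≤ m y → 1 ≤ 𝟙 (R₁? x y) + 𝟙 (R₂? x y)
      go r (inj₁ l) = ≤-trans (≤-reflexive (sym (𝟙-yes (R₁? x y) (r , l)))) (m≤m+n _ _)
      go r (inj₂ l) = ≤-trans (≤-reflexive (sym (𝟙-yes (R₂? x y) (r , l)))) (m≤n+m _ _)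
    bound₁ : ∀ x → x ∈ L → ∑[ y ∈ L ] 𝟙 (R₁? x y) ≤ m x
    bound₁ x x∈ with search (R₁? x) L
    ... | inj₂ none = ≤-trans (≤-reflexive (count-none (R₁? x) L none)) z≤n
    -- All partners of x lie in the class of the one partner z, whose size is at most that of the
    -- class of x by `le`.
    ... | inj₁ (z , z∈ , rz , le) = ≤-trans
      (∑-mono-∈ L λ y y∈ → 𝟙-mono (R₁? x y) (z ~? y) λ (r , _) → right x z y x∈ z∈ y∈ rz r) le
    bound₂ : ∀ y → y ∈ L → ∑[ x ∈ L ] 𝟙 (R₂? x y) ≤ m y
    bound₂ y y∈ with search (λ x → R₂? x y) L
    ... | inj₂ none = ≤-trans (≤-reflexive (count-none (λ x → R₂? x y) L none)) z≤n
    ... | inj₁ (z , z∈ , rz , le) = ≤-trans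
      (∑-mono-∈ L λ x x∈ → 𝟙-mono (R₂? x y) (z ~? x) λ (r , _) → left z x y z∈ x∈ y∈ rz r) le

-- The divisor bound

module Divisors where

  open Counting
  open import Data.Nat
  open import Data.Nat.Properties
  open import Data.Nat.DivMod using (_/_; _%_; m≡m%n+[m/n]*n; m%n<n; m/n*n≤m)
  open import Data.Nat.Divisibility
  open import Data.Nat.Primality
  open import Data.Nat.Primality.Factorisation using (factorise)
  open import Data.Nat.Coprimality using (Coprime; coprime-divisor)
  open import Data.Nat.Induction using (<-wellFounded)
  open import Induction.WellFounded using (Acc; acc)
  open import Data.Nat.ListAction using (product)

  divisors : ℕ → List ℕ
  divisors n = filter (_∣? n) (interval 1 n)

  #divisors : ℕ → ℕ
  #divisors n = length (divisors n)

  ∈-divisors⁺ : ∀ {d n} → 1 ≤ n → d ∣ n → d ∈ divisors n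
  ∈-divisors⁺ {zero} 1≤n d∣n = ⊥-elim (<-irrefl refl (subst (1 ≤_) (0∣⇒≡0 d∣n) 1≤n))
  ∈-divisors⁺ {suc d} {n} 1≤n d∣n =
    ∈-filter⁺ (_∣? n) (∈-interval⁺ 1 n (s≤s z≤n) (s≤s (∣⇒≤ {{>-nonZero 1≤n}} d∣n))) d∣n

  ∈-divisors⁻ : ∀ {d n} → d ∈ divisors n → d ∣ n
  ∈-divisors⁻ {d} {n} d∈ = proj₂ (∈-filter⁻ (_∣? n) {xs = interval 1 n} d∈)

  Unique-divisors : ∀ n → Unique (divisors n)
  Unique-divisors n = Unique.filter⁺ (_∣? n) (Unique-interval 1 n)

  prime-divisor : ∀ n → 2 ≤ n → ∃ λ p → Prime p × p ∣ n
  prime-divisor n 2≤n with factorise n {{>-nonZero (≤-trans (n≤1+n 1) 2≤n)}}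
  ... | record { factors = [] ; isFactorisation = refl } = ⊥-elim (<-irrefl refl 2≤n)
  ... | record { factors = p ∷ ps ; isFactorisation = refl ; factorsPrime = pp ∷ _ } = p , pp , m∣m*n (product ps)

  prime∤⇒coprime : ∀ {p e} → Prime p → ¬ p ∣ e → Coprime e p
  prime∤⇒coprime {p} {e} pp p∤e (d∣e , d∣p) with prime⇒irreducible pp d∣p
  ... | inj₁ d≡1 = d≡1
  ... | inj₂ refl = ⊥-elim (p∤e d∣e)

  2≤prime : ∀ {p} → Prime p → 2 ≤ p
  2≤prime pp = nonTrivial⇒n>1 _ {{prime⇒nonTrivial pp}}

  module _ {p : ℕ} (pp : Prime p) where

    private
      instance
        p≢0 : NonZero p
        p≢0 = prime⇒nonZero pp

      strip : ∀ {e} a m → ¬ p ∣ e → e ∣ p ^ a * m → e ∣ m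
      strip zero m _ h = subst (_ ∣_) (+-identityʳ m) h
      strip {e} (suc a) m p∤e h = strip a m p∤e
        (coprime-divisor (prime∤⇒coprime pp p∤e) (subst (e ∣_) (*-assoc p (p ^ a) m) h))

      -- An overlist of the divisors of p^a m: the products p^i e with i ≤ a and e a divisor of m.
      -- Repetitions are harmless, since only the length (a + 1) d(m) matters.
      cover : ℕ → ℕ → List ℕ
      cover zero m = divisors m
      cover (suc a) m = divisors m ++ map (p *_) (cover a m)

      length-cover : ∀ a m → length (cover a m) ≡ suc a * #divisors m
      length-cover zero m = sym (+-identityʳ _)
      length-cover (suc a) m = trans (length-++ (divisors m))
        (cong (#divisors m +_) (trans (length-map (p *_) (cover a m)) (length-cover a m)))

      ∈-cover : ∀ a m {e} → 1 ≤ m → e ∣ p ^ a * m → e ∈ cover a m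
      ∈-cover zero m 1≤m h = ∈-divisors⁺ 1≤m (subst (_ ∣_) (+-identityʳ m) h)
      ∈-cover (suc a) m {e} 1≤m h with p ∣? e
      ... | no p∤e = ∈-++⁺ˡ (∈-divisors⁺ 1≤m (strip (suc a) m p∤e h))
      ... | yes (divides k refl) = ∈-++⁺ʳ (divisors m) (subst (_∈ map (p *_) (cover a m)) (*-comm p k)
        (∈-map⁺ (p *_) (∈-cover a m 1≤m (*-cancelˡ-∣ p (subst₂ _∣_ (*-comm k p) (*-assoc p (p ^ a) m) h)))))

    #divisors-prime-power : ∀ a m → 1 ≤ m → #divisors (p ^ a * m) ≤ suc a * #divisors m
    #divisors-prime-power a m 1≤m = ≤-trans
      (Unique-⊆-length (divisors (p ^ a * m)) (cover a m) (Unique-divisors (p ^ a * m))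
        (λ e e∈ → ∈-cover a m 1≤m (∈-divisors⁻ e∈)))
      (≤-reflexive (length-cover a m))

    #divisors-prime : ∀ m → 1 ≤ m → #divisors (p * m) ≤ 2 * #divisors m
    #divisors-prime m 1≤m = subst (λ z → #divisors (z * m) ≤ 2 * #divisors m) (*-identityʳ p) (#divisors-prime-power 1 m 1≤m)

  factor-out : ∀ p → 2 ≤ p → ∀ n → 1 ≤ n → ∃ λ a → ∃ λ m → n ≡ p ^ a * m × ¬ p ∣ m
  factor-out p 2≤p n 1≤n = go n 1≤n (<-wellFounded n)
    where
    go : ∀ n → 1 ≤ n → Acc _<_ n → ∃ λ a → ∃ λ m → n ≡ p ^ a * m × ¬ p ∣ m
    go n 1≤n (acc rec) with p ∣? n
    ... | no p∤n = 0 , n , sym (+-identityʳ n) , p∤n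
    ... | yes (divides k refl) = let (a , m , e , h) = go k 1≤k (rec k<) in
        suc a , m , trans (*-comm k p) (trans (cong (p *_) e) (sym (*-assoc p (p ^ a) m))) , h
      where
      1≤k : 1 ≤ k
      1≤k = n≢0⇒n>0 λ { refl → <-irrefl refl 1≤n }
      k< : k < k * p
      k< = m<m*n k p {{>-nonZero 1≤k}} 2≤p

  1≤*ʳ : ∀ {m} n → 1 ≤ n * m → 1 ≤ m
  1≤*ʳ {zero} n h = ⊥-elim (<-irrefl refl (subst (1 ≤_) (*-zeroʳ n) h))
  1≤*ʳ {suc m} n h = s≤s z≤n

  n<2^n : ∀ n → suc n ≤ 2 ^ n
  n<2^n zero = ≤-refl
  n<2^n (suc n) = begin
    suc (suc n)       ≤⟨ +-mono-≤ (m^n>0 2 n) (n<2^n n) ⟩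
    2 ^ n + 2 ^ n     ≡⟨ cong (2 ^ n +_) (sym (+-identityʳ _)) ⟩
    2 ^ suc n         ∎
    where open ≤-Reasoning

  ^-distribʳ-* : ∀ m n o → (m * n) ^ o ≡ m ^ o * n ^ o
  ^-distribʳ-* m n zero = refl
  ^-distribʳ-* m n (suc o) rewrite ^-distribʳ-* m n o = [m*n]*[o*p]≡[m*o]*[n*p] m n (m ^ o) (n ^ o)

  module _ (k : ℕ) .{{_ : NonZero k}} where

    private
      -- Division by k gives a + 1 ≤ k (a/k + 1) ≤ k 2^(a/k), and the k-th power of the last factor
      -- is at most 2^a.
      power≤exponential : ∀ a → suc a ^ k ≤ k ^ k * 2 ^ a
      power≤exponential a = begin
        suc a ^ k                  ≤⟨ ^-monoˡ-≤ k sa≤ ⟩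
        (k * 2 ^ (a / k)) ^ k      ≡⟨ ^-distribʳ-* k (2 ^ (a / k)) k ⟩
        k ^ k * (2 ^ (a / k)) ^ k  ≡⟨ cong (k ^ k *_) (^-*-assoc 2 (a / k) k) ⟩
        k ^ k * 2 ^ (a / k * k)    ≤⟨ *-monoʳ-≤ (k ^ k) (^-monoʳ-≤ 2 (m/n*n≤m a k)) ⟩
        k ^ k * 2 ^ a              ∎
        where
        open ≤-Reasoning
        sa≤ : suc a ≤ k * 2 ^ (a / k)
        sa≤ = begin
          suc a                        ≡⟨ cong suc (m≡m%n+[m/n]*n a k) ⟩
          suc (a % k) + a / k * k      ≤⟨ +-monoˡ-≤ (a / k * k) (m%n<n a k) ⟩
          suc (a / k) * k              ≡⟨ *-comm (suc (a / k)) k ⟩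
          k * suc (a / k)              ≤⟨ *-monoʳ-≤ k (n<2^n (a / k)) ⟩
          k * 2 ^ (a / k)              ∎

      -- A prime factor p at most doubles the number of divisors, hence multiplies its k-th power by
      -- at most 2^k, and p itself pays for that.
      rough-bound : ∀ n → 1 ≤ n → (∀ p → Prime p → p ∣ n → 2 ^ k ≤ p) → #divisors n ^ k ≤ n
      rough-bound n 1≤n rough = go n 1≤n rough (<-wellFounded n)
        where
        go : ∀ n → 1 ≤ n → (∀ p → Prime p → p ∣ n → 2 ^ k ≤ p) → Acc _<_ n → #divisors n ^ k ≤ n
        go 1 _ _ _ = ≤-reflexive (^-zeroˡ k)
        go n@(suc (suc n′)) 1≤n rough (acc rec) with prime-divisor n (s≤s (s≤s z≤n))
        ... | p , pp , divides m e = begin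
          #divisors n ^ k                ≡⟨ cong (λ z → #divisors z ^ k) n≡ ⟩
          #divisors (p * m) ^ k          ≤⟨ ^-monoˡ-≤ k (#divisors-prime pp m 1≤m) ⟩
          (2 * #divisors m) ^ k          ≡⟨ ^-distribʳ-* 2 (#divisors m) k ⟩
          2 ^ k * #divisors m ^ k        ≤⟨ *-mono-≤ (rough p pp (divides m e))
                                              (go m 1≤m (λ r rp r∣m → rough r rp (∣-trans r∣m (divides p n≡))) (rec m<n)) ⟩
          p * m                          ≡⟨ sym n≡ ⟩
          n                              ∎
          where
          open ≤-Reasoning
          n≡ : n ≡ p * m
          n≡ = trans e (*-comm m p)
          1≤m : 1 ≤ m
          1≤m = 1≤*ʳ p (subst (1 ≤_) n≡ 1≤n)
          m<n : m < n
          m<n = subst (m <_) (sym e) (m<m*n m p {{>-nonZero 1≤m}} (2≤prime pp))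

      -- Induction from the rough case downwards. Lowering the threshold from j + 1 to j admits at
      -- most the prime j, and its power j^a multiplies d(n)^k by at most (a + 1)^k ≤ k^k 2^a ≤ k^k
      -- j^a. So each prime below 2^k costs one factor k^k in the constant.
      sifted-bound : ∀ i j → i + j ≡ 2 ^ k →
        ∃ λ C → ∀ n → 1 ≤ n → (∀ p → Prime p → p ∣ n → j ≤ p) → #divisors n ^ k ≤ C * n
      sifted-bound zero j refl = 1 , λ n 1≤n h → ≤-trans (rough-bound n 1≤n h) (≤-reflexive (sym (+-identityʳ n)))
      sifted-bound (suc i) j e with sifted-bound i (suc j) (trans (+-suc i j) e) | prime? j
      ... | C , bound | no ¬pj = C , λ n 1≤n h → bound n 1≤n λ p pp p∣n → ≤∧≢⇒< (h p pp p∣n) λ { refl → ¬pj pp }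
      ... | C , bound | yes pj = k ^ k * C , λ n 1≤n h → stepped n 1≤n h (factor-out j (2≤prime pj) n 1≤n)
        where
        open ≤-Reasoning
        rearrange : ∀ a b c d → a * b * (c * d) ≡ a * c * (b * d)
        rearrange = ℕSolver.solve-∀
        stepped : ∀ n → 1 ≤ n → (∀ p → Prime p → p ∣ n → j ≤ p) →
          (∃ λ a → ∃ λ m → n ≡ j ^ a * m × ¬ j ∣ m) → #divisors n ^ k ≤ k ^ k * C * n
        stepped n 1≤n h (a , m , refl , j∤m) = begin
          #divisors (j ^ a * m) ^ k          ≤⟨ ^-monoˡ-≤ k (#divisors-prime-power pj a m 1≤m) ⟩
          (suc a * #divisors m) ^ k          ≡⟨ ^-distribʳ-* (suc a) (#divisors m) k ⟩
          suc a ^ k * #divisors m ^ k        ≤⟨ *-mono-≤ (power≤exponential a)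
                                                  (bound m 1≤m λ p pp p∣m → ≤∧≢⇒< (h p pp (∣n⇒∣m*n (j ^ a) p∣m)) λ { refl → j∤m p∣m }) ⟩
          k ^ k * 2 ^ a * (C * m)            ≤⟨ *-monoˡ-≤ (C * m) (*-monoʳ-≤ (k ^ k) (^-monoˡ-≤ a (2≤prime pj))) ⟩
          k ^ k * j ^ a * (C * m)            ≡⟨ rearrange (k ^ k) (j ^ a) C m ⟩
          k ^ k * C * (j ^ a * m)            ∎
          where
          1≤m : 1 ≤ m
          1≤m = 1≤*ʳ (j ^ a) 1≤n

    -- The usual d(n) ≪ n^ε for ε = 1/k, raised to the power k to stay among natural numbers.
    divisor-bound : ∃ λ C → ∀ n → 1 ≤ n → #divisors n ^ k ≤ C * n
    divisor-bound = let (C , h) = sifted-bound (2 ^ k) 0 (+-identityʳ _) in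
      C , λ n 1≤n → h n 1≤n λ _ _ _ → z≤n

-- Representations as sums of two squares

module TwoSquares where

  open Counting
  open Divisors
  open import Data.Nat
  open import Data.Nat.Properties
  open import Data.Nat.Divisibility
  open import Data.Nat.Primality
  open import Data.Nat.Coprimality using (Coprime; coprime-divisor)
  import Data.Nat.Coprimality as Coprime
  open import Data.Nat.GCD
  open import Data.Nat.DivMod using (_/_; m/n*n≡m)
  open import Data.Integer using (ℤ; +_; -[1+_])
  import Data.Integer.Divisibility.Signed as ℤᵈ

  IsRep : ℕ → ℕ × ℕ → Set
  IsRep m (x , y) = x * x + y * y ≡ m

  private
    ∣ℤ⇒∣ : ∀ {d z} → + d ℤᵈ.∣ z → d ∣ ℤ.∣ z ∣
    ∣ℤ⇒∣ = ℤᵈ.∣⇒∣ᵤ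

    ∣⇒∣ℤ : ∀ {d z} → d ∣ ℤ.∣ z ∣ → + d ℤᵈ.∣ z
    ∣⇒∣ℤ = ℤᵈ.∣ᵤ⇒∣

  prime∣square : ∀ {p x} → Prime p → p ∣ x * x → p ∣ x
  prime∣square {p} {x} pp h with euclidsLemma x x pp h
  ... | inj₁ d = d
  ... | inj₂ d = d

  square-injective : ∀ {x y} → x * x ≡ y * y → x ≡ y
  square-injective {x} {y} e with <-cmp x y
  ... | tri< l _ _ = ⊥-elim (<-irrefl e (*-mono-< l l))
  ... | tri≈ _ e′ _ = e′
  ... | tri> _ _ g = ⊥-elim (<-irrefl (sym e) (*-mono-< g g))

  module Primitive (m : ℕ) (1≤m : 1 ≤ m) (odd : ¬ 2 ∣ m) (x₀ y₀ : ℕ) (r₀ : IsRep m (x₀ , y₀)) (cop₀ : Coprime x₀ y₀) where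

    D : ℕ × ℕ → ℤ
    D (x , y) = + x ℤ.* + y₀ ℤ.- + y ℤ.* + x₀

    S : ℕ × ℕ → ℤ
    S (x , y) = + x ℤ.* + y₀ ℤ.+ + y ℤ.* + x₀

    -- Modulo each prime power in m the ratio x : y of a primitive representation is plus or minus
    -- x₀ : y₀, both being square roots of -1. The divisor d collects the prime powers with the plus
    -- sign (where D vanishes), its cofactor those with the minus sign (where S vanishes). Thus d
    -- determines the ratio modulo m.
    d : ℕ × ℕ → ℕ
    d z = gcd ℤ.∣ D z ∣ m

    d∣m : ∀ z → d z ∣ m
    d∣m z = gcd[m,n]∣n ℤ.∣ D z ∣ m

    repℤ : ∀ x y → IsRep m (x , y) → + x ℤ.* + x ℤ.+ + y ℤ.* + y ≡ + m
    repℤ x y r = trans (cong₂ ℤ._+_ (sym (ℤ.pos-* x x)) (sym (ℤ.pos-* y y))) (cong +_ r)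

    m∣DS : ∀ z → IsRep m z → m ∣ ℤ.∣ D z ∣ * ℤ.∣ S z ∣
    m∣DS z@(x , y) r = subst (m ∣_) (ℤ.abs-* (D z) (S z)) (∣ℤ⇒∣ (ℤᵈ.divides (+ y₀ ℤ.* + y₀ ℤ.- + y ℤ.* + y)
      (begin
        D z ℤ.* S z
          ≡⟨ eq₁ (+ x) (+ y) (+ x₀) (+ y₀) ⟩
        (+ x ℤ.* + x ℤ.+ + y ℤ.* + y) ℤ.* (+ y₀ ℤ.* + y₀) ℤ.- (+ x₀ ℤ.* + x₀ ℤ.+ + y₀ ℤ.* + y₀) ℤ.* (+ y ℤ.* + y)
          ≡⟨ cong₂ (λ u v → u ℤ.* (+ y₀ ℤ.* + y₀) ℤ.- v ℤ.* (+ y ℤ.* + y)) (repℤ x y r) (repℤ x₀ y₀ r₀) ⟩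
        + m ℤ.* (+ y₀ ℤ.* + y₀) ℤ.- + m ℤ.* (+ y ℤ.* + y)
          ≡⟨ eq₂ (+ m) (+ y₀ ℤ.* + y₀) (+ y ℤ.* + y) ⟩
        (+ y₀ ℤ.* + y₀ ℤ.- + y ℤ.* + y) ℤ.* + m ∎)))
      where
      open ≡-Reasoning
      eq₁ : ∀ x y u v → (x ℤ.* v ℤ.- y ℤ.* u) ℤ.* (x ℤ.* v ℤ.+ y ℤ.* u) ≡
        (x ℤ.* x ℤ.+ y ℤ.* y) ℤ.* (v ℤ.* v) ℤ.- (u ℤ.* u ℤ.+ v ℤ.* v) ℤ.* (y ℤ.* y)
      eq₁ = ℤSolver.solve-∀
      eq₂ : ∀ m a b → m ℤ.* a ℤ.- m ℤ.* b ≡ (a ℤ.- b) ℤ.* m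
      eq₂ = ℤSolver.solve-∀

    m∣dS : ∀ z → IsRep m z → m ∣ d z * ℤ.∣ S z ∣
    m∣dS z r = subst (m ∣_) (trans (sym (c*gcd[m,n]≡gcd[cm,cn] s ℤ.∣ D z ∣ m)) (*-comm s (d z)))
      (gcd-greatest (subst (m ∣_) (*-comm ℤ.∣ D z ∣ s) (m∣DS z r)) (n∣m*n s))
      where s = ℤ.∣ S z ∣

    cancel-coprime : ∀ {i} (T : ℤ) → + i ℤᵈ.∣ + x₀ ℤ.* T → + i ℤᵈ.∣ + y₀ ℤ.* T → i ∣ ℤ.∣ T ∣
    cancel-coprime {i} T hx hy = Coprime.coprime-factors cop₀
      (subst (i ∣_) (ℤ.abs-* (+ x₀) T) (∣ℤ⇒∣ hx) , subst (i ∣_) (ℤ.abs-* (+ y₀) T) (∣ℤ⇒∣ hy))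

    primitive-rep-coprime : ∀ {x y p} → IsRep m (x , y) → Coprime x y → Prime p → p ∣ m → ¬ p ∣ x × ¬ p ∣ y
    primitive-rep-coprime {x} {y} {p} r cop pp p∣m = (λ p∣x → notboth p∣x (other p∣x)) , λ p∣y → notboth (other′ p∣y) p∣y
      where
      notboth : p ∣ x → p ∣ y → ⊥
      notboth px py with cop (px , py)
      ... | refl = ¬prime[1] pp
      other : p ∣ x → p ∣ y
      other px = prime∣square pp (∣m+n∣m⇒∣n (subst (p ∣_) (sym r) p∣m) (∣m⇒∣m*n x px))
      other′ : p ∣ y → p ∣ x
      other′ py = prime∣square pp (∣m+n∣m⇒∣n (subst (p ∣_) (trans (sym r) (+-comm (x * x) (y * y))) p∣m) (∣m⇒∣m*n y py))

    -- A common prime of d and e would divide D + S = 2 x y₀. It is not 2 because m is odd, and it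
    -- divides neither x nor y₀ because both representations are primitive.
    coprime-cofactor : ∀ z e → IsRep m z → Coprime (proj₁ z) (proj₂ z) → e * d z ≡ m → e ∣ ℤ.∣ S z ∣ → Coprime (d z) e
    coprime-cofactor z@(x , y) e r cop ed e∣S {i} (i∣d , i∣e) with <-cmp i 1
    ... | tri≈ _ i≡1 _ = i≡1
    ... | tri< (s≤s z≤n) _ _ = ⊥-elim (<-irrefl refl
      (subst (1 ≤_) (trans (sym ed) (trans (cong (e *_) (0∣⇒≡0 i∣d)) (*-zeroʳ e))) 1≤m))
    ... | tri> _ _ 1<i with prime-divisor i 1<i
    ... | p , pp , p∣i = ⊥-elim (contra (euclidsLemma 2 (x * y₀) pp p∣2xy₀))
      where
      p∣m : p ∣ m
      p∣m = ∣-trans (∣-trans p∣i i∣d) (d∣m z)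
      p∣D : + p ℤᵈ.∣ D z
      p∣D = ∣⇒∣ℤ (∣-trans (∣-trans p∣i i∣d) (gcd[m,n]∣m ℤ.∣ D z ∣ m))
      p∣S : + p ℤᵈ.∣ S z
      p∣S = ∣⇒∣ℤ (∣-trans (∣-trans p∣i i∣e) e∣S)
      sumDS : ∀ x y u v → (x ℤ.* v ℤ.- y ℤ.* u) ℤ.+ (x ℤ.* v ℤ.+ y ℤ.* u) ≡ + 2 ℤ.* (x ℤ.* v)
      sumDS = ℤSolver.solve-∀
      p∣2xy₀ : p ∣ 2 * (x * y₀)
      p∣2xy₀ = subst (p ∣_) (trans (ℤ.abs-* (+ 2) (+ x ℤ.* + y₀)) (cong (2 *_) (ℤ.abs-* (+ x) (+ y₀))))
        (∣ℤ⇒∣ (subst (+ p ℤᵈ.∣_) (sumDS (+ x) (+ y) (+ x₀) (+ y₀)) (ℤᵈ.∣m∣n⇒∣m+n p∣D p∣S)))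
      contra : p ∣ 2 ⊎ p ∣ x * y₀ → ⊥
      contra (inj₁ p∣2) with prime⇒irreducible prime[2] p∣2
      ... | inj₁ refl = ¬prime[1] pp
      ... | inj₂ refl = odd p∣m
      contra (inj₂ h) with euclidsLemma x y₀ pp h
      ... | inj₁ p∣x = proj₁ (primitive-rep-coprime r cop pp p∣m) p∣x
      ... | inj₂ p∣y₀ = proj₂ (primitive-rep-coprime r₀ cop₀ pp p∣m) p∣y₀

    T : ℕ × ℕ → ℕ × ℕ → ℤ
    T (x₁ , y₁) (x₂ , y₂) = + x₁ ℤ.* + y₂ ℤ.- + x₂ ℤ.* + y₁

    -- Modulo d both points are proportional to (x₀, y₀), modulo e both are proportional to (x₀,
    -- -y₀). Their determinant T therefore vanishes modulo d and modulo e, which are coprime with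
    -- product m.
    m∣T : ∀ z w → IsRep m z → IsRep m w → Coprime (proj₁ z) (proj₂ z) → d z ≡ d w → m ∣ ℤ.∣ T z w ∣
    m∣T z@(x₁ , y₁) w@(x₂ , y₂) rz rw cop dz≡dw with d∣m z
    ... | divides e m≡ed = subst (_∣ ℤ.∣ T z w ∣) (sym m≡ed) (coprime-product (d∣T , e∣T))
      where
      instance
        d≢0 : NonZero (d z)
        d≢0 = >-nonZero (1≤*ʳ e (subst (1 ≤_) m≡ed 1≤m))
      e∣S : ∀ v → IsRep m v → d z ≡ d v → e ∣ ℤ.∣ S v ∣
      e∣S v r eq = *-cancelʳ-∣ (d z) (subst₂ _∣_ m≡ed (trans (cong (_* ℤ.∣ S v ∣) (sym eq)) (*-comm (d z) _)) (m∣dS v r))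
      cop-de : Coprime (d z) e
      cop-de = coprime-cofactor z e rz cop (sym m≡ed) (e∣S z rz refl)
      coprime-product : ∀ {t} → d z ∣ t × e ∣ t → e * d z ∣ t
      coprime-product (divides k refl , e∣t) = *-monoˡ-∣ (d z)
        (coprime-divisor (Coprime.sym cop-de) (subst (e ∣_) (*-comm k (d z)) e∣t))
      comb : ∀ {i a b c} f g → + i ℤᵈ.∣ a → + i ℤᵈ.∣ b → f ℤ.* a ℤ.- g ℤ.* b ≡ c → + i ℤᵈ.∣ c
      comb {i} f g ha hb eq = subst (+ i ℤᵈ.∣_) eq (ℤᵈ.∣m∣n⇒∣m-n (ℤᵈ.∣n⇒∣m*n f ha) (ℤᵈ.∣n⇒∣m*n g hb))
      i₁ : ∀ x₁ y₁ x₂ y₂ u v → x₂ ℤ.* (x₁ ℤ.* v ℤ.- y₁ ℤ.* u) ℤ.- x₁ ℤ.* (x₂ ℤ.* v ℤ.- y₂ ℤ.* u) ≡ u ℤ.* (x₁ ℤ.* y₂ ℤ.- x₂ ℤ.* y₁)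
      i₁ = ℤSolver.solve-∀
      i₂ : ∀ x₁ y₁ x₂ y₂ u v → y₂ ℤ.* (x₁ ℤ.* v ℤ.- y₁ ℤ.* u) ℤ.- y₁ ℤ.* (x₂ ℤ.* v ℤ.- y₂ ℤ.* u) ≡ v ℤ.* (x₁ ℤ.* y₂ ℤ.- x₂ ℤ.* y₁)
      i₂ = ℤSolver.solve-∀
      i₃ : ∀ x₁ y₁ x₂ y₂ u v → x₁ ℤ.* (x₂ ℤ.* v ℤ.+ y₂ ℤ.* u) ℤ.- x₂ ℤ.* (x₁ ℤ.* v ℤ.+ y₁ ℤ.* u) ≡ u ℤ.* (x₁ ℤ.* y₂ ℤ.- x₂ ℤ.* y₁)
      i₃ = ℤSolver.solve-∀
      i₄ : ∀ x₁ y₁ x₂ y₂ u v → y₂ ℤ.* (x₁ ℤ.* v ℤ.+ y₁ ℤ.* u) ℤ.- y₁ ℤ.* (x₂ ℤ.* v ℤ.+ y₂ ℤ.* u) ≡ v ℤ.* (x₁ ℤ.* y₂ ℤ.- x₂ ℤ.* y₁)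
      i₄ = ℤSolver.solve-∀
      dD : ∀ v → d z ≡ d v → + d z ℤᵈ.∣ D v
      dD v eq = ∣⇒∣ℤ (subst (_∣ ℤ.∣ D v ∣) (sym eq) (gcd[m,n]∣m ℤ.∣ D v ∣ m))
      d∣T : d z ∣ ℤ.∣ T z w ∣
      d∣T = cancel-coprime (T z w)
        (comb (+ x₂) (+ x₁) (dD z refl) (dD w dz≡dw) (i₁ (+ x₁) (+ y₁) (+ x₂) (+ y₂) (+ x₀) (+ y₀)))
        (comb (+ y₂) (+ y₁) (dD z refl) (dD w dz≡dw) (i₂ (+ x₁) (+ y₁) (+ x₂) (+ y₂) (+ x₀) (+ y₀)))
      e∣T : e ∣ ℤ.∣ T z w ∣
      e∣T = cancel-coprime (T z w)
        (comb (+ x₁) (+ x₂) (∣⇒∣ℤ (e∣S w rw dz≡dw)) (∣⇒∣ℤ (e∣S z rz refl)) (i₃ (+ x₁) (+ y₁) (+ x₂) (+ y₂) (+ x₀) (+ y₀)))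
        (comb (+ y₂) (+ y₁) (∣⇒∣ℤ (e∣S z rz refl)) (∣⇒∣ℤ (e∣S w rw dz≡dw)) (i₄ (+ x₁) (+ y₁) (+ x₂) (+ y₂) (+ x₀) (+ y₀)))

    -- Separates a point from its quarter turn: the two share d, but nonnegative orthogonal points
    -- lie on different axes.
    flag : ℕ → ℕ
    flag zero = 0
    flag (suc _) = 1

    -- Lagrange's identity reads T² + U² = m² with U the inner product. As m divides T, either T =
    -- 0, and the points are parallel and of equal norm, or |T| = m and U = 0, which the flags
    -- exclude unless the points are parallel.
    key-injective : ∀ z w → IsRep m z → IsRep m w → Coprime (proj₁ z) (proj₂ z) →
      d z ≡ d w → flag (proj₁ z) ≡ flag (proj₁ w) → z ≡ w
    key-injective z@(x₁ , y₁) w@(x₂ , y₂) rz rw cop eqd eqf = cases (m∣T z w rz rw cop eqd)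
      where
      U : ℕ
      U = x₁ * x₂ + y₁ * y₂
      t : ℕ
      t = ℤ.∣ T z w ∣
      tt+UU : t * t + U * U ≡ m * m
      tt+UU = ℤ.+-injective (begin
        + (t * t + U * U)                       ≡⟨ cong₂ ℤ._+_ (trans (cong +_ (sym (ℤ.abs-* (T z w) (T z w)))) (sq (T z w))) (ℤ.pos-* U U) ⟩
        T z w ℤ.* T z w ℤ.+ + U ℤ.* + U         ≡⟨ cong (λ u → T z w ℤ.* T z w ℤ.+ u ℤ.* u) (cong₂ ℤ._+_ (ℤ.pos-* x₁ x₂) (ℤ.pos-* y₁ y₂)) ⟩
        T z w ℤ.* T z w ℤ.+ (+ x₁ ℤ.* + x₂ ℤ.+ + y₁ ℤ.* + y₂) ℤ.* (+ x₁ ℤ.* + x₂ ℤ.+ + y₁ ℤ.* + y₂)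
                                                ≡⟨ lagrange (+ x₁) (+ y₁) (+ x₂) (+ y₂) ⟩
        (+ x₁ ℤ.* + x₁ ℤ.+ + y₁ ℤ.* + y₁) ℤ.* (+ x₂ ℤ.* + x₂ ℤ.+ + y₂ ℤ.* + y₂)
                                                ≡⟨ cong₂ ℤ._*_ (repℤ x₁ y₁ rz) (repℤ x₂ y₂ rw) ⟩
        + m ℤ.* + m                             ≡⟨ sym (ℤ.pos-* m m) ⟩
        + (m * m)                               ∎)
        where
        open ≡-Reasoning
        sq : ∀ i → + ℤ.∣ i ℤ.* i ∣ ≡ i ℤ.* i
        sq (+ n) rewrite sym (ℤ.pos-* n n) = refl
        sq -[1+ n ] = refl
        lagrange : ∀ a b c e → (a ℤ.* e ℤ.- c ℤ.* b) ℤ.* (a ℤ.* e ℤ.- c ℤ.* b) ℤ.+ (a ℤ.* c ℤ.+ b ℤ.* e) ℤ.* (a ℤ.* c ℤ.+ b ℤ.* e) ≡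
          (a ℤ.* a ℤ.+ b ℤ.* b) ℤ.* (c ℤ.* c ℤ.+ e ℤ.* e)
        lagrange = ℤSolver.solve-∀
      t≤m : t ≤ m
      t≤m with t ≤? m
      ... | yes h = h
      ... | no h = ⊥-elim (<-irrefl refl (<-≤-trans (*-mono-< (≰⇒> h) (≰⇒> h)) (≤-trans (m≤m+n (t * t) (U * U)) (≤-reflexive tt+UU))))
      parallel : x₁ * y₂ ≡ x₂ * y₁ → z ≡ w
      parallel h = cong₂ _,_ (square-injective xx) (square-injective (+-cancelˡ-≡ (x₁ * x₁) _ _ (trans rz (trans (sym rw) (cong (_+ y₂ * y₂) (sym xx))))))
        where
        open ≡-Reasoning
        instance
          m≢0 : NonZero m
          m≢0 = >-nonZero 1≤m
        e₁ : ∀ a c e → a * a * (c * c + e * e) ≡ a * a * (c * c) + (a * e) * (a * e)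
        e₁ = ℕSolver.solve-∀
        e₂ : ∀ a b c → a * a * (c * c) + (c * b) * (c * b) ≡ c * c * (a * a + b * b)
        e₂ = ℕSolver.solve-∀
        xx : x₁ * x₁ ≡ x₂ * x₂
        xx = *-cancelʳ-≡ (x₁ * x₁) (x₂ * x₂) m (begin
          x₁ * x₁ * m                              ≡⟨ cong (x₁ * x₁ *_) (sym rw) ⟩
          x₁ * x₁ * (x₂ * x₂ + y₂ * y₂)            ≡⟨ e₁ x₁ x₂ y₂ ⟩
          x₁ * x₁ * (x₂ * x₂) + (x₁ * y₂) * (x₁ * y₂) ≡⟨ cong (λ q → x₁ * x₁ * (x₂ * x₂) + q * q) h ⟩
          x₁ * x₁ * (x₂ * x₂) + (x₂ * y₁) * (x₂ * y₁) ≡⟨ e₂ x₁ y₁ x₂ ⟩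
          x₂ * x₂ * (x₁ * x₁ + y₁ * y₁)            ≡⟨ cong (x₂ * x₂ *_) rz ⟩
          x₂ * x₂ * m                              ∎)
      T≡0 : t ≡ 0 → z ≡ w
      T≡0 t0 = parallel (ℤ.+-injective (trans (ℤ.pos-* x₁ y₂) (trans (ℤ.i-j≡0⇒i≡j _ _ (ℤ.∣i∣≡0⇒i≡0 t0)) (sym (ℤ.pos-* x₂ y₁)))))
      orthogonal : U ≡ 0 → z ≡ w
      orthogonal U0 = parallel (orth x₁ y₁ x₂ y₂ eqf U0)
        where
        orth : ∀ x₁ y₁ x₂ y₂ → flag x₁ ≡ flag x₂ → x₁ * x₂ + y₁ * y₂ ≡ 0 → x₁ * y₂ ≡ x₂ * y₁
        orth zero y₁ zero y₂ _ _ = refl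
        orth (suc a) y₁ (suc b) y₂ _ ()
      cases : m ∣ t → z ≡ w
      cases (divides zero t≡0) = T≡0 t≡0
      cases (divides (suc k) e) = orthogonal (U≡0 (≤-antisym t≤m (subst (m ≤_) (sym e) (m≤m+n m (k * m)))))
        where
        U≡0 : t ≡ m → U ≡ 0
        U≡0 t≡m with m*n≡0⇒m≡0∨n≡0 U (+-cancelˡ-≡ (t * t) (U * U) 0 (trans tt+UU (trans (cong₂ _*_ (sym t≡m) (sym t≡m)) (sym (+-identityʳ _)))))
        ... | inj₁ h = h
        ... | inj₂ h = h

    primitive-bound : (L : List (ℕ × ℕ)) → Unique L → (∀ z → z ∈ L → IsRep m z × Coprime (proj₁ z) (proj₂ z)) →
      length L ≤ #divisors m * 2
    primitive-bound L u h = ≤-trans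
      (length-injection L (cartesianProduct (divisors m) (interval 0 2)) (λ z → d z , flag (proj₁ z)) u
        (λ z z∈ → ∈-cartesianProduct⁺ (∈-divisors⁺ 1≤m (d∣m z)) (flag∈ (proj₁ z)))
        (λ z w z∈ w∈ e → key-injective z w (proj₁ (h z z∈)) (proj₁ (h w w∈)) (proj₂ (h z z∈)) (,-injectiveˡ e) (,-injectiveʳ e)))
      (≤-reflexive (length-cartesianProduct (divisors m) (interval 0 2)))
      where
      flag∈ : ∀ x → flag x ∈ interval 0 2
      flag∈ zero = here refl
      flag∈ (suc _) = there (here refl)

  #divisors-mono : ∀ {a m} → 1 ≤ m → a ∣ m → #divisors a ≤ #divisors m
  #divisors-mono {a} {m} 1≤m a∣m = Unique-⊆-length (divisors a) (divisors m) (Unique-divisors a)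
    λ e e∈ → ∈-divisors⁺ 1≤m (∣-trans (∈-divisors⁻ e∈) a∣m)

  -- The representations are sorted by k = gcd(x, y), a divisor of m. Division by k makes them
  -- primitive representations of m/k², which is odd again.
  two-squares-bound : ∀ m → 1 ≤ m → ¬ 2 ∣ m → (L : List (ℕ × ℕ)) → Unique L → (∀ z → z ∈ L → IsRep m z) →
    length L ≤ #divisors m * (#divisors m * 2)
  two-squares-bound m 1≤m odd L u h = length-fibres _≟_ L (divisors m) g (#divisors m * 2)
    (λ z z∈ → ∈-divisors⁺ 1≤m (∣-trans (m∣m*n (g z)) (gg∣m z (h z z∈)))) fibre
    where
    g : ℕ × ℕ → ℕ
    g (x , y) = gcd x y
    gg∣m : ∀ z → IsRep m z → g z * g z ∣ m
    gg∣m (x , y) r = subst (gcd x y * gcd x y ∣_) r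
      (∣m∣n⇒∣m+n (*-pres-∣ (gcd[m,n]∣m x y) (gcd[m,n]∣m x y)) (*-pres-∣ (gcd[m,n]∣n x y) (gcd[m,n]∣n x y)))
    fibre : ∀ k → k ∈ divisors m → length (filter (λ z → g z ≟ k) L) ≤ #divisors m * 2
    fibre k k∈ = bound (filter (λ z → g z ≟ k) L) (Unique.filter⁺ (λ z → g z ≟ k) u)
      λ z z∈ → let (z∈L , e) = ∈-filter⁻ (λ z → g z ≟ k) {xs = L} z∈ in h z z∈L , e
      where
      1≤k : 1 ≤ k
      1≤k = n≢0⇒n>0 λ { refl → <-irrefl (sym (0∣⇒≡0 (∈-divisors⁻ k∈))) 1≤m }
      instance
        k≢0 : NonZero k
        k≢0 = >-nonZero 1≤k
        kk≢0 : NonZero (k * k)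
        kk≢0 = m*n≢0 k k
      /k : ℕ × ℕ → ℕ × ℕ
      /k (x , y) = x / k , y / k
      /k*k : ∀ x y → gcd x y ≡ k → x / k * k ≡ x × y / k * k ≡ y
      /k*k x y refl = m/n*n≡m (gcd[m,n]∣m x y) , m/n*n≡m (gcd[m,n]∣n x y)
      bound : (L : List (ℕ × ℕ)) → Unique L → (∀ z → z ∈ L → IsRep m z × g z ≡ k) → length L ≤ #divisors m * 2
      bound [] _ _ = z≤n
      -- The first representation in the fibre, divided by k, serves as the reference point of
      -- `Primitive`.
      bound L@(z₀@(x₀ , y₀) ∷ _) u h with h z₀ (here refl)
      ... | r₀ , e₀ with subst (λ q → q * q ∣ m) e₀ (gg∣m z₀ r₀)
      ... | divides m′ m≡ = ≤-trans
        (≤-trans (≤-reflexive (sym (length-map /k L)))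
          (Primitive.primitive-bound m′ 1≤m′ (λ d → odd (∣-trans d m′∣m)) (x₀ / k) (y₀ / k) (proj₁ (prim z₀ (h z₀ (here refl)))) (proj₂ (prim z₀ (h z₀ (here refl)))) (map /k L)
            (Unique-map-∈ /k L u λ z w z∈ w∈ e → inj z w (proj₂ (h z z∈)) (proj₂ (h w w∈)) e)
            λ w w∈ → let (z , z∈ , e) = ∈-map⁻ /k w∈ in subst (λ v → IsRep m′ v × Coprime (proj₁ v) (proj₂ v)) (sym e) (prim z (h z z∈))))
        (*-monoˡ-≤ 2 (#divisors-mono 1≤m m′∣m))
        where
        m′∣m : m′ ∣ m
        m′∣m = divides (k * k) (trans m≡ (*-comm m′ (k * k)))
        1≤m′ : 1 ≤ m′
        1≤m′ = 1≤*ʳ (k * k) (subst (1 ≤_) (trans m≡ (*-comm m′ (k * k))) 1≤m)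
        inj : ∀ z w → g z ≡ k → g w ≡ k → /k z ≡ /k w → z ≡ w
        inj (x , y) (x′ , y′) e e′ eq = cong₂ _,_
          (trans (sym (proj₁ (/k*k x y e))) (trans (cong (_* k) (,-injectiveˡ eq)) (proj₁ (/k*k x′ y′ e′))))
          (trans (sym (proj₂ (/k*k x y e))) (trans (cong (_* k) (,-injectiveʳ eq)) (proj₂ (/k*k x′ y′ e′))))
        prim : ∀ z → IsRep m z × g z ≡ k → IsRep m′ (/k z) × Coprime (proj₁ (/k z)) (proj₂ (/k z))
        prim (x , y) (r , e) = *-cancelʳ-≡ _ m′ (k * k) (trans (sq (x / k) (y / k) k)
            (trans (cong₂ (λ u v → u * u + v * v) (proj₁ (/k*k x y e)) (proj₂ (/k*k x y e))) (trans r m≡))) ,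
          λ {i} (i∣x , i∣y) → *-cancelʳ-≡ i 1 k (∣-antisym
            (subst (i * k ∣_) (trans e (sym (+-identityʳ k))) (gcd-greatest (subst (i * k ∣_) (proj₁ (/k*k x y e)) (*-monoˡ-∣ k i∣x)) (subst (i * k ∣_) (proj₂ (/k*k x y e)) (*-monoˡ-∣ k i∣y))))
            (subst (_∣ i * k) (sym (+-identityʳ k)) (n∣m*n i)))
          where
          sq : ∀ a b k → (a * a + b * b) * (k * k) ≡ (a * k) * (a * k) + (b * k) * (b * k)
          sq = ℕSolver.solve-∀

-- Matrix products of words, determinants, norms and congruences of matrices

module Words where

  open Congruences
  open import Data.Nat
  open import Data.Nat.Properties
  open import Data.Integer using (ℤ; +_)
  open import Data.Integer.Divisibility.Signed using (_∣_; _∣?_; ∣m∣n⇒∣m+n; ∣n⇒∣m*n)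

  mat-≡ : ∀ {a b c d a′ b′ c′ d′} → a ≡ a′ → b ≡ b′ → c ≡ c′ → d ≡ d′ → mat a b c d ≡ mat a′ b′ c′ d′
  mat-≡ refl refl refl refl = refl

  ·-assoc : ∀ x y z → (x · y) · z ≡ x · (y · z)
  ·-assoc (mat a b c d) (mat e f g h) (mat i j k l) =
    mat-≡ (eq a b e f g h i k) (eq a b e f g h j l) (eq c d e f g h i k) (eq c d e f g h j l)
    where
    eq : ∀ a b e f g h i k → (a * e + b * g) * i + (a * f + b * h) * k ≡ a * (e * i + f * k) + b * (g * i + h * k)
    eq = ℕSolver.solve-∀

  ·-identityˡ : ∀ x → I₂ · x ≡ x
  ·-identityˡ (mat a b c d) = mat-≡ (trans (+-identityʳ _) (+-identityʳ a)) (trans (+-identityʳ _) (+-identityʳ b)) (+-identityʳ c) (+-identityʳ d)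

  ·-identityʳ : ∀ x → x · I₂ ≡ x
  ·-identityʳ (mat a b c d) = mat-≡ (e₁ a b) (e₂ a b) (e₁ c d) (e₂ c d)
    where
    e₁ : ∀ a b → a * 1 + b * 0 ≡ a
    e₁ = ℕSolver.solve-∀
    e₂ : ∀ a b → a * 0 + b * 1 ≡ b
    e₂ = ℕSolver.solve-∀

  prodWord-++ : ∀ u v → prodWord (u ++ v) ≡ prodWord u · prodWord v
  prodWord-++ [] v = sym (·-identityˡ (prodWord v))
  prodWord-++ (a ∷ u) v = trans (cong (M a ·_) (prodWord-++ u v)) (sym (·-assoc (M a) (prodWord u) (prodWord v)))

  M-· : ∀ a x → M a · x ≡ mat (a * m11 x + m21 x) (a * m12 x + m22 x) (m11 x) (m12 x)
  M-· a (mat e f g h) = mat-≡ (cong (λ z → a * e + z) (+-identityʳ g)) (cong (λ z → a * f + z) (+-identityʳ h))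
    (trans (+-identityʳ _) (+-identityʳ e)) (trans (+-identityʳ _) (+-identityʳ f))

  Digits : List ℕ → Set
  Digits = All (1 ≤_)

  module _ {a : ℕ} (x : Mat) where
    private e = M-· a x
    M11 : m11 (M a · x) ≡ a * m11 x + m21 x
    M11 = cong m11 e
    M12 : m12 (M a · x) ≡ a * m12 x + m22 x
    M12 = cong m12 e
    M21 : m21 (M a · x) ≡ m11 x
    M21 = cong m21 e
    M22 : m22 (M a · x) ≡ m12 x
    M22 = cong m22 e

  module _ where
    private
      step : ∀ a {x y} → 1 ≤ a → x ≤ a * x + y
      step (suc a) {x} {y} _ = ≤-trans (m≤m+n x (a * x)) (m≤m+n _ y)

    m11≥1 : ∀ {w} → Digits w → 1 ≤ m11 (prodWord w)
    m11≥1 [] = ≤-refl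
    m11≥1 {a ∷ w} (h ∷ hs) = subst (1 ≤_) (sym (M11 {a} (prodWord w))) (≤-trans (m11≥1 hs) (step a h))

    m21≤m11 : ∀ {w} → Digits w → m21 (prodWord w) ≤ m11 (prodWord w)
    m21≤m11 [] = z≤n
    m21≤m11 {a ∷ w} (h ∷ hs) = subst₂ _≤_ (sym (M21 {a} (prodWord w))) (sym (M11 {a} (prodWord w))) (step a h)

    m22≤m12 : ∀ {a w} → Digits (a ∷ w) → m22 (prodWord (a ∷ w)) ≤ m12 (prodWord (a ∷ w))
    m22≤m12 {a} {w} (h ∷ hs) = subst₂ _≤_ (sym (M22 {a} (prodWord w))) (sym (M12 {a} (prodWord w))) (step a h)

    columns : ∀ {a w} → Digits (a ∷ w) → m12 (prodWord (a ∷ w)) ≤ m11 (prodWord (a ∷ w)) × m22 (prodWord (a ∷ w)) ≤ m21 (prodWord (a ∷ w))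
    columns {a} {[]} (h ∷ []) = subst₂ _≤_ (sym (M12 {a} I₂)) (sym (M11 {a} I₂)) (subst (λ z → z + 1 ≤ a * 1 + 0) (sym (*-zeroʳ a)) (≤-trans h (≤-reflexive (sym (trans (+-identityʳ _) (*-identityʳ a)))))) , z≤n
    columns {a} {b ∷ w} (h ∷ hs) = let (l₁ , l₂) = columns hs ; g = prodWord (b ∷ w) in
      subst₂ _≤_ (sym (M12 {a} g)) (sym (M11 {a} g)) (+-mono-≤ (*-monoʳ-≤ a l₁) l₂) ,
      subst₂ _≤_ (sym (M22 {a} g)) (sym (M21 {a} g)) l₁

  IsSL : Mat → Set
  IsSL (mat a b c d) = a * d ≡ 1 + b * c

  IsAnti : Mat → Set
  IsAnti (mat a b c d) = 1 + a * d ≡ b * c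

  SL-· : ∀ x y → IsSL x → IsSL y → IsSL (x · y)
  -- Multiplicativity of the determinant without subtraction: the negative terms of det x · det y
  -- are added to both sides and cancelled at the end.
  SL-· (mat a b c d) (mat e f g h) p q = +-cancelʳ-≡ (a * d * (f * g) + b * c * (e * h)) _ _ (begin
    (a * e + b * g) * (c * f + d * h) + (a * d * (f * g) + b * c * (e * h))
      ≡⟨ eq₁ a b c d e f g h ⟩
    (a * d) * (e * h) + (b * c) * (f * g) + ((a * d) * (f * g) + (b * c) * (e * h)) + (a * c * e * f + b * d * g * h)
      ≡⟨ cong₂ (λ u v → u * v + (b * c) * (f * g) + (u * (f * g) + (b * c) * v) + (a * c * e * f + b * d * g * h)) p q ⟩
    (1 + b * c) * (1 + f * g) + (b * c) * (f * g) + ((1 + b * c) * (f * g) + (b * c) * (1 + f * g)) + (a * c * e * f + b * d * g * h)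
      ≡⟨ eq₂ (b * c) (f * g) (a * c * e * f) (b * d * g * h) ⟩
    1 + ((1 + b * c) * (f * g) + (b * c) * (1 + f * g) + (a * c * e * f + b * d * g * h)) + ((1 + b * c) * (f * g) + (b * c) * (1 + f * g))
      ≡⟨ cong₂ (λ u v → 1 + (u * (f * g) + (b * c) * v + (a * c * e * f + b * d * g * h)) + (u * (f * g) + (b * c) * v)) (sym p) (sym q) ⟩
    1 + ((a * d) * (f * g) + (b * c) * (e * h) + (a * c * e * f + b * d * g * h)) + ((a * d) * (f * g) + (b * c) * (e * h))
      ≡⟨ eq₃ a b c d e f g h ⟩
    1 + (a * f + b * h) * (c * e + d * g) + (a * d * (f * g) + b * c * (e * h)) ∎)
    where
    open ≡-Reasoning
    eq₁ : ∀ a b c d e f g h → (a * e + b * g) * (c * f + d * h) + (a * d * (f * g) + b * c * (e * h)) ≡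
      (a * d) * (e * h) + (b * c) * (f * g) + ((a * d) * (f * g) + (b * c) * (e * h)) + (a * c * e * f + b * d * g * h)
    eq₁ = ℕSolver.solve-∀
    eq₂ : ∀ u v r s → (1 + u) * (1 + v) + u * v + ((1 + u) * v + u * (1 + v)) + (r + s) ≡
      1 + ((1 + u) * v + u * (1 + v) + (r + s)) + ((1 + u) * v + u * (1 + v))
    eq₂ = ℕSolver.solve-∀
    eq₃ : ∀ a b c d e f g h → 1 + ((a * d) * (f * g) + (b * c) * (e * h) + (a * c * e * f + b * d * g * h)) + ((a * d) * (f * g) + (b * c) * (e * h)) ≡
      1 + (a * f + b * h) * (c * e + d * g) + (a * d * (f * g) + b * c * (e * h))
    eq₃ = ℕSolver.solve-∀

  private
    M-SL : ∀ a x → IsSL x → IsAnti (M a · x)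
    M-SL a x@(mat e f g h) p = subst IsAnti (sym (M-· a x)) (begin
      1 + (a * e + g) * f         ≡⟨ eq₁ a e f g ⟩
      a * e * f + (1 + f * g)     ≡⟨ cong (λ z → a * e * f + z) (sym p) ⟩
      a * e * f + e * h           ≡⟨ eq₂ a e f h ⟩
      (a * f + h) * e             ∎)
      where
      open ≡-Reasoning
      eq₁ : ∀ a e f g → 1 + (a * e + g) * f ≡ a * e * f + (1 + f * g)
      eq₁ = ℕSolver.solve-∀
      eq₂ : ∀ a e f h → a * e * f + e * h ≡ (a * f + h) * e
      eq₂ = ℕSolver.solve-∀

    M-anti : ∀ a x → IsAnti x → IsSL (M a · x)
    M-anti a x@(mat e f g h) p = subst IsSL (sym (M-· a x)) (begin
      (a * e + g) * f             ≡⟨ eq₁ a e f g ⟩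
      a * e * f + f * g           ≡⟨ cong (λ z → a * e * f + z) (sym p) ⟩
      a * e * f + (1 + e * h)     ≡⟨ eq₂ a e f h ⟩
      1 + (a * f + h) * e         ∎)
      where
      open ≡-Reasoning
      eq₁ : ∀ a e f g → (a * e + g) * f ≡ a * e * f + f * g
      eq₁ = ℕSolver.solve-∀
      eq₂ : ∀ a e f h → a * e * f + (1 + e * h) ≡ 1 + (a * f + h) * e
      eq₂ = ℕSolver.solve-∀

  SL-prodWord : ∀ k w → length w ≡ 2 * k → IsSL (prodWord w)
  SL-prodWord zero [] _ = refl
  SL-prodWord (suc k) (a ∷ []) e with () ← trans e (*-distribˡ-+ 2 1 k)
  SL-prodWord (suc k) (a ∷ b ∷ w) e = M-anti a _ (M-SL b _ (SL-prodWord k w (suc-injective (suc-injective (trans e (*-distribˡ-+ 2 1 k))))))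

  -- The first column of M a · g is (a m11 + m21, m11), so a is its quotient. The quotient is
  -- ambiguous only if on one side m21 = m11 and on the other m21 = 0; the latter forces the empty
  -- word, the former excludes it, and the lengths agree.
  prodWord-injective : ∀ u v → Digits u → Digits v → length u ≡ length v → prodWord u ≡ prodWord v → u ≡ v
  prodWord-injective [] [] _ _ _ _ = refl
  prodWord-injective (a ∷ u) (b ∷ v) (pa ∷ pu) (pb ∷ pv) el e = result (<-cmp a b)
    where
    g = prodWord u
    h = prodWord v
    e′ : mat (a * m11 g + m21 g) (a * m12 g + m22 g) (m11 g) (m12 g) ≡ mat (b * m11 h + m21 h) (b * m12 h + m22 h) (m11 h) (m12 h)
    e′ = trans (sym (M-· a g)) (trans e (M-· b h))
    no-less : ∀ {a b} u v → Digits u → Digits v → length u ≡ length v → a < b →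
      m11 (prodWord u) ≡ m11 (prodWord v) → ¬ a * m11 (prodWord u) + m21 (prodWord u) ≡ b * m11 (prodWord v) + m21 (prodWord v)
    no-less {a} {b} u v du dv el lt e₁₁ eq = absurd u v du dv el (≤-antisym (m21≤m11 du) big) small
      where
      G = prodWord u
      H = prodWord v
      key : m11 G + m21 H ≤ m21 G
      key = +-cancelˡ-≤ (a * m11 G) _ _ (begin
        a * m11 G + (m11 G + m21 H)     ≡⟨ r a (m11 G) (m21 H) ⟩
        suc a * m11 G + m21 H           ≤⟨ +-monoˡ-≤ (m21 H) (*-monoˡ-≤ (m11 G) lt) ⟩
        b * m11 G + m21 H               ≡⟨ cong (λ z → b * z + m21 H) e₁₁ ⟩
        b * m11 H + m21 H               ≡⟨ sym eq ⟩
        a * m11 G + m21 G               ∎)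
        where
        open ≤-Reasoning
        r : ∀ a x y → a * x + (x + y) ≡ suc a * x + y
        r = ℕSolver.solve-∀
      big : m11 G ≤ m21 G
      big = ≤-trans (m≤m+n _ _) key
      small : m21 H ≡ 0
      small = n≤0⇒n≡0 (+-cancelˡ-≤ (m11 G) _ _ (≤-trans key (≤-trans (m21≤m11 du) (≤-reflexive (sym (+-identityʳ _))))))
      absurd : ∀ u v → Digits u → Digits v → length u ≡ length v → m21 (prodWord u) ≡ m11 (prodWord u) → m21 (prodWord v) ≡ 0 → ⊥
      absurd [] [] _ _ _ () _
      absurd (_ ∷ _) (c ∷ v) _ (_ ∷ dv) _ _ z = <-irrefl (sym (trans (sym (M21 {c} (prodWord v))) z)) (m11≥1 dv)
    result : _ → a ∷ u ≡ b ∷ v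
    result (tri< lt _ _) = ⊥-elim (no-less u v pu pv (suc-injective el) lt (cong m21 e′) (cong m11 e′))
    result (tri> _ _ gt) = ⊥-elim (no-less v u pv pu (sym (suc-injective el)) gt (sym (cong m21 e′)) (sym (cong m11 e′)))
    result (tri≈ _ refl _) = cong (a ∷_) (prodWord-injective u v pu pv (suc-injective el) (mat-≡ e₁ (cong m22 e′)
        (+-cancelˡ-≡ (a * m11 g) _ _ (trans (cong m11 e′) (cong (λ z → a * z + m21 h) (sym e₁))))
        (+-cancelˡ-≡ (a * m12 g) _ _ (trans (cong m12 e′) (cong (λ z → a * z + m22 h) (sym (cong m22 e′)))))))
      where
      e₁ : m11 g ≡ m11 h
      e₁ = cong m21 e′

  2xy≤x²+y² : ∀ x y → 2 * (x * y) ≤ x * x + y * y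
  2xy≤x²+y² x y with ≤-total x y
  ... | inj₁ l = subst (λ y → 2 * (x * y) ≤ x * x + y * y) (m+[n∸m]≡n l) (≤-trans (m≤m+n _ ((y ∸ x) * (y ∸ x))) (≤-reflexive (eq x (y ∸ x))))
    where
    eq : ∀ x k → 2 * (x * (x + k)) + k * k ≡ x * x + (x + k) * (x + k)
    eq = ℕSolver.solve-∀
  ... | inj₂ l = subst (λ x → 2 * (x * y) ≤ x * x + y * y) (m+[n∸m]≡n l) (≤-trans (m≤m+n _ ((x ∸ y) * (x ∸ y))) (≤-reflexive (eq y (x ∸ y))))
    where
    eq : ∀ y k → 2 * ((y + k) * y) + k * k ≡ (y + k) * (y + k) + y * y
    eq = ℕSolver.solve-∀

  normSq-· : ∀ x y → normSq (x · y) ≤ normSq x * normSq y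
  normSq-· (mat a b c d) (mat e f g h) = begin
    (a * e + b * g) * (a * e + b * g) + (a * f + b * h) * (a * f + b * h) + (c * e + d * g) * (c * e + d * g) + (c * f + d * h) * (c * f + d * h)
      ≤⟨ +-mono-≤ (+-mono-≤ (+-mono-≤ (cs a b e g) (cs a b f h)) (cs c d e g)) (cs c d f h) ⟩
    (a * a + b * b) * (e * e + g * g) + (a * a + b * b) * (f * f + h * h) + (c * c + d * d) * (e * e + g * g) + (c * c + d * d) * (f * f + h * h)
      ≡⟨ eq (a * a + b * b) (c * c + d * d) (e * e) (f * f) (g * g) (h * h) ⟩
    (a * a + b * b + (c * c + d * d)) * (e * e + f * f + g * g + h * h)
      ≡⟨ cong (_* (e * e + f * f + g * g + h * h)) (sym (+-assoc (a * a + b * b) (c * c) (d * d))) ⟩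
    (a * a + b * b + c * c + d * d) * (e * e + f * f + g * g + h * h) ∎
    where
    open ≤-Reasoning
    eq : ∀ p q e f g h → p * (e + g) + p * (f + h) + q * (e + g) + q * (f + h) ≡ (p + q) * (e + f + g + h)
    eq = ℕSolver.solve-∀
    l₁ : ∀ a b e g → (a * e + b * g) * (a * e + b * g) ≡ a * a * (e * e) + b * b * (g * g) + 2 * ((a * g) * (b * e))
    l₁ = ℕSolver.solve-∀
    l₂ : ∀ a b e g → a * a * (e * e) + b * b * (g * g) + ((a * g) * (a * g) + (b * e) * (b * e)) ≡ (a * a + b * b) * (e * e + g * g)
    l₂ = ℕSolver.solve-∀
    cs : ∀ a b e g → (a * e + b * g) * (a * e + b * g) ≤ (a * a + b * b) * (e * e + g * g)
    cs a b e g = ≤-trans (≤-reflexive (l₁ a b e g)) (≤-trans (+-monoʳ-≤ (a * a * (e * e) + b * b * (g * g)) (2xy≤x²+y² (a * g) (b * e))) (≤-reflexive (l₂ a b e g)))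

  record _≈_[mod_] (x y : Mat) (n : ℕ) : Set where
    constructor congruent
    field
      ≈11 : Congruent n (m11 x) (m11 y)
      ≈12 : Congruent n (m12 x) (m12 y)
      ≈21 : Congruent n (m21 x) (m21 y)
      ≈22 : Congruent n (m22 x) (m22 y)

  ≈? : ∀ n x y → Dec (x ≈ y [mod n ])
  ≈? n x y with (+ n ∣? _) ×-dec ((+ n ∣? _) ×-dec ((+ n ∣? _) ×-dec (+ n ∣? _)))
  ... | yes (p , q , r , s) = yes (congruent p q r s)
  ... | no ¬h = no λ { (congruent p q r s) → ¬h (p , q , r , s) }

  ≈-refl : ∀ {n} x → x ≈ x [mod n ]
  ≈-refl x = congruent (Congruent-refl (m11 x)) (Congruent-refl (m12 x)) (Congruent-refl (m21 x)) (Congruent-refl (m22 x))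

  module _ {n : ℕ} where

    ≈-sym : ∀ {x y} → x ≈ y [mod n ] → y ≈ x [mod n ]
    ≈-sym {mat a b c d} {mat a′ b′ c′ d′} (congruent p q r s) =
      congruent (Congruent-sym a a′ p) (Congruent-sym b b′ q) (Congruent-sym c c′ r) (Congruent-sym d d′ s)

    ≈-trans : ∀ {x y z} → x ≈ y [mod n ] → y ≈ z [mod n ] → x ≈ z [mod n ]
    ≈-trans {mat a b c d} {mat a′ b′ c′ d′} {mat a″ b″ c″ d″} (congruent p q r s) (congruent p′ q′ r′ s′) =
      congruent (t a a′ a″ p p′) (t b b′ b″ q q′) (t c c′ c″ r r′) (t d d′ d″ s s′)
      where
      t : ∀ a b c → Congruent n a b → Congruent n b c → Congruent n a c
      t a b c h h′ = subst (+ n ∣_) (e (+ a) (+ b) (+ c)) (∣m∣n⇒∣m+n h h′)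
        where
        e : ∀ a b c → (a ℤ.- b) ℤ.+ (b ℤ.- c) ≡ a ℤ.- c
        e = ℤSolver.solve-∀

  pos-lin : ∀ a e b g → + (a * e + b * g) ≡ + a ℤ.* + e ℤ.+ + b ℤ.* + g
  pos-lin a e b g = cong₂ ℤ._+_ (ℤ.pos-* a e) (ℤ.pos-* b g)

  ∣-combine : ∀ {n x y z} p q → n ∣ x → n ∣ y → p ℤ.* x ℤ.+ q ℤ.* y ≡ z → n ∣ z
  ∣-combine {n} p q hx hy e = subst (n ∣_) e (∣m∣n⇒∣m+n (∣n⇒∣m*n p hx) (∣n⇒∣m*n q hy))

  SLℤ : ∀ {a b c d} → a * d ≡ 1 + b * c → + a ℤ.* + d ≡ + 1 ℤ.+ + b ℤ.* + c
  SLℤ {a} {b} {c} {d} e = trans (sym (ℤ.pos-* a d)) (trans (cong +_ e) (cong (λ z → + 1 ℤ.+ z) (ℤ.pos-* b c)))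

  module _ {n : ℕ} where

    private
      -- Multiplication by the adjugate (d -b; -c a), which is the inverse since the determinant is
      -- 1, applied to one column at a time.
      cancel : ∀ a b c d e g e′ g′ → a * d ≡ 1 + b * c →
        Congruent n (a * e + b * g) (a * e′ + b * g′) → Congruent n (c * e + d * g) (c * e′ + d * g′) →
        Congruent n e e′ × Congruent n g g′
      cancel a b c d e g e′ g′ det h₁ h₂ =
        ∣-combine (+ d) (ℤ.- + b) k₁ k₂ (trans (i₁ (+ a) (+ b) (+ c) (+ d) (+ e) (+ g) (+ e′) (+ g′)) (fin (+ e) (+ e′))) ,
        ∣-combine (ℤ.- + c) (+ a) k₁ k₂ (trans (i₂ (+ a) (+ b) (+ c) (+ d) (+ e) (+ g) (+ e′) (+ g′)) (fin (+ g) (+ g′)))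
        where
        k₁ = subst (+ n ∣_) (cong₂ ℤ._-_ (pos-lin a e b g) (pos-lin a e′ b g′)) h₁
        k₂ = subst (+ n ∣_) (cong₂ ℤ._-_ (pos-lin c e d g) (pos-lin c e′ d g′)) h₂
        i₁ : ∀ a b c d e g e′ g′ →
          d ℤ.* ((a ℤ.* e ℤ.+ b ℤ.* g) ℤ.- (a ℤ.* e′ ℤ.+ b ℤ.* g′)) ℤ.+ (ℤ.- b) ℤ.* ((c ℤ.* e ℤ.+ d ℤ.* g) ℤ.- (c ℤ.* e′ ℤ.+ d ℤ.* g′))
          ≡ (a ℤ.* d ℤ.- b ℤ.* c) ℤ.* (e ℤ.- e′)
        i₁ = ℤSolver.solve-∀
        i₂ : ∀ a b c d e g e′ g′ →
          (ℤ.- c) ℤ.* ((a ℤ.* e ℤ.+ b ℤ.* g) ℤ.- (a ℤ.* e′ ℤ.+ b ℤ.* g′)) ℤ.+ a ℤ.* ((c ℤ.* e ℤ.+ d ℤ.* g) ℤ.- (c ℤ.* e′ ℤ.+ d ℤ.* g′))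
          ≡ (a ℤ.* d ℤ.- b ℤ.* c) ℤ.* (g ℤ.- g′)
        i₂ = ℤSolver.solve-∀
        det≡1 : + a ℤ.* + d ℤ.- + b ℤ.* + c ≡ + 1
        det≡1 = trans (cong (λ z → z ℤ.- + b ℤ.* + c) (SLℤ {a} {b} {c} {d} det)) (r (+ b ℤ.* + c))
          where
          r : ∀ z → + 1 ℤ.+ z ℤ.- z ≡ + 1
          r = ℤSolver.solve-∀
        fin : ∀ e e′ → (+ a ℤ.* + d ℤ.- + b ℤ.* + c) ℤ.* (e ℤ.- e′) ≡ e ℤ.- e′
        fin e e′ = trans (cong (λ z → z ℤ.* (e ℤ.- e′)) det≡1) (ℤ.*-identityˡ _)

    ≈-cancelˡ : ∀ x {y z} → IsSL x → (x · y) ≈ (x · z) [mod n ] → y ≈ z [mod n ]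
    ≈-cancelˡ (mat a b c d) {mat e f g h} {mat e′ f′ g′ h′} sl (congruent p q r s) =
      let (p₁ , p₂) = cancel a b c d e g e′ g′ sl p r
          (q₁ , q₂) = cancel a b c d f h f′ h′ sl q s in congruent p₁ q₁ p₂ q₂

    ≈-cancelʳ : ∀ z {x y} → IsSL z → (x · z) ≈ (y · z) [mod n ] → x ≈ y [mod n ]
    ≈-cancelʳ (mat e f g h) {mat a b c d} {mat a′ b′ c′ d′} sl (congruent p q r s) =
      let (p₁ , p₂) = cancel e g f h a b a′ b′ sl′ (flip a b a′ b′ e g p) (flip a b a′ b′ f h q)
          (r₁ , r₂) = cancel e g f h c d c′ d′ sl′ (flip c d c′ d′ e g r) (flip c d c′ d′ f h s) in congruent p₁ p₂ r₁ r₂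
      where
      sl′ : e * h ≡ 1 + g * f
      sl′ = trans sl (cong suc (*-comm f g))
      flip : ∀ a b a′ b′ e g → Congruent n (a * e + b * g) (a′ * e + b′ * g) → Congruent n (e * a + g * b) (e * a′ + g * b′)
      flip a b a′ b′ e g = subst₂ (Congruent n) (cong₂ _+_ (*-comm a e) (*-comm b g)) (cong₂ _+_ (*-comm a′ e) (*-comm b′ g))

    ≈-·-cong : ∀ x {x′ y y′} → x ≈ x′ [mod n ] → y ≈ y′ [mod n ] → (x · y) ≈ (x′ · y′) [mod n ]
    ≈-·-cong (mat a b c d) {mat a′ b′ c′ d′} {mat e f g h} {mat e′ f′ g′ h′} (congruent pa pb pc pd) (congruent pe pf pg ph) =
      congruent (lin a b a′ b′ e g e′ g′ pa pb pe pg) (lin a b a′ b′ f h f′ h′ pa pb pf ph)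
                (lin c d c′ d′ e g e′ g′ pc pd pe pg) (lin c d c′ d′ f h f′ h′ pc pd pf ph)
      where
      lin : ∀ a b a′ b′ e g e′ g′ → Congruent n a a′ → Congruent n b b′ → Congruent n e e′ → Congruent n g g′ →
        Congruent n (a * e + b * g) (a′ * e′ + b′ * g′)
      lin a b a′ b′ e g e′ g′ ha hb he hg =
        subst (+ n ∣_) (trans (i (+ a) (+ b) (+ a′) (+ b′) (+ e) (+ g) (+ e′) (+ g′)) (sym (cong₂ ℤ._-_ (pos-lin a e b g) (pos-lin a′ e′ b′ g′))))
          (∣m∣n⇒∣m+n (∣m∣n⇒∣m+n (∣n⇒∣m*n (+ e) ha) (∣n⇒∣m*n (+ g) hb)) (∣m∣n⇒∣m+n (∣n⇒∣m*n (+ a′) he) (∣n⇒∣m*n (+ b′) hg)))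
        where
        i : ∀ a b a′ b′ e g e′ g′ → (e ℤ.* (a ℤ.- a′) ℤ.+ g ℤ.* (b ℤ.- b′)) ℤ.+ (a′ ℤ.* (e ℤ.- e′) ℤ.+ b′ ℤ.* (g ℤ.- g′)) ≡
          (a ℤ.* e ℤ.+ b ℤ.* g) ℤ.- (a′ ℤ.* e′ ℤ.+ b′ ℤ.* g′)
        i = ℤSolver.solve-∀

-- Collisions modulo n between products of words

module Collisions where

  open Counting
  open Congruences
  open Divisors
  open Words
  open import Data.Nat
  open import Data.Nat.Properties
  open import Data.Nat.DivMod using (_/_; /-monoˡ-≤)
  open import Data.Integer using (ℤ; +_)
  open import Data.Integer.Divisibility.Signed using (_∣_; divides; ∣m∣n⇒∣m-n)

  tr : Mat → Mat
  tr (mat a b c d) = mat a c b d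

  tr-· : ∀ x y → tr (x · y) ≡ tr y · tr x
  tr-· (mat a b c d) (mat e f g h) = mat-≡ (i a e b g) (i c e d g) (i a f b h) (i c f d h)
    where
    i : ∀ a e b g → a * e + b * g ≡ e * a + g * b
    i = ℕSolver.solve-∀

  -- Each M a is symmetric.
  tr-prodWord : ∀ w → tr (prodWord w) ≡ prodWord (reverse w)
  tr-prodWord [] = refl
  tr-prodWord (a ∷ w) = begin
    tr (M a · prodWord w)             ≡⟨ tr-· (M a) (prodWord w) ⟩
    tr (prodWord w) · M a             ≡⟨ cong₂ _·_ (tr-prodWord w) (sym (·-identityʳ (M a))) ⟩
    prodWord (reverse w) · prodWord (a ∷ []) ≡⟨ sym (prodWord-++ (reverse w) (a ∷ [])) ⟩
    prodWord (reverse w ++ (a ∷ []))     ≡⟨ cong prodWord (sym (unfold-reverse a w)) ⟩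
    prodWord (reverse (a ∷ w))        ∎
    where open ≡-Reasoning

  SL-tr : ∀ x → IsSL x → IsSL (tr x)
  SL-tr (mat a b c d) p = trans p (cong suc (*-comm b c))

  -- Cross x y k says that k = ᵗx J y with J = (0 −1; 1 0).
  record Cross (x y k : Mat) : Set where
    constructor cross
    field
      c11 : m21 x * m11 y ≡ m11 x * m21 y + m11 k
      c12 : m21 x * m12 y ≡ m11 x * m22 y + m12 k
      c21 : m22 x * m11 y ≡ m12 x * m21 y + m21 k
      c22 : m22 x * m12 y ≡ m12 x * m22 y + m22 k

  private
    -- For M = M a one has ᵗM J M = -J. A common first digit thus reverses the sign of ᵗx J y, and
    -- exchanging x and y restores it, at the price of transposing k.
    Cross-M : ∀ a x y {k} → Cross x y k → Cross (M a · y) (M a · x) (tr k)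
    Cross-M a x@(mat x1 x2 x3 x4) y@(mat y1 y2 y3 y4) {mat k1 k2 k3 k4} (cross e1 e2 e3 e4) =
      subst₂ (λ u v → Cross u v (mat k1 k3 k2 k4)) (sym (M-· a y)) (sym (M-· a x))
        (cross (lem x1 x3 y1 y3 e1) (lem x2 x4 y1 y3 e3) (lem x1 x3 y2 y4 e2) (lem x2 x4 y2 y4 e4))
      where
      i₁ : ∀ a p q r → q * (a * p + r) ≡ a * q * p + r * q
      i₁ = ℕSolver.solve-∀
      i₂ : ∀ a p q s k → a * q * p + (p * s + k) ≡ (a * q + s) * p + k
      i₂ = ℕSolver.solve-∀
      lem : ∀ p r q s {k} → r * q ≡ p * s + k → q * (a * p + r) ≡ (a * q + s) * p + k
      lem p r q s {k} e = trans (i₁ a p q r) (trans (cong (λ z → a * q * p + z) e) (i₂ a p q s k))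

    -- The larger leading digit wins: b ≥ a + 1 and p′ ≤ p give p (b q + q′) ≥ (a p + p′) q, so all
    -- four entries are nonnegative.
    Cross-< : ∀ {a b} x y → a < b → m21 x ≤ m11 x → m22 x ≤ m12 x → ∃ λ k → Cross (M a · x) (M b · y) k
    Cross-< {a} {b} x@(mat x1 x2 x3 x4) y@(mat y1 y2 y3 y4) lt l₁ l₂ =
      k , subst₂ (λ u v → Cross u v k) (sym (M-· a x)) (sym (M-· b y))
        (cross (lem x1 x3 y1 y3 l₁) (lem x1 x3 y2 y4 l₁) (lem x2 x4 y1 y3 l₂) (lem x2 x4 y2 y4 l₂))
      where
      gap : ℕ → ℕ → ℕ → ℕ → ℕ
      gap p p′ q q′ = p * (b * q + q′) ∸ (a * p + p′) * q
      k = mat (gap x1 x3 y1 y3) (gap x1 x3 y2 y4) (gap x2 x4 y1 y3) (gap x2 x4 y2 y4)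
      lem : ∀ p p′ q q′ → p′ ≤ p → p * (b * q + q′) ≡ (a * p + p′) * q + gap p p′ q q′
      lem p p′ q q′ l = sym (m+[n∸m]≡n (begin
        (a * p + p′) * q     ≤⟨ *-monoˡ-≤ q (+-monoʳ-≤ (a * p) l) ⟩
        (a * p + p) * q      ≡⟨ i a p q ⟩
        p * (suc a * q)      ≤⟨ *-monoʳ-≤ p (*-monoˡ-≤ q lt) ⟩
        p * (b * q)          ≤⟨ *-monoʳ-≤ p (m≤m+n (b * q) q′) ⟩
        p * (b * q + q′)     ∎))
        where
        open ≤-Reasoning
        i : ∀ a p q → (a * p + p) * q ≡ p * (suc a * q)
        i = ℕSolver.solve-∀

  private
    m22≤m12-++ : ∀ u {c s} → Digits u → Digits (c ∷ s) → m22 (prodWord (u ++ c ∷ s)) ≤ m12 (prodWord (u ++ c ∷ s))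
    m22≤m12-++ [] _ ds = m22≤m12 ds
    m22≤m12-++ (x ∷ u) {c} {s} (d ∷ du) ds = m22≤m12 {x} {u ++ c ∷ s} (d ∷ All.++⁺ du ds)

  -- The common prefix is stripped digit by digit, each digit exchanging the roles of the words; at
  -- the first difference the larger digit decides. The tail c ∷ s keeps what remains behind that
  -- digit nonempty: the identity matrix violates m22 ≤ m12.
  cross-words : ∀ u v s {c} → Digits u → Digits v → Digits (c ∷ s) → length u ≡ length v → ¬ u ≡ v →
    ∃ λ k → Cross (prodWord (u ++ c ∷ s)) (prodWord (v ++ c ∷ s)) k ⊎ Cross (prodWord (v ++ c ∷ s)) (prodWord (u ++ c ∷ s)) k
  cross-words [] [] s _ _ _ _ ne = ⊥-elim (ne refl)
  cross-words (a ∷ u) (b ∷ v) s {c} (_ ∷ du) (_ ∷ dv) ds el ne with <-cmp a b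
  ... | tri< lt _ _ = let (k , h) = Cross-< (prodWord (u ++ c ∷ s)) (prodWord (v ++ c ∷ s)) lt (m21≤m11 (All.++⁺ du ds)) (m22≤m12-++ u du ds) in k , inj₁ h
  ... | tri> _ _ gt = let (k , h) = Cross-< (prodWord (v ++ c ∷ s)) (prodWord (u ++ c ∷ s)) gt (m21≤m11 (All.++⁺ dv ds)) (m22≤m12-++ v dv ds) in k , inj₂ h
  ... | tri≈ _ refl _ with cross-words u v s du dv ds (suc-injective el) (λ e → ne (cong (a ∷_) e))
  ... | k , inj₁ h = tr k , inj₂ (Cross-M a _ _ h)
  ... | k , inj₂ h = tr k , inj₁ (Cross-M a _ _ h)

  -- This is ᵗ(s x) J (t y) = ᵗx k y, whose entries remain nonnegative.
  Cross-· : ∀ s t {k} x y → Cross s t k → Cross (s · x) (t · y) ((tr x · k) · y)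
  Cross-· (mat s1 s2 s3 s4) (mat t1 t2 t3 t4) {mat k1 k2 k3 k4} (mat e f g h) (mat e′ f′ g′ h′) (cross p1 p2 p3 p4) =
    cross (lem e g e′ g′) (lem e g f′ h′) (lem f h e′ g′) (lem f h f′ h′)
    where
    i₁ : ∀ s1 s2 s3 s4 e g e′ g′ → (s1 * e + s2 * g) * (s3 * e′ + s4 * g′) ≡
      e * e′ * (s1 * s3) + e * g′ * (s1 * s4) + g * e′ * (s2 * s3) + g * g′ * (s2 * s4)
    i₁ = ℕSolver.solve-∀
    i₂ : ∀ a b c d e g e′ g′ k1 k2 k3 k4 →
      e * e′ * (a + k1) + e * g′ * (b + k2) + g * e′ * (c + k3) + g * g′ * (d + k4) ≡
      (e * e′ * a + e * g′ * b + g * e′ * c + g * g′ * d) + ((e * k1 + g * k3) * e′ + (e * k2 + g * k4) * g′)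
    i₂ = ℕSolver.solve-∀
    lem : ∀ e g e′ g′ → (s3 * e + s4 * g) * (t1 * e′ + t2 * g′) ≡
      (s1 * e + s2 * g) * (t3 * e′ + t4 * g′) + ((e * k1 + g * k3) * e′ + (e * k2 + g * k4) * g′)
    lem e g e′ g′ = begin
      (s3 * e + s4 * g) * (t1 * e′ + t2 * g′)
        ≡⟨ i₁ s3 s4 t1 t2 e g e′ g′ ⟩
      e * e′ * (s3 * t1) + e * g′ * (s3 * t2) + g * e′ * (s4 * t1) + g * g′ * (s4 * t2)
        ≡⟨ cong₂ _+_ (cong₂ _+_ (cong₂ _+_ (cong (e * e′ *_) p1) (cong (e * g′ *_) p2)) (cong (g * e′ *_) p3)) (cong (g * g′ *_) p4) ⟩
      e * e′ * (s1 * t3 + k1) + e * g′ * (s1 * t4 + k2) + g * e′ * (s2 * t3 + k3) + g * g′ * (s2 * t4 + k4)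
        ≡⟨ i₂ (s1 * t3) (s1 * t4) (s2 * t3) (s2 * t4) e g e′ g′ k1 k2 k3 k4 ⟩
      (e * e′ * (s1 * t3) + e * g′ * (s1 * t4) + g * e′ * (s2 * t3) + g * g′ * (s2 * t4)) + ((e * k1 + g * k3) * e′ + (e * k2 + g * k4) * g′)
        ≡⟨ cong (λ z → z + ((e * k1 + g * k3) * e′ + (e * k2 + g * k4) * g′)) (sym (i₁ s1 s2 t3 t4 e g e′ g′)) ⟩
      (s1 * e + s2 * g) * (t3 * e′ + t4 * g′) + ((e * k1 + g * k3) * e′ + (e * k2 + g * k4) * g′) ∎
      where open ≡-Reasoning

  private
    cross-entry : ∀ {a b c d k} → a * b ≡ c * d + k → + k ≡ + a ℤ.* + b ℤ.- + c ℤ.* + d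
    cross-entry {a} {b} {c} {d} {k} e = trans (i (+ c ℤ.* + d) (+ k))
      (cong (λ z → z ℤ.- + c ℤ.* + d) (sym (trans (sym (ℤ.pos-* a b)) (trans (cong +_ e) (cong (λ z → z ℤ.+ + k) (ℤ.pos-* c d))))))
      where
      i : ∀ u k → k ≡ u ℤ.+ k ℤ.- u
      i = ℤSolver.solve-∀

  Cross-SL : ∀ x y k → Cross x y k → IsSL x → IsSL y → IsSL k
  Cross-SL (mat a b c d) (mat a′ b′ c′ d′) (mat k1 k2 k3 k4) (cross p1 p2 p3 p4) sx sy = ℤ.+-injective (begin
    + (k1 * k4)                                           ≡⟨ ℤ.pos-* k1 k4 ⟩
    + k1 ℤ.* + k4                                         ≡⟨ cong₂ ℤ._*_ (cross-entry {c} {a′} {a} {c′} p1) (cross-entry {d} {b′} {b} {d′} p4) ⟩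
    (C ℤ.* A′ ℤ.- A ℤ.* C′) ℤ.* (D ℤ.* B′ ℤ.- B ℤ.* D′)   ≡⟨ i A B C D A′ B′ C′ D′ ⟩
    (A ℤ.* D ℤ.- B ℤ.* C) ℤ.* (A′ ℤ.* D′ ℤ.- B′ ℤ.* C′) ℤ.+ (C ℤ.* B′ ℤ.- A ℤ.* D′) ℤ.* (D ℤ.* A′ ℤ.- B ℤ.* C′)
                                                          ≡⟨ cong₂ (λ u v → (u ℤ.- B ℤ.* C) ℤ.* (v ℤ.- B′ ℤ.* C′) ℤ.+ (C ℤ.* B′ ℤ.- A ℤ.* D′) ℤ.* (D ℤ.* A′ ℤ.- B ℤ.* C′))
                                                               (SLℤ {a} {b} {c} {d} sx) (SLℤ {a′} {b′} {c′} {d′} sy) ⟩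
    (+ 1 ℤ.+ B ℤ.* C ℤ.- B ℤ.* C) ℤ.* (+ 1 ℤ.+ B′ ℤ.* C′ ℤ.- B′ ℤ.* C′) ℤ.+ (C ℤ.* B′ ℤ.- A ℤ.* D′) ℤ.* (D ℤ.* A′ ℤ.- B ℤ.* C′)
                                                          ≡⟨ j (B ℤ.* C) (B′ ℤ.* C′) ((C ℤ.* B′ ℤ.- A ℤ.* D′) ℤ.* (D ℤ.* A′ ℤ.- B ℤ.* C′)) ⟩
    + 1 ℤ.+ (C ℤ.* B′ ℤ.- A ℤ.* D′) ℤ.* (D ℤ.* A′ ℤ.- B ℤ.* C′)
                                                          ≡⟨ cong (λ z → + 1 ℤ.+ z) (sym (cong₂ ℤ._*_ (cross-entry {c} {b′} {a} {d′} p2) (cross-entry {d} {a′} {b} {c′} p3))) ⟩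
    + 1 ℤ.+ + k2 ℤ.* + k3                                 ≡⟨ cong (λ z → + 1 ℤ.+ z) (sym (ℤ.pos-* k2 k3)) ⟩
    + (1 + k2 * k3)                                       ∎)
    where
    open ≡-Reasoning
    A = + a ; B = + b ; C = + c ; D = + d ; A′ = + a′ ; B′ = + b′ ; C′ = + c′ ; D′ = + d′
    i : ∀ A B C D A′ B′ C′ D′ → (C ℤ.* A′ ℤ.- A ℤ.* C′) ℤ.* (D ℤ.* B′ ℤ.- B ℤ.* D′) ≡
      (A ℤ.* D ℤ.- B ℤ.* C) ℤ.* (A′ ℤ.* D′ ℤ.- B′ ℤ.* C′) ℤ.+ (C ℤ.* B′ ℤ.- A ℤ.* D′) ℤ.* (D ℤ.* A′ ℤ.- B ℤ.* C′)
    i = ℤSolver.solve-∀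
    j : ∀ u v w → (+ 1 ℤ.+ u ℤ.- u) ℤ.* (+ 1 ℤ.+ v ℤ.- v) ℤ.+ w ≡ + 1 ℤ.+ w
    j = ℤSolver.solve-∀

  -- For x ≡ y mod n the matrix k is ≡ J mod n, and having determinant one it satisfies
  -- the trace congruence to the modulus n².
  Cross-congruent : ∀ n x y k → Cross x y k → IsSL x → IsSL y → x ≈ y [mod n ] →
    (+ n ∣ + m12 k ℤ.+ + 1) × (+ (n * n) ∣ + m12 k ℤ.+ + 2 ℤ.- + m21 k)
  Cross-congruent n x@(mat a b c d) y@(mat a′ b′ c′ d′) k@(mat k1 k2 k3 k4) cr@(cross p1 p2 p3 p4) sx sy (congruent ha hb hc hd) =
    d12 , square d11 d12 d21 d22
    where
    A = + a ; B = + b ; C = + c ; D = + d ; A′ = + a′ ; B′ = + b′ ; C′ = + c′ ; D′ = + d′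
    det′ : B′ ℤ.* C′ ℤ.+ + 1 ≡ A′ ℤ.* D′
    det′ = trans (ℤ.+-comm (B′ ℤ.* C′) (+ 1)) (sym (SLℤ {a′} {b′} {c′} {d′} sy))
    d11 : + n ∣ + k1
    d11 = ∣-combine A′ (ℤ.- C′) hc ha (trans (i A C A′ C′) (sym (cross-entry {c} {a′} {a} {c′} p1)))
      where
      i : ∀ A C A′ C′ → A′ ℤ.* (C ℤ.- C′) ℤ.+ (ℤ.- C′) ℤ.* (A ℤ.- A′) ≡ C ℤ.* A′ ℤ.- A ℤ.* C′
      i = ℤSolver.solve-∀
    d22 : + n ∣ + k4
    d22 = ∣-combine B′ (ℤ.- D′) hd hb (trans (i B D B′ D′) (sym (cross-entry {d} {b′} {b} {d′} p4)))
      where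
      i : ∀ B D B′ D′ → B′ ℤ.* (D ℤ.- D′) ℤ.+ (ℤ.- D′) ℤ.* (B ℤ.- B′) ≡ D ℤ.* B′ ℤ.- B ℤ.* D′
      i = ℤSolver.solve-∀
    d12 : + n ∣ + k2 ℤ.+ + 1
    d12 = ∣-combine B′ (ℤ.- D′) hc ha (trans (i A B′ C A′ C′ D′) (trans (cong (λ z → C ℤ.* B′ ℤ.- A ℤ.* D′ ℤ.+ (z ℤ.- B′ ℤ.* C′)) (sym det′))
        (trans (r (C ℤ.* B′ ℤ.- A ℤ.* D′) (B′ ℤ.* C′)) (cong (λ z → z ℤ.+ + 1) (sym (cross-entry {c} {b′} {a} {d′} p2))))))
      where
      i : ∀ A B′ C A′ C′ D′ → B′ ℤ.* (C ℤ.- C′) ℤ.+ (ℤ.- D′) ℤ.* (A ℤ.- A′) ≡ C ℤ.* B′ ℤ.- A ℤ.* D′ ℤ.+ (A′ ℤ.* D′ ℤ.- B′ ℤ.* C′)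
      i = ℤSolver.solve-∀
      r : ∀ u v → u ℤ.+ (v ℤ.+ + 1 ℤ.- v) ≡ u ℤ.+ + 1
      r = ℤSolver.solve-∀
    d21 : + n ∣ + k3 ℤ.- + 1
    d21 = ∣-combine A′ (ℤ.- C′) hd hb (trans (i B A′ D B′ C′ D′) (trans (cong (λ z → D ℤ.* A′ ℤ.- B ℤ.* C′ ℤ.- (z ℤ.- B′ ℤ.* C′)) (sym det′))
        (trans (r (D ℤ.* A′ ℤ.- B ℤ.* C′) (B′ ℤ.* C′)) (cong (λ z → z ℤ.- + 1) (sym (cross-entry {d} {a′} {b} {c′} p3))))))
      where
      i : ∀ B A′ D B′ C′ D′ → A′ ℤ.* (D ℤ.- D′) ℤ.+ (ℤ.- C′) ℤ.* (B ℤ.- B′) ≡ D ℤ.* A′ ℤ.- B ℤ.* C′ ℤ.- (A′ ℤ.* D′ ℤ.- B′ ℤ.* C′)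
      i = ℤSolver.solve-∀
      r : ∀ u v → u ℤ.- (v ℤ.+ + 1 ℤ.- v) ≡ u ℤ.- + 1
      r = ℤSolver.solve-∀
    -- Each of k₁₁, k₂₂, k₁₂ + 1, k₂₁ - 1 is divisible by n, so k₁₁k₂₂ - (k₁₂ + 1)(k₂₁ - 1) is
    -- divisible by n²; by det k = 1 it equals k₁₂ + 2 - k₂₁.
    square : + n ∣ + k1 → + n ∣ + k2 ℤ.+ + 1 → + n ∣ + k3 ℤ.- + 1 → + n ∣ + k4 → + (n * n) ∣ + k2 ℤ.+ + 2 ℤ.- + k3
    square (divides α eα) (divides β eβ) (divides γ eγ) (divides δ eδ) = divides (α ℤ.* δ ℤ.- β ℤ.* γ) (begin
      + k2 ℤ.+ + 2 ℤ.- + k3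
        ≡⟨ i (+ k2) (+ k3) ⟩
      (+ 1 ℤ.+ + k2 ℤ.* + k3) ℤ.- (+ k2 ℤ.+ + 1) ℤ.* (+ k3 ℤ.- + 1)
        ≡⟨ cong (λ z → z ℤ.- (+ k2 ℤ.+ + 1) ℤ.* (+ k3 ℤ.- + 1)) (sym (SLℤ {k1} {k2} {k3} {k4} (Cross-SL x y k cr sx sy))) ⟩
      + k1 ℤ.* + k4 ℤ.- (+ k2 ℤ.+ + 1) ℤ.* (+ k3 ℤ.- + 1)
        ≡⟨ cong₂ ℤ._-_ (cong₂ ℤ._*_ eα eδ) (cong₂ ℤ._*_ eβ eγ) ⟩
      (α ℤ.* + n) ℤ.* (δ ℤ.* + n) ℤ.- (β ℤ.* + n) ℤ.* (γ ℤ.* + n)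
        ≡⟨ j α β γ δ (+ n) ⟩
      (α ℤ.* δ ℤ.- β ℤ.* γ) ℤ.* (+ n ℤ.* + n)
        ≡⟨ cong (λ z → (α ℤ.* δ ℤ.- β ℤ.* γ) ℤ.* z) (sym (ℤ.pos-* n n)) ⟩
      (α ℤ.* δ ℤ.- β ℤ.* γ) ℤ.* + (n * n) ∎)
      where
      open ≡-Reasoning
      i : ∀ u v → u ℤ.+ + 2 ℤ.- v ≡ (+ 1 ℤ.+ u ℤ.* v) ℤ.- (u ℤ.+ + 1) ℤ.* (v ℤ.- + 1)
      i = ℤSolver.solve-∀
      j : ∀ α β γ δ n → (α ℤ.* n) ℤ.* (δ ℤ.* n) ℤ.- (β ℤ.* n) ℤ.* (γ ℤ.* n) ≡ (α ℤ.* δ ℤ.- β ℤ.* γ) ℤ.* (n ℤ.* n)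
      j = ℤSolver.solve-∀

  -- Cancellation in SL₂ is cancellation of congruences to the modulus 0.
  ·-cancelˡ : ∀ x {y z} → IsSL x → x · y ≡ x · z → y ≡ z
  ·-cancelˡ x {y} {z} sl e = from-≈ (≈-cancelˡ {0} x sl (subst (λ v → (x · y) ≈ v [mod 0 ]) e (≈-refl (x · y))))
    where
    zero∣ : ∀ {a b} → Congruent 0 a b → a ≡ b
    zero∣ {a} {b} (divides q e) = ℤ.+-injective (ℤ.i-j≡0⇒i≡j (+ a) (+ b) (trans e (ℤ.*-zeroʳ q)))
    from-≈ : ∀ {y z} → y ≈ z [mod 0 ] → y ≡ z
    from-≈ (congruent p q r s) = mat-≡ (zero∣ p) (zero∣ q) (zero∣ r) (zero∣ s)

  private
    -- What suffices for reading off leading digits when the last factor is an arbitrary matrix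
    -- instead of a product of digits.
    record Descending (x : Mat) : Set where
      constructor descending
      field
        first : m21 x ≤ m11 x
        second : m22 x ≤ m12 x
        bottom : ¬ (m21 x ≡ 0 × m22 x ≡ 0)

    M-Descending : ∀ a x → 1 ≤ a → ¬ (m11 x ≡ 0 × m12 x ≡ 0) → Descending (M a · x)
    M-Descending (suc a) x _ nz = subst Descending (sym (M-· (suc a) x))
      (descending (≤-trans (m≤m+n _ _) (m≤m+n _ (m21 x))) (≤-trans (m≤m+n _ _) (m≤m+n _ (m22 x))) nz)

    Descending-prodWord : ∀ z x → Digits z → Descending x → Descending (prodWord z · x)
    Descending-prodWord [] x _ h = subst Descending (sym (·-identityˡ x)) h
    Descending-prodWord (a ∷ z) x (d ∷ ds) h = subst Descending (sym (·-assoc (M a) (prodWord z) x))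
      (M-Descending a _ d (top (Descending-prodWord z x ds h)))
      where
      top : ∀ {y} → Descending y → ¬ (m11 y ≡ 0 × m12 y ≡ 0)
      top (descending f s b) (e₁ , e₂) = b (n≤0⇒n≡0 (subst (_ ≤_) e₁ f) , n≤0⇒n≡0 (subst (_ ≤_) e₂ s))

    -- If the leading digits differed, the bottom row of the factor behind the larger one would
    -- vanish in both columns, against `bottom`.
    peel : ∀ z z′ {x x′} → Digits z → Digits z′ → length z ≡ length z′ → Descending x → Descending x′ →
      prodWord z · x ≡ prodWord z′ · x′ → z ≡ z′ × x ≡ x′
    peel [] [] {x} {x′} _ _ _ _ _ e = refl , trans (sym (·-identityˡ x)) (trans e (·-identityˡ x′))
    peel (a ∷ z) (b ∷ z′) {x} {x′} (pa ∷ pz) (pb ∷ pz′) el dx dx′ e = result (<-cmp a b)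
      where
      g = prodWord z · x
      h = prodWord z′ · x′
      e′ : mat (a * m11 g + m21 g) (a * m12 g + m22 g) (m11 g) (m12 g) ≡ mat (b * m11 h + m21 h) (b * m12 h + m22 h) (m11 h) (m12 h)
      e′ = trans (sym (trans (·-assoc (M a) (prodWord z) x) (M-· a g))) (trans e (trans (·-assoc (M b) (prodWord z′) x′) (M-· b h)))
      entry : ∀ {a b p q r s} → a < b → q ≤ p → p ≡ r → a * p + q ≡ b * r + s → s ≡ 0
      entry {a} {b} {p} {q} {_} {s} lt q≤p refl eq = n≤0⇒n≡0 (+-cancelˡ-≤ (a * p + p) s 0 (begin
        a * p + p + s       ≡⟨ r a p s ⟩
        suc a * p + s       ≤⟨ +-monoˡ-≤ s (*-monoˡ-≤ p lt) ⟩
        b * p + s           ≡⟨ sym eq ⟩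
        a * p + q           ≤⟨ +-monoʳ-≤ (a * p) q≤p ⟩
        a * p + p           ≡⟨ sym (+-identityʳ _) ⟩
        a * p + p + 0       ∎))
        where
        open ≤-Reasoning
        r : ∀ a p s → a * p + p + s ≡ suc a * p + s
        r = ℕSolver.solve-∀
      no-less : ∀ {a b g h} → a < b → Descending g → Descending h →
        mat (a * m11 g + m21 g) (a * m12 g + m22 g) (m11 g) (m12 g) ≡ mat (b * m11 h + m21 h) (b * m12 h + m22 h) (m11 h) (m12 h) → ⊥
      no-less lt (descending f s _) (descending _ _ nz) eq =
        nz (entry lt f (cong m21 eq) (cong m11 eq) , entry lt s (cong m22 eq) (cong m12 eq))
      dg = Descending-prodWord z x pz dx
      dh = Descending-prodWord z′ x′ pz′ dx′
      result : _ → a ∷ z ≡ b ∷ z′ × x ≡ x′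
      result (tri< lt _ _) = ⊥-elim (no-less lt dg dh e′)
      result (tri> _ _ gt) = ⊥-elim (no-less gt dh dg (sym e′))
      result (tri≈ _ refl _) =
        let (r₁ , r₂) = peel z z′ pz pz′ (suc-injective el) dx dx′ (mat-≡ (cong m21 e′) (cong m22 e′)
              (+-cancelˡ-≡ (a * m11 g) _ _ (trans (cong m11 e′) (cong (λ v → a * v + m21 h) (sym (cong m21 e′)))))
              (+-cancelˡ-≡ (a * m12 g) _ _ (trans (cong m12 e′) (cong (λ v → a * v + m22 h) (sym (cong m22 e′))))))
        in cong (a ∷_) r₁ , r₂

    Digits-reverse : ∀ w → Digits w → Digits (reverse w)
    Digits-reverse [] _ = []
    Digits-reverse (a ∷ w) (d ∷ ds) = subst Digits (sym (unfold-reverse a w)) (All.++⁺ (Digits-reverse w ds) (d ∷ []))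

    SL-top : ∀ {x} → IsSL x → ¬ (m11 x ≡ 0 × m12 x ≡ 0)
    SL-top {mat a b c d} sl (refl , refl) with () ← sl

  headDigit : List ℕ → ℕ
  headDigit [] = 0
  headDigit (a ∷ _) = a

  -- The transpose of ᵗx k y is ᵗy ᵗk x, and ᵗy is the product of the reversed word, so the digits
  -- of y can be peeled off from its end. The peeling stops before the first digit c of y, because
  -- ᵗk x alone need not be `Descending` whereas M c · ᵗk x is. This is why the head digit of y must
  -- be given separately.
  sandwich-injective : ∀ k {x x′ y y′} → IsSL k → IsSL (prodWord x) → IsSL (prodWord x′) →
    Digits x → Digits x′ → Digits y → Digits y′ →
    length x ≡ length x′ → length y ≡ length y′ → headDigit y ≡ headDigit y′ →
    (tr (prodWord x) · k) · prodWord y ≡ (tr (prodWord x′) · k) · prodWord y′ → x ≡ x′ × y ≡ y′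
  sandwich-injective k {x} {x′} {[]} {[]} sk sx sx′ dx dx′ dy dy′ elx _ _ e = finish , refl
    where
    finish : x ≡ x′
    finish = prodWord-injective x x′ dx dx′ elx (·-cancelˡ (tr k) (SL-tr k sk)
      (trans (sym (tr-· (tr (prodWord x)) k)) (trans (cong tr (trans (sym (·-identityʳ _)) (trans e (·-identityʳ _)))) (tr-· (tr (prodWord x′)) k))))
  sandwich-injective k {x} {x′} {c ∷ y} {_ ∷ y′} sk sx sx′ dx dx′ (dc ∷ dy) (_ ∷ dy′) elx ely refl e =
    prodWord-injective x x′ dx dx′ elx (·-cancelˡ (tr k) (SL-tr k sk) inner) ,
    cong (c ∷_) (reverse-injective (proj₁ peeled))
    where
    q q′ : Mat
    q = tr k · prodWord x
    q′ = tr k · prodWord x′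
    flip : ∀ x y → tr ((tr (prodWord x) · k) · prodWord (c ∷ y)) ≡ prodWord (reverse y) · (M c · (tr k · prodWord x))
    flip x y = begin
      tr ((tr (prodWord x) · k) · prodWord (c ∷ y))         ≡⟨ tr-· _ (prodWord (c ∷ y)) ⟩
      tr (M c · prodWord y) · tr (tr (prodWord x) · k)      ≡⟨ cong₂ _·_ (trans (tr-· (M c) (prodWord y)) (cong (_· M c) (tr-prodWord y))) (tr-· (tr (prodWord x)) k) ⟩
      (prodWord (reverse y) · M c) · (tr k · prodWord x)    ≡⟨ ·-assoc (prodWord (reverse y)) (M c) _ ⟩
      prodWord (reverse y) · (M c · (tr k · prodWord x))    ∎
      where open ≡-Reasoning
    peeled : reverse y ≡ reverse y′ × M c · q ≡ M c · q′
    peeled = peel (reverse y) (reverse y′) (Digits-reverse y dy) (Digits-reverse y′ dy′)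
      (trans (length-reverse y) (trans (suc-injective ely) (sym (length-reverse y′))))
      (M-Descending c q dc (SL-top (SL-· (tr k) (prodWord x) (SL-tr k sk) sx)))
      (M-Descending c q′ dc (SL-top (SL-· (tr k) (prodWord x′) (SL-tr k sk) sx′)))
      (trans (sym (flip x y)) (trans (cong tr e) (flip x′ y′)))
    inner : q ≡ q′
    inner = let e′ = trans (sym (M-· c q)) (trans (proj₂ peeled) (M-· c q′)) in
      mat-≡ (cong m21 e′) (cong m22 e′)
        (+-cancelˡ-≡ (c * m11 q) _ _ (trans (cong m11 e′) (cong (λ v → c * v + m21 q′) (sym (cong m21 e′)))))
        (+-cancelˡ-≡ (c * m12 q) _ _ (trans (cong m12 e′) (cong (λ v → c * v + m22 q′) (sym (cong m22 e′)))))

  normSq-entry : ∀ x → (m12 x * m12 x ≤ normSq x) × (m11 x * m11 x ≤ normSq x) × (m21 x * m21 x ≤ normSq x) × (m22 x * m22 x ≤ normSq x)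
  normSq-entry (mat a b c d) =
    ≤-trans (m≤n+m _ (a * a)) (≤-trans (m≤m+n _ (c * c)) (m≤m+n _ (d * d))) ,
    ≤-trans (m≤m+n _ (b * b)) (≤-trans (m≤m+n _ (c * c)) (m≤m+n _ (d * d))) ,
    ≤-trans (m≤n+m _ (a * a + b * b)) (m≤m+n _ (d * d)) ,
    m≤n+m _ (a * a + b * b + c * c)

  product≤ : ∀ {a b Z} → a * a ≤ Z → b * b ≤ Z → a * b ≤ Z
  product≤ {a} {b} {Z} ha hb = *-cancelˡ-≤ 2 (≤-trans (2xy≤x²+y² a b) (≤-trans (+-mono-≤ ha hb) (≤-reflexive (cong (λ z → Z + z) (sym (+-identityʳ Z))))))

  record WordList (L : List (List ℕ)) (ℓ D : ℕ) : Set where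
    field
      unique : Unique L
      lengths : ∀ w → w ∈ L → length w ≡ 2 * ℓ
      digits : ∀ w → w ∈ L → Digits w
      head≤ : ∀ w → w ∈ L → headDigit w ≤ D

  module SandwichCount (n : ℕ) .{{_ : NonZero n}} (s t k : Mat) (cr : Cross s t k) (ss : IsSL s) (st : IsSL t)
      {L : List (List ℕ)} {ℓ D : ℕ} (WL : WordList L ℓ D) (Z Δ : ℕ)
      (hs : ∀ w → w ∈ L → normSq (s · prodWord w) ≤ Z) (ht : ∀ w → w ∈ L → normSq (t · prodWord w) ≤ Z)
      (hΔ : ∀ m → m ≤ suc (Z * Z) → 1 ≤ m → #divisors m ≤ Δ) where

    open WordList WL

    private
      instance
        nn≢0 : NonZero (n * n)
        nn≢0 = m*n≢0 n n

      R : List ℕ × List ℕ → Set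
      R (x , y) = (s · prodWord x) ≈ (t · prodWord y) [mod n ]

      R? : ∀ z → Dec (R z)
      R? (x , y) = ≈? n (s · prodWord x) (t · prodWord y)

      κ : List ℕ × List ℕ → Mat
      κ (x , y) = (tr (prodWord x) · k) · prodWord y

      LL = cartesianProduct L L

      keys = cartesianProduct (interval 0 (suc (Z / n))) (interval 0 (suc (Z / (n * n))))

      key : List ℕ × List ℕ → ℕ × ℕ
      key z = m12 (κ z) / n , m21 (κ z) / (n * n)

      sl : ∀ {w} → w ∈ L → IsSL (prodWord w)
      sl {w} w∈ = SL-prodWord ℓ w (lengths w w∈)

      κ-cross : ∀ x y → Cross (s · prodWord x) (t · prodWord y) (κ (x , y))
      κ-cross x y = Cross-· s t (prodWord x) (prodWord y) cr

      both : ∀ {z} → z ∈ LL → proj₁ z ∈ L × proj₂ z ∈ L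
      both {z} z∈ = ∈-cartesianProduct⁻ L L z∈

      κ-SL : ∀ z → z ∈ LL → IsSL (κ z)
      κ-SL z@(x , y) z∈ = Cross-SL _ _ (κ z) (κ-cross x y)
        (SL-· s (prodWord x) ss (sl (proj₁ (both z∈)))) (SL-· t (prodWord y) st (sl (proj₂ (both z∈))))

      κ≤ : ∀ z → z ∈ LL → m12 (κ z) ≤ Z × m21 (κ z) ≤ Z
      κ≤ z@(x , y) z∈ =
        bound {m11 u * m22 v} {m21 u} {m12 v} (Cross.c12 (κ-cross x y)) (proj₁ (proj₂ (proj₂ (normSq-entry u)))) (proj₁ (normSq-entry v)) ,
        bound {m12 u * m21 v} {m22 u} {m11 v} (Cross.c21 (κ-cross x y)) (proj₂ (proj₂ (proj₂ (normSq-entry u)))) (proj₁ (proj₂ (normSq-entry v)))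
        where
        u = s · prodWord x
        v = t · prodWord y
        bound : ∀ {e a b c} → a * b ≡ e + c → a * a ≤ normSq u → b * b ≤ normSq v → c ≤ Z
        bound {e} {a} {b} {c} eq la lb = ≤-trans (m≤n+m c e) (≤-trans (≤-reflexive (sym eq))
          (product≤ {a} {b} (≤-trans la (hs x (proj₁ (both z∈)))) (≤-trans lb (ht y (proj₂ (both z∈))))))

      facts : ∀ z → z ∈ LL → R z → (+ n ∣ + m12 (κ z) ℤ.+ + 1) × (+ (n * n) ∣ + m12 (κ z) ℤ.+ + 2 ℤ.- + m21 (κ z))
      facts z@(x , y) z∈ r = Cross-congruent n _ _ (κ z) (κ-cross x y)
        (SL-· s (prodWord x) ss (sl (proj₁ (both z∈)))) (SL-· t (prodWord y) st (sl (proj₂ (both z∈)))) r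

      -- The order matters: κ₁₂ lies in a fixed class modulo n, but the class of κ₂₁ modulo n² is
      -- known only in terms of κ₁₂.
      key-determines : ∀ z w → z ∈ LL → w ∈ LL → R z → R w → key z ≡ key w → m12 (κ z) ≡ m12 (κ w) × m21 (κ z) ≡ m21 (κ w)
      key-determines z w z∈ w∈ rz rw e = e₁₂ , e₂₁
        where
        i : ∀ a b → (a ℤ.+ + 1) ℤ.- (b ℤ.+ + 1) ≡ a ℤ.- b
        i = ℤSolver.solve-∀
        j : ∀ c a b → (c ℤ.+ + 2 ℤ.- b) ℤ.- (c ℤ.+ + 2 ℤ.- a) ≡ a ℤ.- b
        j = ℤSolver.solve-∀
        e₁₂ : m12 (κ z) ≡ m12 (κ w)
        e₁₂ = Congruent-/⇒≡ (m12 (κ z)) (m12 (κ w))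
          (subst (+ n ∣_) (i (+ m12 (κ z)) (+ m12 (κ w))) (∣m∣n⇒∣m-n (proj₁ (facts z z∈ rz)) (proj₁ (facts w w∈ rw)))) (,-injectiveˡ e)
        e₂₁ : m21 (κ z) ≡ m21 (κ w)
        e₂₁ = Congruent-/⇒≡ (m21 (κ z)) (m21 (κ w))
          (subst (+ (n * n) ∣_) (j (+ m12 (κ w)) (+ m21 (κ z)) (+ m21 (κ w)))
            (∣m∣n⇒∣m-n (proj₂ (facts w w∈ rw)) (subst (λ v → + (n * n) ∣ + v ℤ.+ + 2 ℤ.- + m21 (κ z)) e₁₂ (proj₂ (facts z z∈ rz))))) (,-injectiveʳ e)

      _≟²_ : (a b : ℕ × ℕ) → Dec (a ≡ b)
      _≟²_ = ≡-dec _≟_ _≟_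

      fibre : ∀ q → q ∈ keys → ∑[ z ∈ LL ] 𝟙 (R? z ×-dec (key z ≟² q)) ≤ suc D * Δ
      fibre q _ with search (λ z → R? z ×-dec (key z ≟² q)) LL
      ... | inj₂ none = ≤-trans (≤-reflexive (count-none (λ z → R? z ×-dec (key z ≟² q)) LL none)) z≤n
      ... | inj₁ (z₀ , z₀∈ , r₀ , e₀) = begin
        ∑[ z ∈ LL ] 𝟙 (R? z ×-dec (key z ≟² q))
          ≤⟨ count-injection (λ z → R? z ×-dec (key z ≟² q)) LL (cartesianProduct (interval 0 (suc D)) (divisors m))
               (λ z → headDigit (proj₂ z) , m11 (κ z)) (Unique.cartesianProduct⁺ unique unique) into inj ⟩
        length (cartesianProduct (interval 0 (suc D)) (divisors m))
          ≡⟨ length-cartesianProduct (interval 0 (suc D)) (divisors m) ⟩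
        length (interval 0 (suc D)) * #divisors m
          ≡⟨ cong (_* #divisors m) (length-interval 0 (suc D)) ⟩
        suc D * #divisors m
          ≤⟨ *-monoʳ-≤ (suc D) (hΔ m (s≤s (*-mono-≤ (proj₁ (κ≤ z₀ z₀∈)) (proj₂ (κ≤ z₀ z₀∈)))) (s≤s z≤n)) ⟩
        suc D * Δ ∎
        where
        open ≤-Reasoning
        m = 1 + m12 (κ z₀) * m21 (κ z₀)
        same : ∀ z → z ∈ LL → R z × key z ≡ q → m12 (κ z) ≡ m12 (κ z₀) × m21 (κ z) ≡ m21 (κ z₀)
        same z z∈ (r , e) = key-determines z z₀ z∈ z₀∈ r r₀ (trans e (sym e₀))
        det : ∀ z → z ∈ LL → R z × key z ≡ q → m11 (κ z) * m22 (κ z) ≡ m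
        det z z∈ h = trans (κ-SL z z∈) (cong₂ (λ u v → 1 + u * v) (proj₁ (same z z∈ h)) (proj₂ (same z z∈ h)))
        into : ∀ z → z ∈ LL → R z × key z ≡ q → (headDigit (proj₂ z) , m11 (κ z)) ∈ cartesianProduct (interval 0 (suc D)) (divisors m)
        into z z∈ h = ∈-cartesianProduct⁺ (∈-interval⁺ 0 (suc D) z≤n (s≤s (head≤ _ (proj₂ (both z∈)))))
          (∈-divisors⁺ (s≤s z≤n) (ℕᵈ.divides (m22 (κ z)) (trans (sym (det z z∈ h)) (*-comm (m11 (κ z)) (m22 (κ z))))))
        inj : ∀ z w → z ∈ LL → w ∈ LL → R z × key z ≡ q → R w × key w ≡ q →
          (headDigit (proj₂ z) , m11 (κ z)) ≡ (headDigit (proj₂ w) , m11 (κ w)) → z ≡ w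
        inj z@(x , y) w@(x′ , y′) z∈ w∈ hz hw e =
          let (x∈ , y∈) = both z∈ ; (x′∈ , y′∈) = both w∈
              (ex , ey) = sandwich-injective k (Cross-SL s t k cr ss st) (sl x∈) (sl x′∈) (digits x x∈) (digits x′ x′∈) (digits y y∈) (digits y′ y′∈)
                (trans (lengths x x∈) (sym (lengths x′ x′∈))) (trans (lengths y y∈) (sym (lengths y′ y′∈))) (,-injectiveˡ e)
                (mat-≡ e₁ (trans (proj₁ (same z z∈ hz)) (sym (proj₁ (same w w∈ hw)))) (trans (proj₂ (same z z∈ hz)) (sym (proj₂ (same w w∈ hw)))) e₄)
          in cong₂ _,_ ex ey
          where
          e₁ : m11 (κ z) ≡ m11 (κ w)
          e₁ = ,-injectiveʳ e
          k11≢0 : NonZero (m11 (κ z))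
          k11≢0 = ≢-nonZero λ e0 → 1+n≢0 (sym (trans (sym (cong (_* m22 (κ z)) e0)) (det z z∈ hz)))
          e₄ : m22 (κ z) ≡ m22 (κ w)
          e₄ = *-cancelˡ-≡ (m22 (κ z)) (m22 (κ w)) (m11 (κ z)) {{k11≢0}}
            (trans (det z z∈ hz) (trans (sym (det w w∈ hw)) (cong (_* m22 (κ w)) (sym e₁))))

    -- The factors count the choices for κ = ᵗ(s x) J (t y) = ᵗx k y: at most 1 + Z/n values of κ₁₂,
    -- then 1 + Z/n² of κ₂₁, then Δ of κ₁₁ as a divisor of 1 + κ₁₂κ₂₁, which also fixes κ₂₂. With
    -- one of D + 1 head digits for y this determines the pair.
    sandwich-count : ∑[ x ∈ L ] ∑[ y ∈ L ] 𝟙 (≈? n (s · prodWord x) (t · prodWord y)) ≤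
      suc (Z / n) * suc (Z / (n * n)) * (suc D * Δ)
    sandwich-count = begin
      ∑[ x ∈ L ] ∑[ y ∈ L ] 𝟙 (R? (x , y))        ≡⟨ sym (∑-cartesianProduct L L (λ z → 𝟙 (R? z))) ⟩
      ∑[ z ∈ LL ] 𝟙 (R? z)                        ≤⟨ count-fibres R? _≟²_ LL keys key (suc D * Δ) into fibre ⟩
      length keys * (suc D * Δ)                   ≡⟨ cong (_* (suc D * Δ)) (trans (length-cartesianProduct (interval 0 (suc (Z / n))) (interval 0 (suc (Z / (n * n)))))
                                                       (cong₂ _*_ (length-interval 0 (suc (Z / n))) (length-interval 0 (suc (Z / (n * n)))))) ⟩
      suc (Z / n) * suc (Z / (n * n)) * (suc D * Δ) ∎
      where
      open ≤-Reasoning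
      into : ∀ z → z ∈ LL → R z → key z ∈ keys
      into z z∈ _ = ∈-cartesianProduct⁺ (∈-interval⁺ 0 _ z≤n (s≤s (/-monoˡ-≤ n (proj₁ (κ≤ z z∈)))))
        (∈-interval⁺ 0 _ z≤n (s≤s (/-monoˡ-≤ (n * n) (proj₂ (κ≤ z z∈)))))

-- Block sets, their powers, and mean-square equidistribution modulo n

module Blocks where

  open Counting
  open Divisors
  open Words
  open Collisions
  open import Data.Nat
  open import Data.Nat.Properties
  open import Data.Nat.DivMod using (_/_; m/n*n≤m)

  Word : Set
  Word = List ℕ

  _≟ʷ_ : (u v : Word) → Dec (u ≡ v)
  _≟ʷ_ = List.≡-dec _≟_

  ++-injective : ∀ {A : Set} (u u′ : List A) {v v′} → length u ≡ length u′ → u ++ v ≡ u′ ++ v′ → u ≡ u′ × v ≡ v′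
  ++-injective [] [] _ e = refl , e
  ++-injective (x ∷ u) (x′ ∷ u′) el e =
    let (e₁ , e₂) = ∷-injective e ; (e₃ , e₄) = ++-injective u u′ (suc-injective el) e₂ in cong₂ _∷_ e₁ e₃ , e₄

  concatenations : List Word → List Word → List Word
  concatenations L K = map (uncurry _++_) (cartesianProduct L K)

  pow : List Word → ℕ → List Word
  pow T zero = [] ∷ []
  pow T (suc j) = concatenations T (pow T j)

  ∑-concatenations : ∀ L K (f : Word → ℕ) → ∑ (concatenations L K) f ≡ ∑[ u ∈ L ] ∑[ v ∈ K ] f (u ++ v)
  ∑-concatenations L K f = trans (∑-map (cartesianProduct L K) (uncurry _++_) f) (∑-cartesianProduct L K _)

  ∑-pow-+ : ∀ T i j (f : Word → ℕ) → ∑ (pow T (i + j)) f ≡ ∑[ u ∈ pow T i ] ∑[ v ∈ pow T j ] f (u ++ v)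
  ∑-pow-+ T zero j f = sym (+-identityʳ _)
  ∑-pow-+ T (suc i) j f = begin
    ∑ (pow T (suc i + j)) f                                                  ≡⟨ ∑-concatenations T (pow T (i + j)) f ⟩
    ∑[ t ∈ T ] ∑[ w ∈ pow T (i + j) ] f (t ++ w)                             ≡⟨ ∑-cong T (λ t → ∑-pow-+ T i j (λ w → f (t ++ w))) ⟩
    ∑[ t ∈ T ] ∑[ u ∈ pow T i ] ∑[ v ∈ pow T j ] f (t ++ (u ++ v))           ≡⟨ ∑-cong T (λ t → ∑-cong (pow T i) λ u → ∑-cong (pow T j) λ v → cong f (sym (++-assoc t u v))) ⟩
    ∑[ t ∈ T ] ∑[ u ∈ pow T i ] ∑[ v ∈ pow T j ] f ((t ++ u) ++ v)           ≡⟨ sym (∑-concatenations T (pow T i) (λ u → ∑[ v ∈ pow T j ] f (u ++ v))) ⟩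
    ∑[ u ∈ pow T (suc i) ] ∑[ v ∈ pow T j ] f (u ++ v)                       ∎
    where
    open ≡-Reasoning

  ∈-concatenations⁻ : ∀ L K {w} → w ∈ concatenations L K → ∃ λ u → ∃ λ v → u ∈ L × v ∈ K × w ≡ u ++ v
  ∈-concatenations⁻ L K w∈ with ∈-map⁻ (uncurry _++_) w∈
  ... | (u , v) , uv∈ , e = let (u∈ , v∈) = ∈-cartesianProduct⁻ L K uv∈ in u , v , u∈ , v∈ , e

  length-concatenations : ∀ L K → length (concatenations L K) ≡ length L * length K
  length-concatenations L K = trans (length-map (uncurry _++_) (cartesianProduct L K)) (length-cartesianProduct L K)

  length-pow : ∀ T j → length (pow T j) ≡ length T ^ j
  length-pow T zero = refl
  length-pow T (suc j) = trans (length-concatenations T (pow T j)) (cong (length T *_) (length-pow T j))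

  Unique-concatenations : ∀ L K k → (∀ u → u ∈ L → length u ≡ k) → Unique L → Unique K → Unique (concatenations L K)
  Unique-concatenations L K k lens uL uK = Unique-map-∈ (uncurry _++_) (cartesianProduct L K) (Unique.cartesianProduct⁺ uL uK)
    λ (u , v) (u′ , v′) m m′ e →
      let (eu , ev) = ++-injective u u′ (trans (lens u (proj₁ (∈-cartesianProduct⁻ L K m))) (sym (lens u′ (proj₁ (∈-cartesianProduct⁻ L K m′))))) e
      in cong₂ _,_ eu ev

  module _ (T : List Word) where

    pow-length : ∀ {ℓ} → (∀ t → t ∈ T → length t ≡ 2 * ℓ) → ∀ j w → w ∈ pow T j → length w ≡ 2 * (j * ℓ)
    pow-length h zero w (here refl) = refl
    pow-length {ℓ} h (suc j) w w∈ with ∈-concatenations⁻ T (pow T j) w∈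
    ... | t , v , t∈ , v∈ , refl = trans (length-++ t) (trans (cong₂ _+_ (h t t∈) (pow-length h j v v∈)) (sym (*-distribˡ-+ 2 ℓ (j * ℓ))))

    pow-All : ∀ {P : ℕ → Set} → (∀ t → t ∈ T → All P t) → ∀ j w → w ∈ pow T j → All P w
    pow-All h zero w (here refl) = []
    pow-All h (suc j) w w∈ with ∈-concatenations⁻ T (pow T j) w∈
    ... | t , v , t∈ , v∈ , refl = All.++⁺ (h t t∈) (pow-All h j v v∈)

    Unique-pow : ∀ {k} → (∀ t → t ∈ T → length t ≡ k) → Unique T → ∀ j → Unique (pow T j)
    Unique-pow h u zero = [] ∷ []
    Unique-pow {k} h u (suc j) = Unique-concatenations T (pow T j) k h u (Unique-pow h u j)

  -- With X = b^K, `size` says |T| = X^(2 - 1/K), as an equation so that it can be raised to powers.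
  -- The common length makes concatenation injective, and the common ending gives `cross-words` its
  -- nonempty tail.
  record Blocks (q K : ℕ) : Set where
    field
      b : ℕ
      2≤b : 2 ≤ b
      T : List Word
      ℓ D : ℕ
      unique : Unique T
      lengths : ∀ t → t ∈ T → length t ≡ 2 * ℓ
      digits : ∀ t → t ∈ T → All (λ a → 1 ≤ a × a ≤ D) t
      norms : ∀ t → t ∈ T → normSq (prodWord t) ≤ b ^ K * b ^ K
      endings : ∀ t → t ∈ T → ∃ λ u → t ≡ u ++ 1 ∷ 1 ∷ []
      size : b * length T ≡ b ^ K * b ^ K
      residues : ∀ t → t ∈ T → prodWord t ≈ I₂ [mod q ]

  module BlockPowers {q K : ℕ} .{{_ : NonZero K}} (𝔅 : Blocks q K) where
    open Blocks 𝔅 public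

    X τ : ℕ
    X = b ^ K
    τ = length T

    Z : ℕ → ℕ
    Z j = (X * X) ^ j

    instance
      b≢0 : NonZero b
      b≢0 = >-nonZero (≤-trans (s≤s z≤n) 2≤b)

    1≤X : 1 ≤ X
    1≤X = m^n>0 b K

    1≤XX : 1 ≤ X * X
    1≤XX = *-mono-≤ 1≤X 1≤X

    1≤Z : ∀ j → 1 ≤ Z j
    1≤Z j = m^n>0 (X * X) {{>-nonZero 1≤XX}} j

    Z-step : ∀ j → Z j ≤ Z (suc j)
    Z-step j = ≤-trans (≤-reflexive (sym (+-identityʳ (Z j)))) (*-monoˡ-≤ (Z j) 1≤XX)

    τ≤XX : τ ≤ X * X
    τ≤XX = ≤-trans (≤-trans (≤-reflexive (sym (+-identityʳ τ))) (*-monoˡ-≤ τ (≤-trans (n≤1+n 1) 2≤b))) (≤-reflexive size)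

    pow-lengths : ∀ j w → w ∈ pow T j → length w ≡ 2 * (j * ℓ)
    pow-lengths = pow-length T lengths

    pow-digits : ∀ j w → w ∈ pow T j → All (λ a → 1 ≤ a × a ≤ D) w
    pow-digits = pow-All T digits

    pow-norms : ∀ j w → w ∈ pow T j → normSq (prodWord w) ≤ 2 * Z j
    pow-norms zero w (here refl) = ≤-refl
    pow-norms (suc j) w w∈ with ∈-concatenations⁻ T (pow T j) w∈
    ... | t , v , t∈ , v∈ , refl = begin
      normSq (prodWord (t ++ v))                   ≡⟨ cong normSq (prodWord-++ t v) ⟩
      normSq (prodWord t · prodWord v)             ≤⟨ normSq-· (prodWord t) (prodWord v) ⟩
      normSq (prodWord t) * normSq (prodWord v)    ≤⟨ *-mono-≤ (norms t t∈) (pow-norms j v v∈) ⟩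
      X * X * (2 * Z j)                            ≡⟨ i (X * X) (Z j) ⟩
      2 * Z (suc j)                                ∎
      where
      open ≤-Reasoning
      i : ∀ x z → x * (2 * z) ≡ 2 * (x * z)
      i = ℕSolver.solve-∀

    pow-residues : ∀ j w → w ∈ pow T j → prodWord w ≈ I₂ [mod q ]
    pow-residues zero w (here refl) = ≈-refl I₂
    pow-residues (suc j) w w∈ with ∈-concatenations⁻ T (pow T j) w∈
    ... | t , v , t∈ , v∈ , refl = subst (λ z → z ≈ I₂ [mod q ]) (sym (prodWord-++ t v))
      (≈-·-cong (prodWord t) {I₂} {prodWord v} {I₂} (residues t t∈) (pow-residues j v v∈))

    pow-unique : ∀ j → Unique (pow T j)
    pow-unique = Unique-pow T lengths unique

    pow-Digits : ∀ j w → w ∈ pow T j → Digits w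
    pow-Digits j w w∈ = All.map proj₁ (pow-digits j w w∈)

    pow-SL : ∀ j w → w ∈ pow T j → IsSL (prodWord w)
    pow-SL j w w∈ = SL-prodWord (j * ℓ) w (pow-lengths j w w∈)

    pow-WordList : ∀ j → WordList (pow T j) (j * ℓ) D
    pow-WordList j = record { unique = pow-unique j ; lengths = pow-lengths j ; digits = pow-Digits j ; head≤ = λ w w∈ → hd (pow-digits j w w∈) }
      where
      hd : ∀ {w} → All (λ a → 1 ≤ a × a ≤ D) w → headDigit w ≤ D
      hd [] = z≤n
      hd ((_ , h) ∷ _) = h

    t-SL : ∀ t → t ∈ T → IsSL (prodWord t)
    t-SL t t∈ = SL-prodWord ℓ t (lengths t t∈)

    collisions : ℕ → ℕ → ℕ
    collisions n j = ∑[ x ∈ pow T j ] ∑[ y ∈ pow T j ] 𝟙 (≈? n (prodWord x) (prodWord y))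

    private
      ^-cancelˡ-≤ : ∀ k .{{_ : NonZero k}} {x y} → x ^ k ≤ y ^ k → x ≤ y
      ^-cancelˡ-≤ k@(suc _) {x} {y} h with x ≤? y
      ... | yes l = l
      ... | no g = ⊥-elim (<-irrefl refl (<-≤-trans (^-monoˡ-< k (≰⇒> g)) h))

      n≤n^k : ∀ n k .{{_ : NonZero k}} → n ≤ n ^ k
      n≤n^k zero _ = z≤n
      n≤n^k (suc n) (suc k) = ≤-trans (≤-reflexive (sym (*-identityʳ (suc n)))) (*-monoʳ-≤ (suc n) (m^n>0 (suc n) k))

    -- The divisor bound at the exponent 1/(cK), expressed through b = X^(1/K).
    divisors≤ : ∀ c .{{_ : NonZero c}} → ∃ λ G → ∀ i V m → 1 ≤ m → m ≤ V * X ^ (c * i) → #divisors m ≤ G * V * b ^ i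
    divisors≤ c = C , λ i V m 1≤m m≤ → ^-cancelˡ-≤ (c * K) (begin
        #divisors m ^ (c * K)                   ≤⟨ h m 1≤m ⟩
        C * m                                   ≤⟨ *-monoʳ-≤ C m≤ ⟩
        C * (V * X ^ (c * i))                   ≡⟨ sym (*-assoc C V _) ⟩
        -- The constant C V is enlarged to its own power c K so that a root can be taken of the
        -- whole product.
        C * V * X ^ (c * i)                     ≤⟨ *-mono-≤ (n≤n^k (C * V) (c * K)) (≤-reflexive (power i)) ⟩
        (C * V) ^ (c * K) * (b ^ i) ^ (c * K)   ≡⟨ sym (^-distribʳ-* (C * V) (b ^ i) (c * K)) ⟩
        (C * V * b ^ i) ^ (c * K)               ∎)
      where
      open ≤-Reasoning
      instance
        cK≢0 : NonZero (c * K)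
        cK≢0 = m*n≢0 c K
      C = proj₁ (divisor-bound (c * K))
      h = proj₂ (divisor-bound (c * K))
      e : ∀ k c i → k * (c * i) ≡ i * (c * k)
      e = ℕSolver.solve-∀
      power : ∀ i → X ^ (c * i) ≡ (b ^ i) ^ (c * K)
      power i = trans (^-*-assoc b K (c * i)) (trans (cong (b ^_) (e K c i)) (sym (^-*-assoc b i (c * K))))

    Z≡X^ : ∀ i → Z i * Z i ≡ X ^ (4 * i)
    Z≡X^ i = begin
      (X * X) ^ i * (X * X) ^ i      ≡⟨ sym (^-distribʳ-* (X * X) (X * X) i) ⟩
      (X * X * (X * X)) ^ i          ≡⟨ cong (_^ i) (e X) ⟩
      (X ^ 4) ^ i                    ≡⟨ ^-*-assoc X 4 i ⟩
      X ^ (4 * i)                    ∎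
      where
      open ≡-Reasoning
      e : ∀ x → x * x * (x * x) ≡ x * (x * (x * (x * 1)))
      e = ℕSolver.solve-∀

    private
      G₄ : ℕ
      G₄ = proj₁ (divisors≤ 4)

      Δ : ℕ → ℕ
      Δ i = G₄ * 5 * b ^ i

      Δ-bound : ∀ i m → m ≤ suc (2 * Z i * (2 * Z i)) → 1 ≤ m → #divisors m ≤ Δ i
      Δ-bound i m m≤ 1≤m = proj₂ (divisors≤ 4) i 5 m 1≤m (≤-trans m≤ (begin
        suc (2 * Z i * (2 * Z i))      ≡⟨ cong suc (e (Z i)) ⟩
        1 + 4 * (Z i * Z i)            ≤⟨ +-monoˡ-≤ (4 * (Z i * Z i)) (*-mono-≤ (1≤Z i) (1≤Z i)) ⟩
        5 * (Z i * Z i)                ≡⟨ cong (5 *_) (Z≡X^ i) ⟩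
        5 * X ^ (4 * i)                ∎))
        where
        open ≤-Reasoning
        e : ∀ z → 2 * z * (2 * z) ≡ 4 * (z * z)
        e = ℕSolver.solve-∀

    module _ (n : ℕ) .{{_ : NonZero n}} where

      private
        instance
          nn≢0 : NonZero (n * n)
          nn≢0 = m*n≢0 n n

        offDiagonal : ℕ → ℕ
        offDiagonal j = suc (2 * Z (suc j) / n) * suc (2 * Z (suc j) / (n * n)) * (suc D * Δ (suc j))

        pairs : ℕ → Word → Word → ℕ
        pairs j t t′ = ∑[ w ∈ pow T j ] ∑[ w′ ∈ pow T j ] 𝟙 (≈? n (prodWord t · prodWord w) (prodWord t′ · prodWord w′))

        pairs-sym : ∀ j t t′ → pairs j t t′ ≤ pairs j t′ t
        pairs-sym j t t′ = ≤-trans (≤-reflexive (∑-swap (pow T j) (pow T j) _))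
          (∑-mono (pow T j) λ w′ → ∑-mono (pow T j) λ w → 𝟙-mono (≈? n (prodWord t · prodWord w) (prodWord t′ · prodWord w′)) (≈? n (prodWord t′ · prodWord w′) (prodWord t · prodWord w)) ≈-sym)

        pairs-same : ∀ j t → t ∈ T → pairs j t t ≤ collisions n j
        pairs-same j t t∈ = ∑-mono (pow T j) λ w → ∑-mono (pow T j) λ w′ →
          𝟙-mono (≈? n (prodWord t · prodWord w) (prodWord t · prodWord w′)) (≈? n (prodWord w) (prodWord w′)) (≈-cancelˡ (prodWord t) (t-SL t t∈))

        extended-norm : ∀ j t → t ∈ T → ∀ w → w ∈ pow T j → normSq (prodWord t · prodWord w) ≤ 2 * Z (suc j)
        extended-norm j t t∈ w w∈ = ≤-trans (≤-reflexive (cong normSq (sym (prodWord-++ t w))))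
          (pow-norms (suc j) (t ++ w) (∈-map⁺ (uncurry _++_) (∈-cartesianProduct⁺ t∈ w∈)))

        pairs-cross : ∀ j t t′ k → t ∈ T → t′ ∈ T → Cross (prodWord t) (prodWord t′) k → pairs j t t′ ≤ offDiagonal j
        pairs-cross j t t′ k t∈ t′∈ cr = SandwichCount.sandwich-count n (prodWord t) (prodWord t′) k cr (t-SL t t∈) (t-SL t′ t′∈)
          (pow-WordList j) (2 * Z (suc j)) (Δ (suc j)) (extended-norm j t t∈) (extended-norm j t′ t′∈) (Δ-bound (suc j))

        -- The ending 1, 1 shared by all blocks is the tail in `cross-words`. Whichever orientation
        -- results is acceptable because `pairs` is symmetric in the two blocks.
        pairs-distinct : ∀ j t t′ → t ∈ T → t′ ∈ T → ¬ t ≡ t′ → pairs j t t′ ≤ offDiagonal j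
        pairs-distinct j t t′ t∈ t′∈ ne with endings t t∈ | endings t′ t′∈
        ... | u , refl | u′ , refl with cross-words u u′ (1 ∷ []) {1}
                (All.map proj₁ (All.++⁻ˡ u (digits t t∈))) (All.map proj₁ (All.++⁻ˡ u′ (digits t′ t′∈))) (s≤s z≤n ∷ s≤s z≤n ∷ [])
                (+-cancelʳ-≡ 2 _ _ (trans (sym (length-++ u)) (trans (lengths t t∈) (trans (sym (lengths t′ t′∈)) (length-++ u′)))))
                (λ e → ne (cong (_++ 1 ∷ 1 ∷ []) e))
        ... | k , inj₁ cr = pairs-cross j t t′ k t∈ t′∈ cr
        ... | k , inj₂ cr = ≤-trans (pairs-sym j t t′) (pairs-cross j t′ t k t′∈ t∈ cr)

        -- The two products are compared by their first blocks: equal blocks cancel and leave a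
        -- collision of j blocks, distinct ones fall under the sandwich bound.
        collisions-step : ∀ j → collisions n (suc j) ≤ τ * collisions n j + τ * τ * offDiagonal j
        collisions-step j = begin
          collisions n (suc j)
            ≡⟨ ∑-concatenations T W _ ⟩
          ∑[ t ∈ T ] ∑[ w ∈ W ] ∑[ y ∈ pow T (suc j) ] 𝟙 (≈? n (prodWord (t ++ w)) (prodWord y))
            ≡⟨ ∑-cong T (λ t → ∑-cong W λ w → ∑-concatenations T W _) ⟩
          ∑[ t ∈ T ] ∑[ w ∈ W ] ∑[ t′ ∈ T ] ∑[ w′ ∈ W ] 𝟙 (≈? n (prodWord (t ++ w)) (prodWord (t′ ++ w′)))
            ≤⟨ ∑-mono T (λ t → ∑-mono W λ w → ∑-mono T λ t′ → ∑-mono W λ w′ →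
                 𝟙-mono (≈? n (prodWord (t ++ w)) (prodWord (t′ ++ w′))) (≈? n (prodWord t · prodWord w) (prodWord t′ · prodWord w′))
                   (subst₂ (λ x y → x ≈ y [mod n ]) (prodWord-++ t w) (prodWord-++ t′ w′))) ⟩
          ∑[ t ∈ T ] ∑[ w ∈ W ] ∑[ t′ ∈ T ] ∑[ w′ ∈ W ] 𝟙 (≈? n (prodWord t · prodWord w) (prodWord t′ · prodWord w′))
            ≡⟨ ∑-cong T (λ t → ∑-swap W T _) ⟩
          ∑[ t ∈ T ] ∑[ t′ ∈ T ] pairs j t t′
            ≤⟨ ∑-mono-∈ T (λ t t∈ → ∑-mono-∈ T λ t′ t′∈ → split t t′ t∈ t′∈) ⟩
          ∑[ t ∈ T ] ∑[ t′ ∈ T ] (𝟙 (t ≟ʷ t′) * collisions n j + offDiagonal j)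
            ≡⟨ ∑-cong T (λ t → trans (∑-+ T _ _) (cong₂ _+_ (∑-*ʳ T (collisions n j) _) (∑-const T (offDiagonal j)))) ⟩
          ∑[ t ∈ T ] (∑ T (λ t′ → 𝟙 (t ≟ʷ t′)) * collisions n j + τ * offDiagonal j)
            ≤⟨ ∑-mono T (λ t → +-monoˡ-≤ (τ * offDiagonal j) (*-monoˡ-≤ (collisions n j) (once t))) ⟩
          ∑[ t ∈ T ] (1 * collisions n j + τ * offDiagonal j)
            ≡⟨ ∑-const T _ ⟩
          τ * (1 * collisions n j + τ * offDiagonal j)
            ≡⟨ e τ (collisions n j) (offDiagonal j) ⟩
          τ * collisions n j + τ * τ * offDiagonal j ∎
          where
          open ≤-Reasoning
          W = pow T j
          e : ∀ t c o → t * (1 * c + t * o) ≡ t * c + t * t * o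
          e = ℕSolver.solve-∀
          split : ∀ t t′ → t ∈ T → t′ ∈ T → pairs j t t′ ≤ 𝟙 (t ≟ʷ t′) * collisions n j + offDiagonal j
          split t t′ t∈ t′∈ with t ≟ʷ t′
          ... | yes refl = ≤-trans (pairs-same j t t∈) (≤-trans (≤-reflexive (sym (+-identityʳ _))) (m≤m+n _ _))
          ... | no ne = pairs-distinct j t t′ t∈ t′∈ ne
          once : ∀ t → ∑[ t′ ∈ T ] 𝟙 (t ≟ʷ t′) ≤ 1
          once t = count-injection (t ≟ʷ_) T (t ∷ []) (λ t′ → t′) unique (λ t′ _ e → here (sym e)) (λ _ _ _ _ _ _ e → e)

        n³ : ℕ
        n³ = n * (n * n)

        -- The factor n³, the order of SL₂(ℤ/n) up to a constant, clears the two quotients by n and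
        -- n² at once.
        offDiagonal≤ : ∀ j → n³ * offDiagonal j ≤ 6 * (suc D * Δ (suc j)) * (Z (suc j) * (Z (suc j) + n³))
        offDiagonal≤ j = begin
          n³ * (suc (Y / n) * suc (Y / (n * n)) * E)                 ≡⟨ e₁ n (suc (Y / n)) (n * n) (suc (Y / (n * n))) E ⟩
          (suc (Y / n) * n) * (suc (Y / (n * n)) * (n * n)) * E      ≤⟨ *-monoˡ-≤ E (*-mono-≤ (+-monoʳ-≤ n (m/n*n≤m Y n)) (+-monoʳ-≤ (n * n) (m/n*n≤m Y (n * n)))) ⟩
          (n + Y) * (n * n + Y) * E                                  ≤⟨ *-monoˡ-≤ E poly ⟩
          6 * (z * (z + n³)) * E                                     ≡⟨ e₂ (z * (z + n³)) E ⟩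
          6 * E * (z * (z + n³))                                     ∎
          where
          open ≤-Reasoning
          z = Z (suc j)
          Y = 2 * z
          E = suc D * Δ (suc j)
          1≤n : 1 ≤ n
          1≤n = >-nonZero⁻¹ n
          e₁ : ∀ n a m b E → n * m * (a * b * E) ≡ (a * n) * (b * m) * E
          e₁ = ℕSolver.solve-∀
          e₂ : ∀ a E → 6 * a * E ≡ 6 * E * a
          e₂ = ℕSolver.solve-∀
          n≤n³ : n ≤ n³
          n≤n³ = ≤-trans (≤-reflexive (sym (*-identityʳ n))) (*-monoʳ-≤ n (*-mono-≤ 1≤n 1≤n))
          nn≤n³ : n * n ≤ n³
          nn≤n³ = ≤-trans (≤-reflexive (sym (+-identityʳ (n * n)))) (*-monoˡ-≤ (n * n) 1≤n)
          e₃ : ∀ n z m → (n + 2 * z) * (m + 2 * z) ≡ n * m + 2 * (z * n) + 2 * (z * m) + 4 * (z * z)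
          e₃ = ℕSolver.solve-∀
          e₄ : ∀ z c → z * c + 2 * (z * c) + 2 * (z * c) + 4 * (z * z) + (z * c + 2 * (z * z)) ≡ 6 * (z * (z + c))
          e₄ = ℕSolver.solve-∀
          poly : (n + Y) * (n * n + Y) ≤ 6 * (z * (z + n³))
          poly = begin
            (n + Y) * (n * n + Y)
              ≡⟨ e₃ n z (n * n) ⟩
            n³ + 2 * (z * n) + 2 * (z * (n * n)) + 4 * (z * z)
              ≤⟨ +-monoˡ-≤ (4 * (z * z)) (+-mono-≤ (+-mono-≤ (≤-trans (≤-reflexive (sym (+-identityʳ n³))) (*-monoˡ-≤ n³ (1≤Z (suc j))))
                   (*-monoʳ-≤ 2 (*-monoʳ-≤ z n≤n³))) (*-monoʳ-≤ 2 (*-monoʳ-≤ z nn≤n³))) ⟩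
            z * n³ + 2 * (z * n³) + 2 * (z * n³) + 4 * (z * z)
              ≤⟨ m≤m+n _ (z * n³ + 2 * (z * z)) ⟩
            z * n³ + 2 * (z * n³) + 2 * (z * n³) + 4 * (z * z) + (z * n³ + 2 * (z * z))
              ≡⟨ e₄ z n³ ⟩
            6 * (z * (z + n³)) ∎

      -- Depends on the block set alone and has the same value for every n.
      collision-constant : ℕ
      collision-constant = suc (τ * τ * (6 * (suc D * (G₄ * 5))))

      -- Divided by n³, the right side has the term Z²/n³ of perfect equidistribution and the term Z
      -- of the diagonal, up to the divisor loss b^j. The factor j + 1 has one share for each
      -- possible number of common first blocks.
      collisions≤ : ∀ j → n * (n * n) * collisions n j ≤ collision-constant * suc j * b ^ j * (Z j * (Z j + n * (n * n)))
      collisions≤ zero = begin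
        n³ * collisions n 0                     ≤⟨ *-monoʳ-≤ n³ (+-monoˡ-≤ 0 (+-monoˡ-≤ 0 (𝟙≤1 (≈? n I₂ I₂)))) ⟩
        n³ * 1                                  ≡⟨ *-identityʳ n³ ⟩
        n³                                      ≤⟨ n≤1+n n³ ⟩
        1 + n³                                  ≡⟨ sym (+-identityʳ _) ⟩
        1 * (1 + n³)                            ≤⟨ *-mono-≤ {1} {collision-constant * 1 * 1} (s≤s z≤n) (≤-reflexive (sym (+-identityʳ (1 + n³)))) ⟩
        collision-constant * 1 * 1 * (1 * (1 + n³)) ∎
        where open ≤-Reasoning
      collisions≤ (suc j) = begin
        n³ * collisions n (suc j)
          ≤⟨ *-monoʳ-≤ n³ (collisions-step j) ⟩
        n³ * (τ * collisions n j + τ * τ * offDiagonal j)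
          ≡⟨ e₁ n³ τ (collisions n j) (offDiagonal j) ⟩
        τ * (n³ * collisions n j) + τ * τ * (n³ * offDiagonal j)
          ≤⟨ +-mono-≤ (*-monoʳ-≤ τ (collisions≤ j)) (*-monoʳ-≤ (τ * τ) (offDiagonal≤ j)) ⟩
        τ * (C * suc j * b ^ j * (Z j * (Z j + n³))) + τ * τ * (6 * (suc D * Δ (suc j)) * W)
          ≡⟨ cong₂ _+_ (e₂ τ (C * suc j) (b ^ j) (Z j) (Z j + n³)) (e₃ (τ * τ) (suc D) (G₄ * 5) (b ^ suc j) W) ⟩
        C * suc j * b ^ j * ((τ * Z j) * (Z j + n³)) + τ * τ * (6 * (suc D * (G₄ * 5))) * b ^ suc j * W
          ≤⟨ +-mono-≤
               (*-mono-≤ (*-monoʳ-≤ (C * suc j) (^-monoʳ-≤ b (n≤1+n j))) (*-mono-≤ (*-monoˡ-≤ (Z j) τ≤XX) (+-monoˡ-≤ n³ (Z-step j))))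
               (*-monoˡ-≤ W (*-monoˡ-≤ (b ^ suc j) (n≤1+n (τ * τ * (6 * (suc D * (G₄ * 5))))))) ⟩
        C * suc j * b ^ suc j * W + C * b ^ suc j * W
          ≡⟨ e₄ C (suc j) (b ^ suc j) W ⟩
        C * suc (suc j) * b ^ suc j * W ∎
        where
        open ≤-Reasoning
        C = collision-constant
        W = Z (suc j) * (Z (suc j) + n³)
        e₁ : ∀ n t c o → n * (t * c + t * t * o) ≡ t * (n * c) + t * t * (n * o)
        e₁ = ℕSolver.solve-∀
        e₂ : ∀ t c b z y → t * (c * b * (z * y)) ≡ c * b * ((t * z) * y)
        e₂ = ℕSolver.solve-∀
        e₃ : ∀ t d g b w → t * (6 * (d * (g * b)) * w) ≡ t * (6 * (d * g)) * b * w
        e₃ = ℕSolver.solve-∀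
        e₄ : ∀ c j b w → c * j * b * w + c * b * w ≡ c * (1 + j) * b * w
        e₄ = ℕSolver.solve-∀

-- Quadratic congruences modulo p²: two leading digits, conics, and products of two factors

module Quadratics where

  open Counting
  open Congruences
  open Words
  open import Data.Nat using (ℕ; suc; NonZero; z≤n)
  import Data.Nat as ℕ
  import Data.Nat.Properties as ℕ
  import Data.Nat.DivMod as ℕ
  open import Data.Nat.Primality using (Prime; euclidsLemma; prime⇒nonZero; ¬prime[1])
  open import Data.Integer using (ℤ; +_; _+_; _*_; _-_; -_)
  open import Data.Integer.Divisibility.Signed
  import Data.Sum as Sum

  ∣-≡ : ∀ {n a b} → a ≡ b → n ∣ a → n ∣ b
  ∣-≡ {n} e = subst (n ∣_) e

  module PrimeModulus {p : ℕ} (pp : Prime p) where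

    instance
      p≢0 : NonZero p
      p≢0 = prime⇒nonZero pp

    n : ℕ
    n = p ℕ.* p

    instance
      n≢0 : NonZero n
      n≢0 = ℕ.m*n≢0 p p

    euclid : ∀ a b → + p ∣ a * b → + p ∣ a ⊎ + p ∣ b
    euclid a b h = Sum.map ∣ᵤ⇒∣ ∣ᵤ⇒∣ (euclidsLemma ℤ.∣ a ∣ ℤ.∣ b ∣ pp (subst (p ℕᵈ.∣_) (ℤ.abs-* a b) (∣⇒∣ᵤ h)))

    p∤1 : ¬ + p ∣ + 1
    p∤1 h with ℕᵈ.∣1⇒≡1 (∣⇒∣ᵤ h)
    ... | refl = ¬prime[1] pp

    n⇒p : ∀ {a} → + n ∣ a → + p ∣ a
    n⇒p h = ∣-trans (divides (+ p) (ℤ.pos-* p p)) h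

    cancel-unit-p : ∀ a b → ¬ + p ∣ a → + p ∣ a * b → + p ∣ b
    cancel-unit-p a b p∤a h with euclid a b h
    ... | inj₁ d = ⊥-elim (p∤a d)
    ... | inj₂ d = d

    cancel-unit : ∀ a b → ¬ + p ∣ a → + n ∣ a * b → + n ∣ b
    cancel-unit a b p∤a h with cancel-unit-p a b p∤a (n⇒p h)
    ... | divides k refl = subst (_∣ k * + p) (sym (ℤ.pos-* p p))
      (*-monoˡ-∣ (+ p) (cancel-unit-p a k p∤a (*-cancelʳ-∣ (+ p) (subst₂ _∣_ (ℤ.pos-* p p) (sym (ℤ.*-assoc a k (+ p))) h))))

    module Roots (α β γ : ℤ) where

      f : ℤ → ℤ
      f x = α * (x * x) + β * x + γ

      disc-id : ∀ x → (+ 2 * α * x + β) * (+ 2 * α * x + β) ≡ (β * β - + 4 * α * γ) + + 4 * α * f x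
      disc-id x = e α β γ x
        where
        e : ∀ α β γ x → (+ 2 * α * x + β) * (+ 2 * α * x + β) ≡ (β * β - + 4 * α * γ) + + 4 * α * (α * (x * x) + β * x + γ)
        e = ℤSolver.solve-∀

      difference : ∀ x y → f x - f y ≡ (α * (x + y) + β) * (x - y)
      difference x y = e α β γ x y
        where
        e : ∀ α β γ x y → (α * (x * x) + β * x + γ) - (α * (y * y) + β * y + γ) ≡ (α * (x + y) + β) * (x - y)
        e = ℤSolver.solve-∀

      two-roots-p : ¬ (+ p ∣ α × + p ∣ β) → ∀ x y z → + p ∣ f x → + p ∣ f y → + p ∣ f z →
        + p ∣ x - y ⊎ + p ∣ x - z ⊎ + p ∣ y - z
      two-roots-p nd x y z hx hy hz
        with euclid _ (x - y) (∣-≡ (difference x y) (∣m∣n⇒∣m-n hx hy)) | euclid _ (x - z) (∣-≡ (difference x z) (∣m∣n⇒∣m-n hx hz))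
      ... | inj₂ d | _ = inj₁ d
      ... | inj₁ _ | inj₂ d = inj₂ (inj₁ d)
      ... | inj₁ d₁ | inj₁ d₂ with euclid α (y - z) (∣-≡ (e α β x y z) (∣m∣n⇒∣m-n d₁ d₂))
        where
        e : ∀ α β x y z → (α * (x + y) + β) - (α * (x + z) + β) ≡ α * (y - z)
        e = ℤSolver.solve-∀
      ... | inj₂ d = inj₂ (inj₂ d)
      ... | inj₁ d = ⊥-elim (nd (d , ∣m+n∣m⇒∣n d₁ (∣m⇒∣m*n (x + y) d)))

      -- Uniqueness in Hensel's lemma. If x ≡ y mod p, the cofactor of x - y in f x - f y is ≡ 2αx +
      -- β, whose square is ≡ the discriminant and so is a unit.
      two-roots : ¬ + p ∣ β * β - + 4 * α * γ → ∀ x y z → + n ∣ f x → + n ∣ f y → + n ∣ f z →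
        + n ∣ x - y ⊎ + n ∣ x - z ⊎ + n ∣ y - z
      two-roots nd x y z hx hy hz = Sum.map (lift x y hx hy) (Sum.map (lift x z hx hz) (lift y z hy hz))
        (two-roots-p (λ (pα , pβ) → nd (∣m∣n⇒∣m-n (∣m⇒∣m*n β pβ) (∣m⇒∣m*n γ (∣n⇒∣m*n (+ 4) pα)))) x y z (n⇒p hx) (n⇒p hy) (n⇒p hz))
        where
        e : ∀ α β x y → (α * (x + y) + β) + α * (x - y) ≡ + 2 * α * x + β
        e = ℤSolver.solve-∀
        lift : ∀ x y → + n ∣ f x → + n ∣ f y → + p ∣ x - y → + n ∣ x - y
        lift x y hx hy d = cancel-unit (α * (x + y) + β) (x - y)
          (λ h → nd (∣m+n∣n⇒∣m (∣-≡ (disc-id x) (∣m⇒∣m*n _ (∣-≡ (e α β x y) (∣m∣n⇒∣m+n h (∣n⇒∣m*n α d))))) (∣n⇒∣m*n (+ 4 * α) (n⇒p hx))))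
          (∣-≡ (difference x y) (∣m∣n⇒∣m-n hx hy))

      -- Here (2αx + β)² ≡ 0 mod p, so the root is unique modulo p. Modulo p² it may lift to p
      -- classes, so only the modulus p is claimed.
      double-root : + p ∣ β * β - + 4 * α * γ → ¬ + p ∣ + 2 * α → ∀ x y → + p ∣ f x → + p ∣ f y → + p ∣ x - y
      double-root d nd x y hx hy = cancel-unit-p (+ 2 * α) (x - y) nd (∣-≡ (e α β x y) (∣m∣n⇒∣m-n (half x hx) (half y hy)))
        where
        half : ∀ x → + p ∣ f x → + p ∣ + 2 * α * x + β
        half x hx = Sum.reduce (euclid (+ 2 * α * x + β) (+ 2 * α * x + β) (∣-≡ (sym (disc-id x)) (∣m∣n⇒∣m+n d (∣n⇒∣m*n (+ 4 * α) hx))))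
        e : ∀ α β x y → (+ 2 * α * x + β) - (+ 2 * α * y + β) ≡ + 2 * α * (x - y)
        e = ℤSolver.solve-∀

  pos-sq : ∀ a → + (a ℕ.* a) ≡ + a * + a
  pos-sq a = ℤ.pos-* a a

  -- Primality belongs to the condition, so that sums may run over all integers p of an interval.
  Bad : ℤ → ℕ → Mat → Set
  Bad ε p g = Prime p × + (p ℕ.* p) ∣ + normSq g - + 2 * ε

  module OddPrime {p : ℕ} (pp : Prime p) (2<p : 2 ℕ.< p) (ε : ℤ) (εε : ε * ε ≡ + 1) where
    open PrimeModulus pp

    p∤2 : ¬ + p ∣ + 2
    p∤2 h = ℕ.<⇒≱ 2<p (ℕᵈ.∣⇒≤ (∣⇒∣ᵤ h))

    p∤ε : ¬ + p ∣ ε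
    p∤ε h = p∤1 (∣-≡ εε (∣m⇒∣m*n ε h))

    p∤* : ∀ {a b} → ¬ + p ∣ a → ¬ + p ∣ b → ¬ + p ∣ a * b
    p∤* {a} {b} ha hb h = Sum.[ ha , hb ] (euclid a b h)

    p∤4 : ¬ + p ∣ + 4
    p∤4 = p∤* {+ 2} {+ 2} p∤2 p∤2

    -- With the rows r, s of w, the top digit a and the second digit b, the matrix has rows
    -- a S + r and S = b r + s, and t − 2ε is a quadratic in a of discriminant −4(|S|² − ε)².
    module Wild (q A : ℕ) (p∤q : ¬ + p ∣ + q) (n≤A : n ℕ.≤ A) (w : Mat) (sl : IsSL w) where

      r₁ r₂ s₁ s₂ : ℤ
      r₁ = + m11 w
      r₂ = + m12 w
      s₁ = + m21 w
      s₂ = + m22 w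

      det : r₁ * s₂ - r₂ * s₁ ≡ + 1
      det = trans (cong (_- r₂ * s₁) (SLℤ {m11 w} {m12 w} {m21 w} {m22 w} sl)) (e (r₂ * s₁))
        where
        e : ∀ z → + 1 + z - z ≡ + 1
        e = ℤSolver.solve-∀

      a b : ℕ → ℕ
      a x = suc (q ℕ.* x)
      b y = q ℕ.* y

      g : ℕ → ℕ → Mat
      g x y = M (a x) · (M (b y) · w)

      S₁ S₂ N β γ : ℕ → ℤ
      S₁ y = + b y * r₁ + s₁
      S₂ y = + b y * r₂ + s₂
      N y = S₁ y * S₁ y + S₂ y * S₂ y
      β y = + 2 * (S₁ y * r₁ + S₂ y * r₂)
      γ y = r₁ * r₁ + r₂ * r₂ + N y - + 2 * ε

      norm-formula : ∀ x y → + normSq (g x y) - + 2 * ε ≡ N y * (+ a x * + a x) + β y * + a x + γ y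
      norm-formula x y = trans (cong (_- + 2 * ε) (trans (cong (λ z → + normSq z) shape) expand)) (e (+ a x) (S₁ y) (S₂ y) r₁ r₂ ε)
        where
        u₁ = b y ℕ.* m11 w ℕ.+ m21 w
        u₂ = b y ℕ.* m12 w ℕ.+ m22 w
        shape : g x y ≡ mat (a x ℕ.* u₁ ℕ.+ m11 w) (a x ℕ.* u₂ ℕ.+ m12 w) u₁ u₂
        shape = trans (cong (M (a x) ·_) (M-· (b y) w)) (M-· (a x) (mat u₁ u₂ (m11 w) (m12 w)))
        U₁ : + u₁ ≡ S₁ y
        U₁ = cong (_+ s₁) (ℤ.pos-* (b y) (m11 w))
        U₂ : + u₂ ≡ S₂ y
        U₂ = cong (_+ s₂) (ℤ.pos-* (b y) (m12 w))
        V : ∀ u r {S} → + u ≡ S → + (a x ℕ.* u ℕ.+ r) ≡ + a x * S + + r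
        V u r e = cong (_+ + r) (trans (ℤ.pos-* (a x) u) (cong (+ a x *_) e))
        sq : ∀ u {S} → + u ≡ S → + (u ℕ.* u) ≡ S * S
        sq u e = trans (pos-sq u) (cong₂ _*_ e e)
        expand : + normSq (mat (a x ℕ.* u₁ ℕ.+ m11 w) (a x ℕ.* u₂ ℕ.+ m12 w) u₁ u₂) ≡
          (+ a x * S₁ y + r₁) * (+ a x * S₁ y + r₁) + (+ a x * S₂ y + r₂) * (+ a x * S₂ y + r₂) + S₁ y * S₁ y + S₂ y * S₂ y
        expand = cong₂ _+_ (cong₂ _+_ (cong₂ _+_ (sq _ (V u₁ (m11 w) U₁)) (sq _ (V u₂ (m12 w) U₂))) (sq u₁ U₁)) (sq u₂ U₂)
        e : ∀ a S₁ S₂ r₁ r₂ ε → (a * S₁ + r₁) * (a * S₁ + r₁) + (a * S₂ + r₂) * (a * S₂ + r₂) + S₁ * S₁ + S₂ * S₂ - + 2 * ε ≡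
          (S₁ * S₁ + S₂ * S₂) * (a * a) + + 2 * (S₁ * r₁ + S₂ * r₂) * a + (r₁ * r₁ + r₂ * r₂ + (S₁ * S₁ + S₂ * S₂) - + 2 * ε)
        e = ℤSolver.solve-∀

      -- With r the first row of w and S · r the inner product, Lagrange's identity (S · r)² =
      -- |S|²|r|² - 1 turns the discriminant into -4(N² - 2εN + 1), a square up to the factor -4
      -- because ε² = 1.
      discriminant : ∀ y → β y * β y - + 4 * N y * γ y ≡ - (+ 4 * ((N y - ε) * (N y - ε)))
      discriminant y = begin
        β y * β y - + 4 * N y * γ y
          ≡⟨ e₁ (+ b y) r₁ r₂ s₁ s₂ ε ⟩
        - (+ 4 * ((N y - ε) * (N y - ε))) + + 4 * (ε * ε - D * D)
          ≡⟨ cong₂ (λ u v → - (+ 4 * ((N y - ε) * (N y - ε))) + + 4 * (u - v * v)) εε det ⟩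
        - (+ 4 * ((N y - ε) * (N y - ε))) + + 4 * (+ 1 - + 1 * + 1)
          ≡⟨ ℤ.+-identityʳ _ ⟩
        - (+ 4 * ((N y - ε) * (N y - ε))) ∎
        where
        open ≡-Reasoning
        D = r₁ * s₂ - r₂ * s₁
        e₁ : ∀ b r₁ r₂ s₁ s₂ ε → let S₁ = b * r₁ + s₁ ; S₂ = b * r₂ + s₂ ; N = S₁ * S₁ + S₂ * S₂ in
          + 2 * (S₁ * r₁ + S₂ * r₂) * (+ 2 * (S₁ * r₁ + S₂ * r₂)) - + 4 * N * (r₁ * r₁ + r₂ * r₂ + N - + 2 * ε) ≡
          - (+ 4 * ((N - ε) * (N - ε))) + + 4 * (ε * ε - (r₁ * s₂ - r₂ * s₁) * (r₁ * s₂ - r₂ * s₁))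
        e₁ = ℤSolver.solve-∀

      a-difference : ∀ x x′ → + a x - + a x′ ≡ + q * (+ x - + x′)
      a-difference x x′ = trans (cong₂ (λ u v → (+ 1 + u) - (+ 1 + v)) (ℤ.pos-* q x) (ℤ.pos-* q x′)) (e (+ q) (+ x) (+ x′))
        where
        e : ∀ q x y → (+ 1 + q * x) - (+ 1 + q * y) ≡ q * (x - y)
        e = ℤSolver.solve-∀

      b-difference : ∀ x x′ → + b x - + b x′ ≡ + q * (+ x - + x′)
      b-difference x x′ = trans (cong₂ _-_ (ℤ.pos-* q x) (ℤ.pos-* q x′)) (e (+ q) (+ x) (+ x′))
        where
        e : ∀ q x y → q * x - q * y ≡ q * (x - y)
        e = ℤSolver.solve-∀

      R? : ∀ y x → Dec (+ n ∣ + normSq (g x y) - + 2 * ε)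
      R? y x = + n ∣? _

      special? : ∀ y → Dec (+ p ∣ N y - ε)
      special? y = + p ∣? _

      -- If p does not divide N - ε, the discriminant is a unit and there are at most two classes
      -- modulo p². For special y there is one class, but only modulo p; the leading coefficient N ≡
      -- ε is then a unit.
      row : ∀ y → ∑[ x ∈ interval 0 A ] 𝟙 (R? y x) ℕ.≤ 2 ℕ.* suc (A ℕ./ n) ℕ.+ 𝟙 (special? y) ℕ.* suc (A ℕ./ p)
      row y with special? y
      ... | no ¬sp = ℕ.≤-trans (count-two-classes (R? y) n 0 A two) (ℕ.m≤m+n _ _)
        where
        two : ∀ x₁ x₂ x₃ → _ → _ → _ → Congruent n x₁ x₂ ⊎ Congruent n x₁ x₃ ⊎ Congruent n x₂ x₃
        two x₁ x₂ x₃ h₁ h₂ h₃ = Sum.map (back x₁ x₂) (Sum.map (back x₁ x₃) (back x₂ x₃))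
          (Roots.two-roots (N y) (β y) (γ y)
            (λ d → p∤* {+ 4} {(N y - ε) * (N y - ε)} p∤4 (p∤* {N y - ε} {N y - ε} ¬sp ¬sp) (∣-≡ (trans (cong -_ (discriminant y)) (ℤ.neg-involutive _)) (∣m⇒∣-m d)))
            (+ a x₁) (+ a x₂) (+ a x₃) (∣-≡ (norm-formula x₁ y) h₁) (∣-≡ (norm-formula x₂ y) h₂) (∣-≡ (norm-formula x₃ y) h₃))
          where
          back : ∀ x x′ → + n ∣ + a x - + a x′ → Congruent n x x′
          back x x′ h = cancel-unit (+ q) (+ x - + x′) p∤q (∣-≡ (a-difference x x′) h)
      ... | yes sp = ℕ.≤-trans (count-class (R? y) p 0 A one)
              (ℕ.≤-trans (ℕ.≤-reflexive (sym (ℕ.+-identityʳ _))) (ℕ.m≤n+m _ (2 ℕ.* suc (A ℕ./ n))))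
        where
        p∤N : ¬ + p ∣ N y
        p∤N h = p∤ε (∣-≡ (e (N y) ε) (∣m∣n⇒∣m-n h sp))
          where
          e : ∀ N ε → N - (N - ε) ≡ ε
          e = ℤSolver.solve-∀
        one : ∀ x₁ x₂ → + n ∣ + normSq (g x₁ y) - + 2 * ε → + n ∣ + normSq (g x₂ y) - + 2 * ε → Congruent p x₁ x₂
        one x₁ x₂ h₁ h₂ = cancel-unit-p (+ q) (+ x₁ - + x₂) p∤q (∣-≡ (a-difference x₁ x₂)
          (Roots.double-root (N y) (β y) (γ y) (∣-≡ (sym (discriminant y)) (∣m⇒∣-m (∣n⇒∣m*n (+ 4) (∣m⇒∣m*n (N y - ε) sp))))
            (p∤* {+ 2} {N y} p∤2 p∤N) (+ a x₁) (+ a x₂) (n⇒p (∣-≡ (norm-formula x₁ y) h₁)) (n⇒p (∣-≡ (norm-formula x₂ y) h₂))))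

      -- N - ε is a quadratic in the second digit. Its coefficients |r|² and 2 r · s cannot both
      -- vanish modulo p, since |r|²|s|² - (r · s)² = 1.
      special-count : ∑[ y ∈ interval 1 A ] 𝟙 (special? y) ℕ.≤ 2 ℕ.* suc (A ℕ./ p)
      special-count = count-two-classes special? p 1 A two
        where
        α β₀ γ₀ : ℤ
        α = r₁ * r₁ + r₂ * r₂
        β₀ = + 2 * (r₁ * s₁ + r₂ * s₂)
        γ₀ = s₁ * s₁ + s₂ * s₂ - ε
        e₁ : ∀ b r₁ r₂ s₁ s₂ ε → (b * r₁ + s₁) * (b * r₁ + s₁) + (b * r₂ + s₂) * (b * r₂ + s₂) - ε ≡
          (r₁ * r₁ + r₂ * r₂) * (b * b) + + 2 * (r₁ * s₁ + r₂ * s₂) * b + (s₁ * s₁ + s₂ * s₂ - ε)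
        e₁ = ℤSolver.solve-∀
        e₂ : ∀ r₁ r₂ s₁ s₂ → (r₁ * r₁ + r₂ * r₂) * (s₁ * s₁ + s₂ * s₂) - (r₁ * s₁ + r₂ * s₂) * (r₁ * s₁ + r₂ * s₂) ≡
          (r₁ * s₂ - r₂ * s₁) * (r₁ * s₂ - r₂ * s₁)
        e₂ = ℤSolver.solve-∀
        nondegenerate : ¬ (+ p ∣ α × + p ∣ β₀)
        nondegenerate (hα , hβ) = p∤1 (∣-≡ (trans (e₂ r₁ r₂ s₁ s₂) (cong₂ _*_ det det))
          (∣m∣n⇒∣m-n (∣m⇒∣m*n (s₁ * s₁ + s₂ * s₂) hα) (∣m⇒∣m*n _ (cancel-unit-p (+ 2) _ p∤2 hβ))))
        back : ∀ y y′ → + p ∣ + b y - + b y′ → Congruent p y y′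
        back y y′ h = cancel-unit-p (+ q) (+ y - + y′) p∤q (∣-≡ (b-difference y y′) h)
        two : ∀ y₁ y₂ y₃ → + p ∣ N y₁ - ε → + p ∣ N y₂ - ε → + p ∣ N y₃ - ε → Congruent p y₁ y₂ ⊎ Congruent p y₁ y₃ ⊎ Congruent p y₂ y₃
        two y₁ y₂ y₃ h₁ h₂ h₃ = Sum.map (back y₁ y₂) (Sum.map (back y₁ y₃) (back y₂ y₃))
          (Roots.two-roots-p α β₀ γ₀ nondegenerate (+ b y₁) (+ b y₂) (+ b y₃)
            (∣-≡ (e₁ (+ b y₁) r₁ r₂ s₁ s₂ ε) h₁) (∣-≡ (e₁ (+ b y₂) r₁ r₂ s₁ s₂ ε) h₂) (∣-≡ (e₁ (+ b y₃) r₁ r₂ s₁ s₂ ε) h₃))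

      -- As p² ≤ A, the counts 1 + A/p² and 1 + A/p are at most doubled main terms. Ordinary rows
      -- give A · 2 · 2A/p², special ones 2 (2A/p)², hence 12 = 4 + 8.
      wild-count : (∑[ y ∈ interval 1 A ] ∑[ x ∈ interval 0 A ] 𝟙 (R? y x)) ℕ.* (p ℕ.* p) ℕ.≤ 12 ℕ.* (A ℕ.* A)
      wild-count = begin
        (∑[ y ∈ interval 1 A ] ∑[ x ∈ interval 0 A ] 𝟙 (R? y x)) ℕ.* n
          ≤⟨ ℕ.*-monoˡ-≤ n (∑-mono (interval 1 A) row) ⟩
        (∑[ y ∈ interval 1 A ] (u ℕ.+ 𝟙 (special? y) ℕ.* v)) ℕ.* n
          ≡⟨ cong (ℕ._* n) (trans (∑-+ (interval 1 A) _ _) (cong₂ ℕ._+_ (trans (∑-const (interval 1 A) u) (cong (ℕ._* u) (length-interval 1 A))) (∑-*ʳ (interval 1 A) v _))) ⟩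
        (A ℕ.* u ℕ.+ ∑ (interval 1 A) (λ y → 𝟙 (special? y)) ℕ.* v) ℕ.* n
          ≤⟨ ℕ.*-monoˡ-≤ n (ℕ.+-monoʳ-≤ (A ℕ.* u) (ℕ.*-monoˡ-≤ v special-count)) ⟩
        (A ℕ.* (2 ℕ.* suc (A ℕ./ n)) ℕ.+ 2 ℕ.* v ℕ.* v) ℕ.* (p ℕ.* p)
          ≡⟨ e₁ A (suc (A ℕ./ n)) v p ⟩
        2 ℕ.* (A ℕ.* (suc (A ℕ./ n) ℕ.* (p ℕ.* p))) ℕ.+ 2 ℕ.* ((v ℕ.* p) ℕ.* (v ℕ.* p))
          ≤⟨ ℕ.+-mono-≤ (ℕ.*-monoʳ-≤ 2 (ℕ.*-monoʳ-≤ A (twice n n≤A))) (ℕ.*-monoʳ-≤ 2 (ℕ.*-mono-≤ (twice p p≤A) (twice p p≤A))) ⟩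
        2 ℕ.* (A ℕ.* (2 ℕ.* A)) ℕ.+ 2 ℕ.* ((2 ℕ.* A) ℕ.* (2 ℕ.* A))
          ≡⟨ e₂ A ⟩
        12 ℕ.* (A ℕ.* A) ∎
        where
        open ℕ.≤-Reasoning
        u = 2 ℕ.* suc (A ℕ./ n)
        v = suc (A ℕ./ p)
        p≤A : p ℕ.≤ A
        p≤A = ℕ.≤-trans (ℕ.m≤m*n p p) n≤A
        twice : ∀ m .{{_ : NonZero m}} → m ℕ.≤ A → suc (A ℕ./ m) ℕ.* m ℕ.≤ 2 ℕ.* A
        twice m l = ℕ.≤-trans (ℕ.+-mono-≤ l (ℕ.m/n*n≤m A m)) (ℕ.≤-reflexive (cong (A ℕ.+_) (sym (ℕ.+-identityʳ A))))
        e₁ : ∀ A u v p → (A ℕ.* (2 ℕ.* u) ℕ.+ 2 ℕ.* v ℕ.* v) ℕ.* (p ℕ.* p) ≡ 2 ℕ.* (A ℕ.* (u ℕ.* (p ℕ.* p))) ℕ.+ 2 ℕ.* ((v ℕ.* p) ℕ.* (v ℕ.* p))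
        e₁ = ℕSolver.solve-∀
        e₂ : ∀ A → 2 ℕ.* (A ℕ.* (2 ℕ.* A)) ℕ.+ 2 ℕ.* ((2 ℕ.* A) ℕ.* (2 ℕ.* A)) ≡ 12 ℕ.* (A ℕ.* A)
        e₂ = ℕSolver.solve-∀

    OnConic : ℤ → ℕ × ℕ → Set
    OnConic c (x , y) = + n ∣ + x * + x + + y * + y - c

    onConic? : ∀ c z → Dec (OnConic c z)
    onConic? c (x , y) = + n ∣? _

    private
      I = interval 0 n

    conic : ℤ → List (ℕ × ℕ)
    conic c = filter (onConic? c) (cartesianProduct I I)

    -- The value c = 0 must be covered, since it occurs for one of the two conics whatever the sign.
    -- The x with p dividing x² - c may have about p partners y each, but there are only about 2p of
    -- them, so they contribute O(p²) as the others do.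
    conic-length : ∀ c → length (conic c) ℕ.≤ 12 ℕ.* n
    conic-length c = begin
      length (conic c)                                       ≡⟨ length-filter (onConic? c) (cartesianProduct I I) ⟩
      ∑[ z ∈ cartesianProduct I I ] 𝟙 (onConic? c z)         ≡⟨ ∑-cartesianProduct I I _ ⟩
      ∑[ x ∈ I ] ∑[ y ∈ I ] 𝟙 (onConic? c (x , y))           ≤⟨ ∑-mono I row ⟩
      ∑[ x ∈ I ] (4 ℕ.+ 𝟙 (special? x) ℕ.* suc p)            ≡⟨ trans (∑-+ I _ _) (cong₂ ℕ._+_ (trans (∑-const I 4) (cong (ℕ._* 4) (length-interval 0 n))) (∑-*ʳ I (suc p) _)) ⟩
      n ℕ.* 4 ℕ.+ ∑ I (λ x → 𝟙 (special? x)) ℕ.* suc p       ≤⟨ ℕ.+-monoʳ-≤ (n ℕ.* 4) (ℕ.*-monoˡ-≤ (suc p) special-count) ⟩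
      n ℕ.* 4 ℕ.+ 2 ℕ.* suc p ℕ.* suc p                      ≤⟨ ℕ.+-monoʳ-≤ (n ℕ.* 4) (ℕ.*-mono-≤ (ℕ.*-monoʳ-≤ 2 sp≤) sp≤) ⟩
      n ℕ.* 4 ℕ.+ 2 ℕ.* (p ℕ.+ p) ℕ.* (p ℕ.+ p)              ≡⟨ e p ⟩
      12 ℕ.* n                                               ∎
      where
      open ℕ.≤-Reasoning
      e : ∀ p → (p ℕ.* p) ℕ.* 4 ℕ.+ 2 ℕ.* (p ℕ.+ p) ℕ.* (p ℕ.+ p) ≡ 12 ℕ.* (p ℕ.* p)
      e = ℕSolver.solve-∀
      sp≤ : suc p ℕ.≤ p ℕ.+ p
      sp≤ = ℕ.+-monoˡ-≤ p (ℕ.>-nonZero⁻¹ p)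
      n/p : n ℕ./ p ≡ p
      n/p = ℕ.m*n/n≡m p p
      special? : ∀ x → Dec (+ p ∣ + x * + x - c)
      special? x = + p ∣? _
      i₁ : ∀ x c → x * x - c ≡ + 1 * (x * x) + + 0 * x + - c
      i₁ = ℤSolver.solve-∀
      i₂ : ∀ x y c → x * x + y * y - c ≡ + 1 * (y * y) + + 0 * y + (x * x - c)
      i₂ = ℤSolver.solve-∀
      i₃ : ∀ d → + 0 * + 0 - + 4 * + 1 * d ≡ - (+ 4 * d)
      i₃ = ℤSolver.solve-∀
      i₄ : ∀ d → - (+ 0 * + 0 - + 4 * + 1 * d) ≡ + 4 * d
      i₄ = ℤSolver.solve-∀
      special-count : ∑ I (λ x → 𝟙 (special? x)) ℕ.≤ 2 ℕ.* suc p
      special-count = ℕ.≤-trans (count-two-classes special? p 0 n λ x y z hx hy hz →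
          Roots.two-roots-p (+ 1) (+ 0) (- c) (λ (h , _) → p∤1 h) (+ x) (+ y) (+ z) (∣-≡ (i₁ (+ x) c) hx) (∣-≡ (i₁ (+ y) c) hy) (∣-≡ (i₁ (+ z) c) hz))
        (ℕ.≤-reflexive (cong (λ z → 2 ℕ.* suc z) n/p))
      row : ∀ x → ∑[ y ∈ I ] 𝟙 (onConic? c (x , y)) ℕ.≤ 4 ℕ.+ 𝟙 (special? x) ℕ.* suc p
      row x with special? x
      ... | no ¬sp = ℕ.≤-trans (count-two-classes (λ y → onConic? c (x , y)) n 0 n λ y₁ y₂ y₃ h₁ h₂ h₃ →
            Roots.two-roots (+ 1) (+ 0) (+ x * + x - c) (λ d → p∤* {+ 4} {+ x * + x - c} p∤4 ¬sp (∣-≡ (i₄ (+ x * + x - c)) (∣m⇒∣-m d))) (+ y₁) (+ y₂) (+ y₃)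
              (∣-≡ (i₂ (+ x) (+ y₁) c) h₁) (∣-≡ (i₂ (+ x) (+ y₂) c) h₂) (∣-≡ (i₂ (+ x) (+ y₃) c) h₃))
          (ℕ.≤-trans (ℕ.≤-reflexive (cong (λ z → 2 ℕ.* suc z) (ℕ.n/n≡1 n))) (ℕ.m≤m+n 4 _))
      ... | yes sp = ℕ.≤-trans (count-class (λ y → onConic? c (x , y)) p 0 n λ y₁ y₂ h₁ h₂ →
            Roots.double-root (+ 1) (+ 0) (+ x * + x - c) (∣-≡ (sym (i₃ (+ x * + x - c))) (∣m⇒∣-m (∣n⇒∣m*n (+ 4) sp))) p∤2 (+ y₁) (+ y₂)
              (n⇒p (∣-≡ (i₂ (+ x) (+ y₁) c) h₁)) (n⇒p (∣-≡ (i₂ (+ x) (+ y₂) c) h₂)))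
          (ℕ.≤-trans (ℕ.≤-reflexive (trans (cong suc n/p) (sym (ℕ.+-identityʳ (suc p))))) (ℕ.m≤n+m _ 4))

    -- Residues of a − d, b + c, a + d, b − c; the factor n ∸ 1 stands for −1.
    coordinates : Mat → (ℕ × ℕ) × (ℕ × ℕ)
    coordinates (mat a b c d) =
      ((a ℕ.+ (n ℕ.∸ 1) ℕ.* d) ℕ.% n , (b ℕ.+ c) ℕ.% n) , ((a ℕ.+ d) ℕ.% n , (b ℕ.+ (n ℕ.∸ 1) ℕ.* c) ℕ.% n)

    private
      %-cong : ∀ x → + n ∣ + (x ℕ.% n) - + x
      %-cong x = %⇒Congruent (x ℕ.% n) x (ℕ.m%n%n≡m%n x n)

      minus : ∀ a d → + n ∣ + ((a ℕ.+ (n ℕ.∸ 1) ℕ.* d) ℕ.% n) - (+ a - + d)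
      minus a d = ∣-≡ (e₀ (+ (v ℕ.% n)) (+ a) (+ d) (+ v)) (∣m∣n⇒∣m+n (%-cong v) (divides (+ d) (begin
          + v - (+ a - + d)                                ≡⟨ cong (λ z → + a + z - (+ a - + d)) (ℤ.pos-* (n ℕ.∸ 1) d) ⟩
          + a + + (n ℕ.∸ 1) * + d - (+ a - + d)            ≡⟨ e₁ (+ a) (+ (n ℕ.∸ 1)) (+ d) ⟩
          + d * (+ 1 + + (n ℕ.∸ 1))                        ≡⟨ cong (λ z → + d * + z) (ℕ.m+[n∸m]≡n {1} {n} (ℕ.>-nonZero⁻¹ n)) ⟩
          + d * + n                                        ∎)))
        where
        open ≡-Reasoning
        v = a ℕ.+ (n ℕ.∸ 1) ℕ.* d
        e₀ : ∀ r a d v → (r - v) + (v - (a - d)) ≡ r - (a - d)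
        e₀ = ℤSolver.solve-∀
        e₁ : ∀ a m d → a + m * d - (a - d) ≡ d * (+ 1 + m)
        e₁ = ℤSolver.solve-∀

      plus : ∀ a d → + n ∣ + ((a ℕ.+ d) ℕ.% n) - (+ a + + d)
      plus a d = %-cong (a ℕ.+ d)

      on : ∀ c x y X Y → + n ∣ + x - X → + n ∣ + y - Y → + n ∣ X * X + Y * Y - c → OnConic c (x , y)
      on c x y X Y hx hy h = ∣-≡ (e (+ x) (+ y) X Y c) (∣m∣n⇒∣m+n h (∣m∣n⇒∣m+n (∣n⇒∣m*n (+ x + X) hx) (∣n⇒∣m*n (+ y + Y) hy)))
        where
        e : ∀ x y X Y c → (X * X + Y * Y - c) + ((x + X) * (x - X) + (y + Y) * (y - Y)) ≡ x * x + y * y - c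
        e = ℤSolver.solve-∀

    -- A bad matrix has both t - 2 and t + 2 fixed modulo p², hence lies on a product of two conics:
    -- O(n²) classes, against about n³ in SL₂(ℤ/n).
    conics : List ((ℕ × ℕ) × (ℕ × ℕ))
    conics = cartesianProduct (conic (+ 2 * ε - + 2)) (conic (+ 2 * ε + + 2))

    coordinates∈ : ∀ g → IsSL g → + n ∣ + normSq g - + 2 * ε → coordinates g ∈ conics
    coordinates∈ (mat a b c d) sl h = ∈-cartesianProduct⁺
      (∈-filter⁺ (onConic? _) (∈-cartesianProduct⁺ (res _) (res _)) (on (+ 2 * ε - + 2) _ ((b ℕ.+ c) ℕ.% n) (+ a - + d) (+ b + + c) (minus a d) (plus b c) (∣-≡ (sym (id₁ (+ a) (+ b) (+ c) (+ d) det)) h′)))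
      (∈-filter⁺ (onConic? _) (∈-cartesianProduct⁺ (res _) (res _)) (on (+ 2 * ε + + 2) ((a ℕ.+ d) ℕ.% n) _ (+ a + + d) (+ b - + c) (plus a d) (minus b c) (∣-≡ (sym (id₂ (+ a) (+ b) (+ c) (+ d) det)) h′)))
      where
      res : ∀ x → x ℕ.% n ∈ I
      res x = ∈-interval⁺ 0 n z≤n (ℕ.m%n<n x n)
      det : + a * + d ≡ + 1 + + b * + c
      det = SLℤ {a} {b} {c} {d} sl
      t : ℤ → ℤ → ℤ → ℤ → ℤ
      t a b c d = a * a + b * b + c * c + d * d
      h′ : + n ∣ t (+ a) (+ b) (+ c) (+ d) - + 2 * ε
      h′ = ∣-≡ (cong (_- + 2 * ε) (cong₂ _+_ (cong₂ _+_ (cong₂ _+_ (pos-sq a) (pos-sq b)) (pos-sq c)) (pos-sq d))) h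
      id₁ : ∀ a b c d → a * d ≡ + 1 + b * c → (a - d) * (a - d) + (b + c) * (b + c) - (+ 2 * ε - + 2) ≡ t a b c d - + 2 * ε
      id₁ a b c d e = trans (i a b c d ε) (trans (cong (λ z → t a b c d - + 2 * ε + + 2 * (+ 1 + b * c - z)) e) (j (t a b c d - + 2 * ε) (b * c)))
        where
        i : ∀ a b c d ε → (a - d) * (a - d) + (b + c) * (b + c) - (+ 2 * ε - + 2) ≡ a * a + b * b + c * c + d * d - + 2 * ε + + 2 * (+ 1 + b * c - a * d)
        i = ℤSolver.solve-∀
        j : ∀ u v → u + + 2 * (+ 1 + v - (+ 1 + v)) ≡ u
        j = ℤSolver.solve-∀
      id₂ : ∀ a b c d → a * d ≡ + 1 + b * c → (a + d) * (a + d) + (b - c) * (b - c) - (+ 2 * ε + + 2) ≡ t a b c d - + 2 * ε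
      id₂ a b c d e = trans (i a b c d ε) (trans (cong (λ z → t a b c d - + 2 * ε + + 2 * (z - (+ 1 + b * c))) e) (j (t a b c d - + 2 * ε) (b * c)))
        where
        i : ∀ a b c d ε → (a + d) * (a + d) + (b - c) * (b - c) - (+ 2 * ε + + 2) ≡ a * a + b * b + c * c + d * d - + 2 * ε + + 2 * (a * d - (+ 1 + b * c))
        i = ℤSolver.solve-∀
        j : ∀ u v → u + + 2 * ((+ 1 + v) - (+ 1 + v)) ≡ u
        j = ℤSolver.solve-∀

    coordinates-≈ : ∀ g h → coordinates g ≡ coordinates h → g ≈ h [mod n ]
    coordinates-≈ (mat a b c d) (mat a′ b′ c′ d′) e = congruent
        (half (+ a - + a′) (sumd a d a′ d′ dm dp)) (half (+ b - + b′) (sumd b c b′ c′ cm cp))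
        (half (+ c - + c′) (difd b c b′ c′ cm cp)) (half (+ d - + d′) (difd a d a′ d′ dm dp))
      where
      half : ∀ x → + n ∣ + 2 * x → + n ∣ x
      half x = cancel-unit (+ 2) x p∤2
      same : ∀ {r r′ : ℕ} X Y → r ≡ r′ → + n ∣ + r - X → + n ∣ + r′ - Y → + n ∣ X - Y
      same {r} {_} X Y refl hx hy = ∣-≡ (i (+ r) X Y) (∣m∣n⇒∣m-n hy hx)
        where
        i : ∀ r X Y → (r - Y) - (r - X) ≡ X - Y
        i = ℤSolver.solve-∀
      dm = same (+ a - + d) (+ a′ - + d′) (,-injectiveˡ (,-injectiveˡ e)) (minus a d) (minus a′ d′)
      cp = same (+ b + + c) (+ b′ + + c′) (,-injectiveʳ (,-injectiveˡ e)) (plus b c) (plus b′ c′)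
      dp = same (+ a + + d) (+ a′ + + d′) (,-injectiveˡ (,-injectiveʳ e)) (plus a d) (plus a′ d′)
      cm = same (+ b - + c) (+ b′ - + c′) (,-injectiveʳ (,-injectiveʳ e)) (minus b c) (minus b′ c′)
      sumd : ∀ a d a′ d′ → + n ∣ (+ a - + d) - (+ a′ - + d′) → + n ∣ (+ a + + d) - (+ a′ + + d′) → + n ∣ + 2 * (+ a - + a′)
      sumd a d a′ d′ hm hp = ∣-≡ (i (+ a) (+ d) (+ a′) (+ d′)) (∣m∣n⇒∣m+n hm hp)
        where
        i : ∀ a d a′ d′ → ((a - d) - (a′ - d′)) + ((a + d) - (a′ + d′)) ≡ + 2 * (a - a′)
        i = ℤSolver.solve-∀
      difd : ∀ a d a′ d′ → + n ∣ (+ a - + d) - (+ a′ - + d′) → + n ∣ (+ a + + d) - (+ a′ + + d′) → + n ∣ + 2 * (+ d - + d′)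
      difd a d a′ d′ hm hp = ∣-≡ (i (+ a) (+ d) (+ a′) (+ d′)) (∣m∣n⇒∣m-n hp hm)
        where
        i : ∀ a d a′ d′ → ((a + d) - (a′ + d′)) - ((a - d) - (a′ - d′)) ≡ + 2 * (d - d′)
        i = ℤSolver.solve-∀

    module Middle {A : Set} (L : List A) (P : A → Mat) (slP : ∀ x → x ∈ L → IsSL (P x)) (u v : Mat) (su : IsSL u) (sv : IsSL v) where

      g : A → A → Mat
      g x y = (u · P x) · (P y · v)

      -- For a fixed residue of the product, either middle factor determines the other modulo n by
      -- cancellation. This is a partial matching of classes, so each of the at most 144 n² residues
      -- accounts for at most twice the number of collisions.
      middle-count : ∑[ x ∈ L ] ∑[ y ∈ L ] 𝟙 (+ n ∣? (+ normSq (g x y) - + 2 * ε)) ℕ.≤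
        288 ℕ.* (n ℕ.* n) ℕ.* ∑[ x ∈ L ] ∑[ y ∈ L ] 𝟙 (≈? n (P x) (P y))
      middle-count = begin
        ∑[ x ∈ L ] ∑[ y ∈ L ] 𝟙 (bad? x y)
          ≤⟨ ∑-mono-∈ L (λ x x∈ → ∑-mono-∈ L λ y y∈ → cover x y x∈ y∈) ⟩
        ∑[ x ∈ L ] ∑[ y ∈ L ] ∑[ σ ∈ conics ] 𝟙 (R? σ x y)
          ≡⟨ ∑-cong L (λ x → ∑-swap L conics _) ⟩
        ∑[ x ∈ L ] ∑[ σ ∈ conics ] ∑[ y ∈ L ] 𝟙 (R? σ x y)
          ≡⟨ ∑-swap L conics _ ⟩
        ∑[ σ ∈ conics ] ∑[ x ∈ L ] ∑[ y ∈ L ] 𝟙 (R? σ x y)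
          ≤⟨ ∑-bound conics (2 ℕ.* coll) (λ σ _ → count-partial-matching {_~_ = λ x y → P x ≈ P y [mod n ]} (λ x y → ≈? n (P x) (P y)) (R? σ) L right left) ⟩
        length conics ℕ.* (2 ℕ.* coll)
          ≤⟨ ℕ.*-monoˡ-≤ (2 ℕ.* coll) (ℕ.≤-trans (ℕ.≤-reflexive (length-cartesianProduct (conic (+ 2 * ε - + 2)) (conic (+ 2 * ε + + 2)))) (ℕ.*-mono-≤ (conic-length _) (conic-length _))) ⟩
        12 ℕ.* n ℕ.* (12 ℕ.* n) ℕ.* (2 ℕ.* coll)
          ≡⟨ e n coll ⟩
        288 ℕ.* (n ℕ.* n) ℕ.* coll ∎
        where
        open ℕ.≤-Reasoning
        coll = ∑[ x ∈ L ] ∑[ y ∈ L ] 𝟙 (≈? n (P x) (P y))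
        e : ∀ n c → 12 ℕ.* n ℕ.* (12 ℕ.* n) ℕ.* (2 ℕ.* c) ≡ 288 ℕ.* (n ℕ.* n) ℕ.* c
        e = ℕSolver.solve-∀
        bad? : ∀ x y → Dec (+ n ∣ + normSq (g x y) - + 2 * ε)
        bad? x y = + n ∣? _
        R? : ∀ σ x y → Dec (coordinates (g x y) ≡ σ)
        R? σ x y = ≡-dec (≡-dec ℕ._≟_ ℕ._≟_) (≡-dec ℕ._≟_ ℕ._≟_) (coordinates (g x y)) σ
        slg : ∀ x y → x ∈ L → y ∈ L → IsSL (g x y)
        slg x y x∈ y∈ = SL-· (u · P x) (P y · v) (SL-· u (P x) su (slP x x∈)) (SL-· (P y) v (slP y y∈) sv)
        cover : ∀ x y → x ∈ L → y ∈ L → 𝟙 (bad? x y) ℕ.≤ ∑[ σ ∈ conics ] 𝟙 (R? σ x y)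
        cover x y x∈ y∈ = 𝟙≤ (bad? x y) λ h → ℕ.≤-trans (ℕ.≤-reflexive (sym (𝟙-yes (R? (coordinates (g x y)) x y) refl)))
          (∑-term conics (λ σ → 𝟙 (R? σ x y)) (coordinates∈ (g x y) (slg x y x∈ y∈) h))
        right : ∀ {σ} x y z → x ∈ L → y ∈ L → z ∈ L → coordinates (g x y) ≡ σ → coordinates (g x z) ≡ σ → P y ≈ P z [mod n ]
        right x y z x∈ y∈ z∈ h₁ h₂ = ≈-cancelʳ v sv (≈-cancelˡ (u · P x) (SL-· u (P x) su (slP x x∈)) (coordinates-≈ (g x y) (g x z) (trans h₁ (sym h₂))))
        left : ∀ {σ} x y z → x ∈ L → y ∈ L → z ∈ L → coordinates (g x z) ≡ σ → coordinates (g y z) ≡ σ → P x ≈ P y [mod n ]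
        left x y z x∈ y∈ z∈ h₁ h₂ = ≈-cancelˡ u su (≈-cancelʳ (P z · v) (SL-· (P z) v (slP z z∈) sv) (coordinates-≈ (g x z) (g y z) (trans h₁ (sym h₂))))

-- Large primes: matrices of given norm

module LargePrimes where

  open Counting
  open Congruences
  open Divisors
  open TwoSquares
  open Words
  open Quadratics using (Bad; ∣-≡)
  open import Data.Nat
  open import Data.Nat.Properties
  open import Data.Nat.DivMod using (_/_; m/n*n≤m; /-monoˡ-≤)
  open import Data.Nat.Primality using (Prime; prime?; prime⇒nonZero)
  open import Data.Integer using (ℤ; +_)
  open import Data.Integer.Divisibility.Signed using (_∣_; _∣?_; ∣m∣n⇒∣m-n)

  isRep? : ∀ m z → Dec (IsRep m z)
  isRep? m (x , y) = x * x + y * y ≟ m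

  reps : ℕ → List (ℕ × ℕ)
  reps m = filter (isRep? m) (cartesianProduct (interval 0 (suc m)) (interval 0 (suc m)))

  ∈-reps⁺ : ∀ {m z} → IsRep m z → z ∈ reps m
  ∈-reps⁺ {m} {x , y} r = ∈-filter⁺ (isRep? m)
    (∈-cartesianProduct⁺ (∈-interval⁺ 0 (suc m) z≤n (s≤s (small x (≤-trans (m≤m+n _ _) (≤-reflexive r)))))
                         (∈-interval⁺ 0 (suc m) z≤n (s≤s (small y (≤-trans (m≤n+m _ _) (≤-reflexive r)))))) r
    where
    small : ∀ x → x * x ≤ m → x ≤ m
    small zero _ = z≤n
    small (suc x) h = ≤-trans (m≤m*n (suc x) (suc x)) h

  reps-length : ∀ m → 1 ≤ m → ¬ 2 ℕᵈ.∣ m → length (reps m) ≤ #divisors m * (#divisors m * 2)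
  reps-length m 1≤m odd = two-squares-bound m 1≤m odd (reps m)
    (Unique.filter⁺ (isRep? m) (Unique.cartesianProduct⁺ (Unique-interval 0 (suc m)) (Unique-interval 0 (suc m))))
    λ z z∈ → proj₂ (∈-filter⁻ (isRep? m) {xs = cartesianProduct (interval 0 (suc m)) (interval 0 (suc m))} z∈)

  ∣-∣-square : ∀ a d → ∣ a - d ∣ * ∣ a - d ∣ + 2 * (a * d) ≡ a * a + d * d
  ∣-∣-square a d with ≤-total a d
  ... | inj₁ l rewrite m≤n⇒∣m-n∣≡n∸m l = subst (λ z → (d ∸ a) * (d ∸ a) + 2 * (a * z) ≡ a * a + z * z) (m+[n∸m]≡n l) (e a (d ∸ a))
    where
    e : ∀ a k → k * k + 2 * (a * (a + k)) ≡ a * a + (a + k) * (a + k)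
    e = ℕSolver.solve-∀
  ... | inj₂ l rewrite m≤n⇒∣n-m∣≡n∸m l = subst (λ z → (a ∸ d) * (a ∸ d) + 2 * (z * d) ≡ z * z + d * d) (m+[n∸m]≡n l) (e d (a ∸ d))
    where
    e : ∀ d k → k * k + 2 * ((d + k) * d) ≡ (d + k) * (d + k) + d * d
    e = ℕSolver.solve-∀

  private
    flag : ℕ → ℕ → ℕ
    flag a d = 𝟙 (a ≤? d)

    recover-≤ : ∀ a d a′ d′ → a ≤ d → a′ ≤ d′ → a + d ≡ a′ + d′ → ∣ a - d ∣ ≡ ∣ a′ - d′ ∣ → a ≡ a′ × d ≡ d′
    recover-≤ a d a′ d′ l l′ s m = a≡a′ , +-cancelˡ-≡ a d d′ (trans s (cong (_+ d′) (sym a≡a′)))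
      where
      k≡k′ : d ∸ a ≡ d′ ∸ a′
      k≡k′ = trans (sym (m≤n⇒∣m-n∣≡n∸m l)) (trans m (m≤n⇒∣m-n∣≡n∸m l′))
      double : ∀ a d → a ≤ d → 2 * a + (d ∸ a) ≡ a + d
      double a d l = trans (cong (λ z → a + z + (d ∸ a)) (+-identityʳ a)) (trans (+-assoc a a _) (cong (λ z → a + z) (m+[n∸m]≡n l)))
      a≡a′ : a ≡ a′
      a≡a′ = *-cancelˡ-≡ a a′ 2 (+-cancelʳ-≡ (d ∸ a) _ _
        (trans (double a d l) (trans s (trans (sym (double a′ d′ l′)) (cong (λ z → 2 * a′ + z) (sym k≡k′))))))

    recover : ∀ a d a′ d′ → flag a d ≡ flag a′ d′ → a + d ≡ a′ + d′ → ∣ a - d ∣ ≡ ∣ a′ - d′ ∣ → a ≡ a′ × d ≡ d′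
    recover a d a′ d′ f s m with a ≤? d | a′ ≤? d′
    ... | yes l | yes l′ = recover-≤ a d a′ d′ l l′ s m
    ... | no g | no g′ = let (x , y) = recover-≤ d a d′ a′ (<⇒≤ (≰⇒> g)) (<⇒≤ (≰⇒> g′)) (trans (+-comm d a) (trans s (+-comm a′ d′)))
                               (trans (∣-∣-comm d a) (trans m (∣-∣-comm a′ d′))) in y , x
    ... | yes _ | no _ = ⊥-elim (1+n≢0 f)
    ... | no _ | yes _ = ⊥-elim (1+n≢0 (sym f))

    Key : Set
    Key = ((ℕ × ℕ) × (ℕ × ℕ)) × (ℕ × ℕ)

    -- The squares see only |a - d| and |b - c|; the two flags restore the lost signs.
    key : Mat → Key
    key (mat a b c d) = ((∣ a - d ∣ , b + c) , (a + d , ∣ b - c ∣)) , (flag a d , flag b c)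

    key-injective : ∀ g h → key g ≡ key h → g ≡ h
    key-injective (mat a b c d) (mat a′ b′ c′ d′) e =
      let (e₁ , e₂) = ,-injectiveˡ (,-injectiveˡ e) , ,-injectiveʳ (,-injectiveˡ e)
          (a≡ , d≡) = recover a d a′ d′ (,-injectiveˡ (,-injectiveʳ e)) (,-injectiveˡ e₂) (,-injectiveˡ e₁)
          (b≡ , c≡) = recover b c b′ c′ (,-injectiveʳ (,-injectiveʳ e)) (,-injectiveʳ e₁) (,-injectiveʳ e₂)
      in mat-≡ a≡ b≡ c≡ d≡

  -- The norm 2 + m gives representations of m = t - 2 and of 4 + m = t + 2, both odd; each number
  -- has at most 2Δ² of them, and there are four choices of flags.
  fixed-norm-count : ∀ m Δ → 1 ≤ m → ¬ 2 ℕᵈ.∣ m → #divisors m ≤ Δ → #divisors (4 + m) ≤ Δ →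
    (L : List Mat) → Unique L → (∀ g → g ∈ L → IsSL g × normSq g ≡ 2 + m) → length L ≤ 16 * (Δ * Δ * (Δ * Δ))
  fixed-norm-count m Δ 1≤m odd h₁ h₂ L u h = begin
    length L                                             ≤⟨ length-injection L K key u into (λ x y _ _ e → key-injective x y e) ⟩
    length K                                             ≡⟨ trans (length-cartesianProduct (cartesianProduct (reps m) (reps (4 + m))) (cartesianProduct range range))
                                                              (cong₂ _*_ (length-cartesianProduct (reps m) (reps (4 + m))) (length-cartesianProduct range range)) ⟩
    length (reps m) * length (reps (4 + m)) * 4          ≤⟨ *-monoˡ-≤ 4 (*-mono-≤ (≤-trans (reps-length m 1≤m odd) (*-mono-≤ h₁ (*-monoˡ-≤ 2 h₁)))
                                                              (≤-trans (reps-length (4 + m) (s≤s z≤n) odd₄) (*-mono-≤ h₂ (*-monoˡ-≤ 2 h₂)))) ⟩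
    Δ * (Δ * 2) * (Δ * (Δ * 2)) * 4                      ≡⟨ e Δ ⟩
    16 * (Δ * Δ * (Δ * Δ))                               ∎
    where
    open ≤-Reasoning
    e : ∀ x → x * (x * 2) * (x * (x * 2)) * 4 ≡ 16 * (x * x * (x * x))
    e = ℕSolver.solve-∀
    range = interval 0 2
    K : List Key
    K = cartesianProduct (cartesianProduct (reps m) (reps (4 + m))) (cartesianProduct range range)
    odd₄ : ¬ 2 ℕᵈ.∣ 4 + m
    odd₄ d = odd (ℕᵈ.∣m+n∣m⇒∣n d (ℕᵈ.divides 2 refl))
    flag∈ : ∀ a d → flag a d ∈ range
    flag∈ a d = ∈-interval⁺ 0 2 z≤n (s≤s (𝟙≤1 (a ≤? d)))
    into : ∀ g → g ∈ L → key g ∈ K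
    into g@(mat a b c d) g∈ = ∈-cartesianProduct⁺ (∈-cartesianProduct⁺ (∈-reps⁺ r₁) (∈-reps⁺ r₂)) (∈-cartesianProduct⁺ (flag∈ a d) (flag∈ b c))
      where
      sl = proj₁ (h g g∈)
      nm = proj₂ (h g g∈)
      i₁ : ∀ x b c → 2 + (x + (b + c) * (b + c)) ≡ x + 2 * (1 + b * c) + (b * b + c * c)
      i₁ = ℕSolver.solve-∀
      i₂ : ∀ a b c d → a * a + d * d + (b * b + c * c) ≡ a * a + b * b + c * c + d * d
      i₂ = ℕSolver.solve-∀
      i₃ : ∀ a d x → (a + d) * (a + d) + x ≡ a * a + d * d + 2 * (a * d) + x
      i₃ = ℕSolver.solve-∀
      i₄ : ∀ s x y → s + 2 * (1 + y) + x ≡ 2 + (s + (x + 2 * y))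
      i₄ = ℕSolver.solve-∀
      r₁ : IsRep m (∣ a - d ∣ , b + c)
      r₁ = +-cancelˡ-≡ 2 _ _ (trans (i₁ (∣ a - d ∣ * ∣ a - d ∣) b c) (trans (cong (λ z → ∣ a - d ∣ * ∣ a - d ∣ + 2 * z + (b * b + c * c)) (sym sl))
        (trans (cong (_+ (b * b + c * c)) (∣-∣-square a d)) (trans (i₂ a b c d) nm))))
      r₂ : IsRep (4 + m) (a + d , ∣ b - c ∣)
      r₂ = trans (i₃ a d (∣ b - c ∣ * ∣ b - c ∣)) (trans (cong (λ z → a * a + d * d + 2 * z + ∣ b - c ∣ * ∣ b - c ∣) sl)
        (trans (i₄ (a * a + d * d) (∣ b - c ∣ * ∣ b - c ∣) (b * c)) (cong (λ z → 2 + z) (trans (cong (λ z → a * a + d * d + z) (∣-∣-square b c)) (trans (i₂ a b c d) nm)))))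

  opaque
    bad? : ∀ ε p g → Dec (Bad ε p g)
    bad? ε p g = prime? p ×-dec (+ (p * p) ∣? _)

  large-count : ∀ ε p V Δ → Prime p → (∀ m → 1 ≤ m → m ≤ 2 + V → #divisors m ≤ Δ) →
    (L : List Mat) → Unique L → (∀ g → g ∈ L → IsSL g × normSq g ≤ V × ∃ λ m → normSq g ≡ 2 + m × 1 ≤ m × ¬ 2 ℕᵈ.∣ m) →
    (∑[ g ∈ L ] 𝟙 (bad? ε p g)) * (p * p) ≤ (V + p * p) * (16 * (Δ * Δ * (Δ * Δ)))
  large-count ε p V Δ pp hΔ L u h = begin
    (∑[ g ∈ L ] 𝟙 (bad? ε p g)) * (p * p)
      ≤⟨ *-monoˡ-≤ (p * p) (count-fibres (bad? ε p) _≟_ L range (λ g → normSq g / (p * p)) B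
           (λ g g∈ _ → ∈-interval⁺ 0 _ z≤n (s≤s (/-monoˡ-≤ (p * p) (proj₁ (proj₂ (h g g∈)))))) (λ k _ → fibre k)) ⟩
    length range * B * (p * p)
      ≡⟨ cong (λ z → z * B * (p * p)) (length-interval 0 (suc (V / (p * p)))) ⟩
    suc (V / (p * p)) * B * (p * p)
      ≡⟨ e (suc (V / (p * p))) B (p * p) ⟩
    suc (V / (p * p)) * (p * p) * B
      ≤⟨ *-monoˡ-≤ B (≤-trans (+-monoʳ-≤ (p * p) (m/n*n≤m V (p * p))) (≤-reflexive (+-comm (p * p) V))) ⟩
    (V + p * p) * B ∎
    where
    open ≤-Reasoning
    instance
      p≢0 : NonZero p
      p≢0 = prime⇒nonZero pp
      pp≢0 : NonZero (p * p)
      pp≢0 = m*n≢0 p p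
    B = 16 * (Δ * Δ * (Δ * Δ))
    range = interval 0 (suc (V / (p * p)))
    e : ∀ a b c → a * b * c ≡ a * c * b
    e = ℕSolver.solve-∀
    fibre : ∀ k → ∑[ g ∈ L ] 𝟙 (bad? ε p g ×-dec (normSq g / (p * p) ≟ k)) ≤ B
    fibre k with search (λ g → bad? ε p g ×-dec (normSq g / (p * p) ≟ k)) L
    ... | inj₂ none = ≤-trans (≤-reflexive (count-none (λ g → bad? ε p g ×-dec (normSq g / (p * p) ≟ k)) L none)) z≤n
    -- One member g₀ fixes the norm on the whole fibre: the residue modulo p² is that of 2ε, the
    -- quotient is k.
    ... | inj₁ (g₀ , g₀∈ , (_ , b₀) , k₀) with h g₀ g₀∈
    ... | _ , g₀≤ , m , e₀ , 1≤m , odd = ≤-trans (≤-reflexive (sym (length-filter R? L)))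
        (fixed-norm-count m Δ 1≤m odd (hΔ m 1≤m (≤-trans (m≤n+m m 4) 4+m≤)) (hΔ (4 + m) (s≤s z≤n) 4+m≤) (filter R? L) (Unique.filter⁺ R? u) same)
      where
      R? = λ g → bad? ε p g ×-dec (normSq g / (p * p) ≟ k)
      4+m≤ : 4 + m ≤ 2 + V
      4+m≤ = +-monoʳ-≤ 2 (subst (_≤ V) e₀ g₀≤)
      i : ∀ x y z → (x ℤ.- z) ℤ.- (y ℤ.- z) ≡ x ℤ.- y
      i = ℤSolver.solve-∀
      same : ∀ g → g ∈ filter R? L → IsSL g × normSq g ≡ 2 + m
      same g g∈ with ∈-filter⁻ R? {xs = L} g∈
      ... | g∈L , (_ , b) , k₁ = proj₁ (h g g∈L) ,
        trans (Congruent-/⇒≡ (normSq g) (normSq g₀) (∣-≡ (i (+ normSq g) (+ normSq g₀) (+ 2 ℤ.* ε)) (∣m∣n⇒∣m-n b b₀)) (trans k₁ (sym k₀))) e₀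

-- Construction of block sets from continued fractions

module Construction where

  open Counting
  open Congruences
  open Divisors using (n<2^n; ^-distribʳ-*)
  open Words
  open Blocks
  open import Data.Nat
  open import Data.Nat.Properties
  open import Data.Nat.DivMod using (_/_; _%_; m/n*n≤m; m/n*n≡m; m%n<n; m≡m%n+[m/n]*n; /-monoˡ-≤; m≥n⇒m/n>0)
  open import Data.Nat.Divisibility
  open import Data.Nat.GCD using (gcd; gcd[m,n]∣m; gcd[m,n]∣n)
  open import Data.Nat.Coprimality using (Coprime; coprime?; gcd≡1⇒coprime)
  open import Data.Nat.Induction using (<-wellFounded)
  open import Induction.WellFounded using (Acc; acc)

  private
    coprimePair? : (z : ℕ × ℕ) → Dec (Coprime (proj₁ z) (proj₂ z))
    coprimePair? (x , y) = coprime? x y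

  coprimePairs : ℕ → List (ℕ × ℕ)
  coprimePairs H = filter coprimePair? (cartesianProduct (interval 1 H) (interval 1 H))

  -- Pairs with a common divisor d have density at most 1/d². This is 1/4 for d = 2 and at most 1/2
  -- summed over d ≥ 3, so a quarter of all pairs is left.
  coprime-count : ∀ H → H * H ≤ 4 * length (coprimePairs H)
  coprime-count H = +-cancelʳ-≤ (3 * (H * H)) _ _ (begin
    H * H + 3 * (H * H)                       ≡⟨ e₁ (H * H) ⟩
    4 * (H * H)                               ≤⟨ *-monoʳ-≤ 4 total ⟩
    4 * (c + (c₂ + S))                        ≡⟨ e₂ c c₂ S ⟩
    4 * c + (c₂ * (2 * 2) + 2 * (2 * S))      ≤⟨ +-monoʳ-≤ (4 * c) (+-mono-≤ (multiples-square 2) (*-monoʳ-≤ 2 (∑-inverse-squares 2 H common (H * H) λ d l _ → multiples-square′ d (≤-trans (n≤1+n 2) l)))) ⟩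
    4 * c + (H * H + 2 * (H * H))             ≡⟨ cong (4 * c +_) (e₃ (H * H)) ⟩
    4 * c + 3 * (H * H)                       ∎)
    where
    open ≤-Reasoning
    I = interval 1 H
    c = length (coprimePairs H)
    e₁ : ∀ x → x + 3 * x ≡ 4 * x
    e₁ = ℕSolver.solve-∀
    e₂ : ∀ c a s → 4 * (c + (a + s)) ≡ 4 * c + (a * (2 * 2) + 2 * (2 * s))
    e₂ = ℕSolver.solve-∀
    e₃ : ∀ x → x + 2 * x ≡ 3 * x
    e₃ = ℕSolver.solve-∀
    both? : ∀ d (z : ℕ × ℕ) → Dec (d ∣ proj₁ z × d ∣ proj₂ z)
    both? d (x , y) = (d ∣? x) ×-dec (d ∣? y)
    common : ℕ → ℕ
    common d = ∑[ z ∈ cartesianProduct I I ] 𝟙 (both? d z)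
    c₂ = common 2
    S = ∑ (interval 3 H) common
    multiples : ∀ d .{{_ : NonZero d}} → ∑[ x ∈ I ] 𝟙 (d ∣? x) ≤ H / d
    multiples d = ≤-trans (count-injection (d ∣?_) I (interval 1 (H / d)) (_/ d) (Unique-interval 1 H)
        (λ x x∈ d∣x → let (1≤x , x<) = ∈-interval⁻ 1 H x∈ in
          ∈-interval⁺ 1 (H / d) (m≥n⇒m/n>0 (∣⇒≤ {{>-nonZero 1≤x}} d∣x)) (s≤s (/-monoˡ-≤ d (s≤s⁻¹ x<))))
        (λ x y _ _ d∣x d∣y e → trans (sym (m/n*n≡m d∣x)) (trans (cong (_* d) e) (m/n*n≡m d∣y))))
      (≤-reflexive (length-interval 1 (H / d)))
    multiples-square : ∀ d .{{_ : NonZero d}} → common d * (d * d) ≤ H * H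
    multiples-square d = begin
      common d * (d * d)
        ≡⟨ cong (_* (d * d)) (∑-cartesianProduct I I _) ⟩
      (∑[ x ∈ I ] ∑[ y ∈ I ] 𝟙 (both? d (x , y))) * (d * d)
        ≤⟨ *-monoˡ-≤ (d * d) (∑-mono I λ x → ∑-mono I λ y → 𝟙-× (d ∣? x) (d ∣? y)) ⟩
      (∑[ x ∈ I ] ∑[ y ∈ I ] (𝟙 (d ∣? x) * 𝟙 (d ∣? y))) * (d * d)
        ≡⟨ cong (_* (d * d)) (trans (∑-cong I λ x → ∑-*ˡ I (𝟙 (d ∣? x)) _) (∑-*ʳ I (∑[ y ∈ I ] 𝟙 (d ∣? y)) _)) ⟩
      (∑[ x ∈ I ] 𝟙 (d ∣? x)) * (∑[ y ∈ I ] 𝟙 (d ∣? y)) * (d * d)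
        ≤⟨ *-monoˡ-≤ (d * d) (*-mono-≤ (multiples d) (multiples d)) ⟩
      (H / d) * (H / d) * (d * d)
        ≡⟨ [m*n]*[o*p]≡[m*o]*[n*p] (H / d) (H / d) d d ⟩
      (H / d * d) * (H / d * d)
        ≤⟨ *-mono-≤ (m/n*n≤m H d) (m/n*n≤m H d) ⟩
      H * H ∎
      where
      𝟙-× : ∀ {P Q : Set} (P? : Dec P) (Q? : Dec Q) → 𝟙 (P? ×-dec Q?) ≤ 𝟙 P? * 𝟙 Q?
      𝟙-× (yes _) (yes _) = ≤-refl
      𝟙-× (yes _) (no _) = z≤n
      𝟙-× (no _) _ = z≤n
    multiples-square′ : ∀ d → 2 ≤ d → common d * (d * d) ≤ H * H
    multiples-square′ d 2≤d = multiples-square d {{>-nonZero (≤-trans (n≤1+n 1) 2≤d)}}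
    covered : ∀ z → z ∈ cartesianProduct I I → 1 ≤ 𝟙 (coprimePair? z) + (𝟙 (both? 2 z) + ∑[ d ∈ interval 3 H ] 𝟙 (both? d z))
    covered z@(x , y) z∈ with coprime? x y
    ... | yes _ = s≤s z≤n
    ... | no ¬cop with gcd x y in eq | gcd[m,n]∣m x y | gcd[m,n]∣n x y
    ... | 0 | g∣x | _ = ⊥-elim (<-irrefl (sym (0∣⇒≡0 g∣x)) (proj₁ (∈-interval⁻ 1 H (proj₁ (∈-cartesianProduct⁻ I I z∈)))))
    ... | 1 | _ | _ = ⊥-elim (¬cop (gcd≡1⇒coprime eq))
    ... | 2 | g∣x | g∣y = ≤-trans (≤-reflexive (sym (𝟙-yes (both? 2 z) (g∣x , g∣y)))) (m≤m+n _ _)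
    ... | g@(suc (suc (suc _))) | g∣x | g∣y = ≤-trans (≤-trans (≤-reflexive (sym (𝟙-yes (both? g z) (g∣x , g∣y))))
            (∑-term (interval 3 H) (λ d → 𝟙 (both? d z)) (∈-interval⁺ 3 H (s≤s (s≤s (s≤s z≤n)))
              (≤-trans (s≤s (∣⇒≤ {{>-nonZero (proj₁ x-range)}} g∣x)) (≤-trans (proj₂ x-range) (m≤n+m (suc H) 2)))))) (m≤n+m _ _)
      where
      x-range = ∈-interval⁻ 1 H (proj₁ (∈-cartesianProduct⁻ I I z∈))
    total : H * H ≤ c + (c₂ + S)
    total = begin
      H * H
        ≡⟨ sym (trans (length-cartesianProduct I I) (cong₂ _*_ (length-interval 1 H) (length-interval 1 H))) ⟩
      length (cartesianProduct I I)
        ≡⟨ trans (sym (*-identityʳ _)) (sym (∑-const (cartesianProduct I I) 1)) ⟩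
      ∑[ z ∈ cartesianProduct I I ] 1
        ≤⟨ ∑-mono-∈ (cartesianProduct I I) covered ⟩
      ∑[ z ∈ cartesianProduct I I ] (𝟙 (coprimePair? z) + (𝟙 (both? 2 z) + ∑[ d ∈ interval 3 H ] 𝟙 (both? d z)))
        ≡⟨ trans (∑-+ (cartesianProduct I I) _ _) (cong₂ _+_ (sym (length-filter coprimePair? (cartesianProduct I I)))
             (trans (∑-+ (cartesianProduct I I) _ _) (cong (c₂ +_) (∑-swap (cartesianProduct I I) (interval 3 H) _)))) ⟩
      c + (c₂ + S) ∎

  record ColumnWord (x y : ℕ) (w : Word) : Set where
    field
      digits : All (λ a → 1 ≤ a × a ≤ x) w
      top : m11 (prodWord w) ≡ x
      bottom : m21 (prodWord w) ≡ y

  EvenWord OddWord : ℕ → ℕ → Set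
  EvenWord x y = ∃ λ w → ColumnWord x y w × ∃ λ k → length w ≡ 2 * k
  OddWord x y = ∃ λ w → ColumnWord x y w × ∃ λ k → length w ≡ 1 + 2 * k

  -- Euclid's algorithm, with both parities carried along: the final digit x may also be written as
  -- x - 1 followed by 1. Words of even length are wanted, and each division step exchanges the
  -- parities.
  continued-fraction : ∀ x y → 1 ≤ y → y < x → Coprime x y → EvenWord x y × OddWord x y
  continued-fraction x y 1≤y y<x cop = go x y 1≤y y<x cop (<-wellFounded y)
    where
    extend : ∀ {y r w} q → 1 ≤ q → 1 ≤ y → ColumnWord y r w → ColumnWord (q * y + r) y (q ∷ w)
    extend {y} {r} {w} q 1≤q 1≤y cw = record
      { digits = (1≤q , ≤-trans (m≤m*n q y {{>-nonZero 1≤y}}) (m≤m+n _ r)) ∷ All.map (λ (l , u) → l , ≤-trans u (≤-trans (m≤n*m y q {{>-nonZero 1≤q}}) (m≤m+n _ r))) digits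
      ; top = trans (M11 {q} (prodWord w)) (cong₂ (λ u v → q * u + v) top bottom)
      ; bottom = trans (M21 {q} (prodWord w)) top }
      where open ColumnWord cw
    go : ∀ x y → 1 ≤ y → y < x → Coprime x y → Acc _<_ y → EvenWord x y × OddWord x y
    go (suc x) 1 _ y<x _ _ =
      (x ∷ 1 ∷ [] , subst (λ z → ColumnWord z 1 (x ∷ 1 ∷ [])) (trans (cong (_+ 1) (*-identityʳ x)) (+-comm x 1)) (extend x (s≤s⁻¹ y<x) ≤-refl one) , 1 , refl) ,
      (suc x ∷ [] , record { digits = (s≤s z≤n , ≤-refl) ∷ [] ; top = trans (M11 {suc x} I₂) (trans (+-identityʳ _) (*-identityʳ _)) ; bottom = refl } , 0 , refl)
      where
      one : ColumnWord 1 1 (1 ∷ [])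
      one = record { digits = (≤-refl , ≤-refl) ∷ [] ; top = refl ; bottom = refl }
    go x y@(suc (suc _)) 1≤y y<x cop (acc rec) =
      let (ev , od) = go y r r≥1 (m%n<n x y) cop′ (rec (m%n<n x y)) in step-odd od , step-even ev
      where
      q = x / y
      r = x % y
      x≡ : q * y + r ≡ x
      x≡ = trans (+-comm (q * y) r) (sym (m≡m%n+[m/n]*n x y))
      q≥1 : 1 ≤ q
      q≥1 = m≥n⇒m/n>0 (<⇒≤ y<x)
      cop′ : Coprime y r
      cop′ (d∣y , d∣r) = cop (subst (_ ∣_) x≡ (∣m∣n⇒∣m+n (∣n⇒∣m*n q d∣y) d∣r) , d∣y)
      r≥1 : 1 ≤ r
      r≥1 = n≢0⇒n>0 λ r≡0 → 1+n≢0 (suc-injective (cop (subst (y ∣_) (trans (sym (+-identityʳ _)) (trans (cong (q * y +_) (sym r≡0)) x≡)) (n∣m*n q) , ∣-refl)))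
      step-odd : OddWord y r → EvenWord x y
      step-odd (w , cw , k , e) = q ∷ w , subst (λ z → ColumnWord z y (q ∷ w)) x≡ (extend q q≥1 1≤y cw) , suc k , trans (cong suc e) (sym (*-distribˡ-+ 2 1 k))
      step-even : EvenWord y r → OddWord x y
      step-even (w , cw , k , e) = q ∷ w , subst (λ z → ColumnWord z y (q ∷ w)) x≡ (extend q q≥1 1≤y cw) , k , cong suc e

  -- Two digits at least double the corner entry. Words with entries O(H) thus have length O(log H),
  -- which keeps the pigeonhole on length cheap.
  2^k≤m11 : ∀ k w → Digits w → length w ≡ 2 * k → 2 ^ k ≤ m11 (prodWord w)
  2^k≤m11 zero w d _ = m11≥1 d
  2^k≤m11 (suc k) (a ∷ []) _ e with () ← trans e (*-distribˡ-+ 2 1 k)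
  2^k≤m11 (suc k) (suc a ∷ suc b ∷ w) (_ ∷ _ ∷ d) e = begin
    2 * 2 ^ k                          ≤⟨ *-monoʳ-≤ 2 (2^k≤m11 k w d (suc-injective (suc-injective (trans e (*-distribˡ-+ 2 1 k))))) ⟩
    2 * g₁                             ≤⟨ m≤m+n (2 * g₁) (b * g₁ + g₂ + a * (suc b * g₁ + g₂)) ⟩
    2 * g₁ + (b * g₁ + g₂ + a * (suc b * g₁ + g₂)) ≡⟨ r a b g₁ g₂ ⟩
    suc a * (suc b * g₁ + g₂) + g₁     ≡⟨ sym (trans (M11 {suc a} (prodWord (suc b ∷ w))) (cong₂ (λ u v → suc a * u + v) (M11 {suc b} g) (M21 {suc b} g))) ⟩
    m11 (prodWord (suc a ∷ suc b ∷ w)) ∎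
    where
    open ≤-Reasoning
    g = prodWord w
    g₁ = m11 g
    g₂ = m21 g
    r : ∀ a b g h → 2 * g + (b * g + h + a * (suc b * g + h)) ≡ suc a * (suc b * g + h) + g
    r = ℕSolver.solve-∀

  normSq≤ : ∀ a w → Digits (a ∷ w) → normSq (prodWord (a ∷ w)) ≤ 4 * (m11 (prodWord (a ∷ w)) * m11 (prodWord (a ∷ w)))
  normSq≤ a w d = ≤-trans (+-mono-≤ (+-mono-≤ (+-mono-≤ ≤-refl (sq l₁₂)) (sq l₂₁)) (sq (≤-trans l₂₂ l₂₁))) (≤-reflexive (e (m * m)))
    where
    m = m11 (prodWord (a ∷ w))
    l₁₂ = proj₁ (columns d)
    l₂₂ = proj₂ (columns d)
    l₂₁ = m21≤m11 d
    sq : ∀ {x} → x ≤ m → x * x ≤ m * m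
    sq h = *-mono-≤ h h
    e : ∀ x → x + x + x + x ≡ 4 * x
    e = ℕSolver.solve-∀

  -- The empty word is a junk value, taken unless x and y are positive and coprime.
  pairWord : ℕ × ℕ → Word
  pairWord (x , y) with 1 ≤? x | 1 ≤? y | coprime? (x + y) y
  -- The column is (x + y, y), so that its top exceeds its bottom for every pair, as the expansion
  -- requires; coprimality is unaffected.
  ... | yes px | yes py | yes cop = proj₁ (proj₁ (continued-fraction (x + y) y py (m<n+m y px) cop))
  ... | _ | _ | _ = []

  pairWord-spec : ∀ x y → 1 ≤ x → 1 ≤ y → Coprime x y → ColumnWord (x + y) y (pairWord (x , y)) × ∃ λ k → length (pairWord (x , y)) ≡ 2 * k
  pairWord-spec x y px py cop with 1 ≤? x | 1 ≤? y | coprime? (x + y) y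
  ... | yes px | yes py | yes cop′ = proj₂ (proj₁ (continued-fraction (x + y) y py (m<n+m y px) cop′))
  ... | no n | _ | _ = ⊥-elim (n px)
  ... | yes _ | no n | _ = ⊥-elim (n py)
  ... | yes _ | yes _ | no n = ⊥-elim (n λ {d} (d∣x+y , d∣y) → cop (∣m+n∣m⇒∣n (subst (d ∣_) (+-comm x y) d∣x+y) d∣y , d∣y))

  Residue : Set
  Residue = (ℕ × ℕ) × (ℕ × ℕ)

  _≟ʳ_ : (r s : Residue) → Dec (r ≡ s)
  _≟ʳ_ = ≡-dec (≡-dec _≟_ _≟_) (≡-dec _≟_ _≟_)

  module _ (q : ℕ) .{{_ : NonZero q}} where

    residue : Mat → Residue
    residue (mat a b c d) = (a % q , b % q) , (c % q , d % q)

    allResidues : List Residue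
    allResidues = cartesianProduct (cartesianProduct I I) (cartesianProduct I I)
      where I = interval 0 q

    length-allResidues : length allResidues ≡ q * q * (q * q)
    length-allResidues = trans (length-cartesianProduct (cartesianProduct I I) (cartesianProduct I I))
      (cong₂ _*_ sq sq)
      where
      I = interval 0 q
      sq : length (cartesianProduct I I) ≡ q * q
      sq = trans (length-cartesianProduct I I) (cong₂ _*_ (length-interval 0 q) (length-interval 0 q))

    residue∈ : ∀ g → residue g ∈ allResidues
    residue∈ (mat a b c d) = ∈-cartesianProduct⁺ (∈-cartesianProduct⁺ (res a) (res b)) (∈-cartesianProduct⁺ (res c) (res d))
      where
      res : ∀ x → x % q ∈ interval 0 q
      res x = ∈-interval⁺ 0 q z≤n (m%n<n x q)

    residue-≈ : ∀ g h → residue g ≡ residue h → g ≈ h [mod q ]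
    residue-≈ (mat a b c d) (mat a′ b′ c′ d′) e = congruent
      (%⇒Congruent a a′ (,-injectiveˡ (,-injectiveˡ e))) (%⇒Congruent b b′ (,-injectiveʳ (,-injectiveˡ e)))
      (%⇒Congruent c c′ (,-injectiveˡ (,-injectiveʳ e))) (%⇒Congruent d d′ (,-injectiveʳ (,-injectiveʳ e)))

    power : Mat → ℕ → Mat
    power g zero = I₂
    power g (suc i) = g · power g i

    power-+ : ∀ g i j → power g (i + j) ≡ power g i · power g j
    power-+ g zero j = sym (·-identityˡ (power g j))
    power-+ g (suc i) j = trans (cong (g ·_) (power-+ g i j)) (sym (·-assoc g (power g i) (power g j)))

    SL-power : ∀ g i → IsSL g → IsSL (power g i)
    SL-power g zero _ = refl
    SL-power g (suc i) sl = SL-· g (power g i) sl (SL-power g i sl)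

    -- Two powers of g agree modulo q by the pigeonhole principle, and the smaller one cancels.
    finite-order : ∀ g → IsSL g → ∃ λ n → power g (suc n) ≈ I₂ [mod q ]
    finite-order g sl with pigeonhole-fibre _≟ʳ_ (interval 0 (suc (length allResidues))) allResidues (λ i → residue (power g i)) 1
        (λ i _ → residue∈ (power g i)) (≤-reflexive (trans (cong suc (*-identityʳ _)) (sym (length-interval 0 (suc (length allResidues))))))
    ... | r , 2≤ = two (filter (λ i → residue (power g i) ≟ʳ r) exponents) (Unique.filter⁺ (λ i → residue (power g i) ≟ʳ r) (Unique-interval 0 _))
            (λ i i∈ → proj₂ (∈-filter⁻ (λ i → residue (power g i) ≟ʳ r) {xs = exponents} i∈)) 2≤
      where
      exponents = interval 0 (suc (length allResidues))
      ordered : ∀ i j → i < j → residue (power g i) ≡ residue (power g j) → ∃ λ n → power g (suc n) ≈ I₂ [mod q ]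
      ordered i j i<j e = j ∸ suc i , ≈-sym (≈-cancelˡ (power g i) (SL-power g i sl)
        (subst₂ (λ u v → u ≈ v [mod q ]) (sym (·-identityʳ (power g i))) (trans (cong (power g) (sym split)) (power-+ g i (suc (j ∸ suc i)))) (residue-≈ (power g i) (power g j) e)))
        where
        split : i + suc (j ∸ suc i) ≡ j
        split = trans (+-suc i _) (m+[n∸m]≡n i<j)
      two : (L : List ℕ) → Unique L → (∀ i → i ∈ L → residue (power g i) ≡ r) → 1 < length L → ∃ λ n → power g (suc n) ≈ I₂ [mod q ]
      two (i ∷ j ∷ L) ((i≢j ∷ _) ∷ _) h _ with <-cmp i j
      ... | tri< lt _ _ = ordered i j lt (trans (h i (here refl)) (sym (h j (there (here refl)))))
      ... | tri≈ _ e _ = ⊥-elim (i≢j e)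
      ... | tri> _ _ gt = ordered j i gt (trans (h j (there (here refl))) (sym (h i (here refl))))
      two (i ∷ []) _ _ (s≤s ())

    module Build (K : ℕ) .{{_ : NonZero K}} where

      private
        opaque
          -- Chosen for the pigeonhole: 1024 · 2βK · q⁴ = C β must be less than b = 2^β, and β = 4C
          -- gives C β = (2C)² < (2^(2C))² = b. Moreover X = 16 H, because a pair from [1, H]²
          -- followed by the digits 1, 1 has norm at most 4 (2H)² · 7 = 112 H² ≤ (16 H)².
          C β : ℕ
          C = 2048 * K * (q * q * (q * q))
          β = 4 * C

          C≡ : C ≡ 2048 * K * (q * q * (q * q))
          C≡ = refl

          β≡ : β ≡ 4 * C
          β≡ = refl

        h H b X τ₀ : ℕ
        b = 2 ^ β
        X = b ^ K
        h = β * K ∸ 4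
        H = 2 ^ h
        τ₀ = b ^ (K + pred K)

        instance
          C≢0 : NonZero C
          C≢0 = subst NonZero (sym C≡) (m*n≢0 (2048 * K) (q * q * (q * q)) {{m*n≢0 2048 K}} {{m*n≢0 (q * q) (q * q) {{m*n≢0 q q}} {{m*n≢0 q q}}}})

        1≤C : 1 ≤ C
        1≤C = >-nonZero⁻¹ C

        4≤β : 4 ≤ β
        4≤β = ≤-trans (*-monoʳ-≤ 4 1≤C) (≤-reflexive (sym β≡))

        βK≡ : 4 + h ≡ β * K
        βK≡ = m+[n∸m]≡n (≤-trans 4≤β (m≤m*n β K))

        X≡ : X ≡ 16 * H
        X≡ = trans (^-*-assoc 2 β K) (trans (cong (2 ^_) (sym βK≡)) (^-distribˡ-+-* 2 4 h))

        bτ₀ : b * τ₀ ≡ X * X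
        bτ₀ = trans (cong (b ^_) (sym (trans (cong (K +_) (sym (suc-pred K))) (+-suc K (pred K))))) (^-distribˡ-+-* b K K)

        Cβ<b : C * β < b
        Cβ<b = begin-strict
          C * β                             ≡⟨ trans (cong (C *_) β≡) (e₁ C) ⟩
          2 * C * (2 * C)                   <⟨ *-mono-< (n<2^n (2 * C)) (n<2^n (2 * C)) ⟩
          2 ^ (2 * C) * 2 ^ (2 * C)         ≡⟨ sym (^-distribˡ-+-* 2 (2 * C) (2 * C)) ⟩
          2 ^ (2 * C + 2 * C)               ≡⟨ cong (2 ^_) (trans (e₂ C) (sym β≡)) ⟩
          b                                 ∎
          where
          open ≤-Reasoning
          e₁ : ∀ c → c * (4 * c) ≡ 2 * c * (2 * c)
          e₁ = ℕSolver.solve-∀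
          e₂ : ∀ c → 2 * c + 2 * c ≡ 4 * c
          e₂ = ℕSolver.solve-∀

        pairs : List (ℕ × ℕ)
        pairs = coprimePairs H

        word : ℕ × ℕ → Word
        word z = pairWord z ++ 1 ∷ 1 ∷ []

        spec : ∀ z → z ∈ pairs → ColumnWord (proj₁ z + proj₂ z) (proj₂ z) (pairWord z) × (∃ λ k → length (pairWord z) ≡ 2 * k) × proj₁ z + proj₂ z ≤ 2 * H × 1 ≤ proj₁ z
        spec (x , y) z∈ = let (m , cop) = ∈-filter⁻ coprimePair? {xs = cartesianProduct (interval 1 H) (interval 1 H)} z∈
                              (x∈ , y∈) = ∈-cartesianProduct⁻ (interval 1 H) (interval 1 H) m
                              (lx , ux) = ∈-interval⁻ 1 H x∈ ; (ly , uy) = ∈-interval⁻ 1 H y∈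
                              (cw , ev) = pairWord-spec x y lx ly cop
          in cw , ev , ≤-trans (+-mono-≤ (s≤s⁻¹ ux) (s≤s⁻¹ uy)) (≤-reflexive (cong (H +_) (sym (+-identityʳ H)))) , lx

        words : List Word
        words = map word pairs

        words-unique : Unique words
        words-unique = Unique-map-∈ word pairs (Unique.filter⁺ coprimePair? (Unique.cartesianProduct⁺ (Unique-interval 1 H) (Unique-interval 1 H))) inj
          where
          inj : ∀ z w → z ∈ pairs → w ∈ pairs → word z ≡ word w → z ≡ w
          inj z@(x , y) w@(x′ , y′) z∈ w∈ e = cong₂ _,_ (+-cancelʳ-≡ y x x′ (trans ex (cong (x′ +_) (sym ey)))) ey
            where
            module Z = ColumnWord (proj₁ (spec z z∈))
            module W = ColumnWord (proj₁ (spec w w∈))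
            stem : pairWord z ≡ pairWord w
            stem = ++-cancelʳ (1 ∷ 1 ∷ []) (pairWord z) (pairWord w) e
            ey : y ≡ y′
            ey = trans (sym Z.bottom) (trans (cong (λ v → m21 (prodWord v)) stem) W.bottom)
            ex : x + y ≡ x′ + y′
            ex = trans (sym Z.top) (trans (cong (λ v → m11 (prodWord v)) stem) W.top)

        record Good (w : Word) : Set where
          field
            even : ∃ λ k → length w ≡ 2 * k
            short : length w < 2 * h + 5
            digits : All (λ a → 1 ≤ a × a ≤ 2 * H) w
            norm : normSq (prodWord w) ≤ X * X
            ending : ∃ λ u → w ≡ u ++ 1 ∷ 1 ∷ []

        good : ∀ w → w ∈ words → Good w
        good w w∈ with ∈-map⁻ word w∈
        ... | z@(x , y) , z∈ , refl = record
            { even = suc k , trans len (trans (+-comm (2 * k) 2) (sym (*-distribˡ-+ 2 1 k)))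
            ; short = ≤-trans (s≤s (≤-reflexive len)) (≤-trans (≤-reflexive (cong suc (+-comm (2 * k) 2)))
                (≤-trans (+-monoʳ-≤ 3 (*-monoʳ-≤ 2 k≤)) (≤-reflexive (e₁ h))))
            ; digits = All.++⁺ (All.map (λ (l , u) → l , ≤-trans u x+y≤) (ColumnWord.digits cw)) ((≤-refl , 1≤2H) ∷ (≤-refl , 1≤2H) ∷ [])
            ; norm = norm≤
            ; ending = pairWord z , refl }
          where
          cw = proj₁ (spec z z∈)
          k = proj₁ (proj₁ (proj₂ (spec z z∈)))
          ke = proj₂ (proj₁ (proj₂ (spec z z∈)))
          x+y≤ = proj₁ (proj₂ (proj₂ (spec z z∈)))
          1≤x = proj₂ (proj₂ (proj₂ (spec z z∈)))
          dg : Digits (pairWord z)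
          dg = All.map proj₁ (ColumnWord.digits cw)
          len : length (word z) ≡ 2 * k + 2
          len = trans (length-++ (pairWord z)) (cong (_+ 2) ke)
          1≤2H : 1 ≤ 2 * H
          1≤2H = ≤-trans (m^n>0 2 h) (m≤n*m H 2)
          e₁ : ∀ h → 3 + 2 * (1 + h) ≡ 2 * h + 5
          e₁ = ℕSolver.solve-∀
          m11≡ : m11 (prodWord (pairWord z)) ≡ x + y
          m11≡ = ColumnWord.top cw
          k≤ : k ≤ suc h
          k≤ with k ≤? suc h
          ... | yes l = l
          ... | no g = ⊥-elim (<-irrefl refl (<-≤-trans (^-monoʳ-< 2 (s≤s (s≤s z≤n)) (≰⇒> g)) (≤-trans (2^k≤m11 k (pairWord z) dg ke) (≤-trans (≤-reflexive m11≡) x+y≤))))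
          stem-norm : ∀ w → Digits w → normSq (prodWord w) ≤ 4 * (m11 (prodWord w) * m11 (prodWord w))
          stem-norm [] _ = s≤s (s≤s z≤n)
          stem-norm (a ∷ w) d = normSq≤ a w d
          norm≤ : normSq (prodWord (word z)) ≤ X * X
          norm≤ = begin
            normSq (prodWord (word z))                           ≡⟨ cong normSq (prodWord-++ (pairWord z) (1 ∷ 1 ∷ [])) ⟩
            normSq (prodWord (pairWord z) · prodWord (1 ∷ 1 ∷ [])) ≤⟨ normSq-· (prodWord (pairWord z)) (prodWord (1 ∷ 1 ∷ [])) ⟩
            normSq (prodWord (pairWord z)) * 7                   ≤⟨ *-monoˡ-≤ 7 (≤-trans (stem-norm (pairWord z) dg) (≤-reflexive (cong (λ v → 4 * (v * v)) m11≡))) ⟩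
            4 * ((x + y) * (x + y)) * 7                          ≤⟨ *-monoˡ-≤ 7 (*-monoʳ-≤ 4 (*-mono-≤ x+y≤ x+y≤)) ⟩
            4 * (2 * H * (2 * H)) * 7                            ≡⟨ e₂ H ⟩
            112 * (H * H)                                        ≤⟨ *-monoˡ-≤ (H * H) (m≤m+n 112 144) ⟩
            256 * (H * H)                                        ≡⟨ e₃ H ⟩
            16 * H * (16 * H)                                    ≡⟨ sym (cong₂ _*_ X≡ X≡) ⟩
            X * X                                                ∎
            where
            open ≤-Reasoning
            e₂ : ∀ h → 4 * (2 * h * (2 * h)) * 7 ≡ 112 * (h * h)
            e₂ = ℕSolver.solve-∀
            e₃ : ∀ h → 256 * (h * h) ≡ 16 * h * (16 * h)
            e₃ = ℕSolver.solve-∀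

        keys : List (ℕ × Residue)
        keys = cartesianProduct (interval 0 (2 * h + 5)) allResidues

        key : Word → ℕ × Residue
        key w = length w , residue (prodWord w)

        _≟ᵏ_ : (x y : ℕ × Residue) → Dec (x ≡ y)
        _≟ᵏ_ = ≡-dec _≟_ _≟ʳ_

        -- There are at least H²/4 = X²/1024 words and at most 2βK q⁴ keys, while τ₀ = X²/b; the
        -- claim becomes C β < b.
        enough : length keys * τ₀ < length words
        enough = *-cancelˡ-< (1024 * b) _ _ (begin-strict
          1024 * b * (length keys * τ₀)
            ≡⟨ cong (λ v → 1024 * b * (v * τ₀)) (trans (length-cartesianProduct (interval 0 (2 * h + 5)) allResidues) (cong₂ _*_ (length-interval 0 (2 * h + 5)) length-allResidues)) ⟩
          1024 * b * ((2 * h + 5) * Q * τ₀)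
            ≡⟨ e₁ b (2 * h + 5) Q τ₀ ⟩
          1024 * (2 * h + 5) * Q * (b * τ₀)
            ≡⟨ cong (1024 * (2 * h + 5) * Q *_) bτ₀ ⟩
          1024 * (2 * h + 5) * Q * (X * X)
            ≤⟨ *-monoˡ-≤ (X * X) (*-monoˡ-≤ Q (*-monoʳ-≤ 1024 2h+5≤)) ⟩
          1024 * (2 * (β * K)) * Q * (X * X)
            ≡⟨ cong (_* (X * X)) (trans (e₂ β K Q) (cong (_* β) (sym C≡))) ⟩
          C * β * (X * X)
            <⟨ *-monoˡ-< (X * X) {{m*n≢0 X X {{X≢0}} {{X≢0}}}} Cβ<b ⟩
          b * (X * X)
            ≡⟨ cong (b *_) (trans (cong₂ _*_ X≡ X≡) (e₃ H)) ⟩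
          b * (256 * (H * H))
            ≤⟨ *-monoʳ-≤ b (*-monoʳ-≤ 256 (coprime-count H)) ⟩
          b * (256 * (4 * length pairs))
            ≡⟨ e₄ b (length pairs) ⟩
          1024 * b * length pairs
            ≡⟨ cong (1024 * b *_) (sym (length-map word pairs)) ⟩
          1024 * b * length words ∎)
          where
          open ≤-Reasoning
          Q = q * q * (q * q)
          X≢0 : NonZero X
          X≢0 = m^n≢0 b K {{m^n≢0 2 β}}
          e₁ : ∀ b k Q t → 1024 * b * (k * Q * t) ≡ 1024 * k * Q * (b * t)
          e₁ = ℕSolver.solve-∀
          e₂ : ∀ β K Q → 1024 * (2 * (β * K)) * Q ≡ 2048 * K * Q * β
          e₂ = ℕSolver.solve-∀
          e₃ : ∀ h → 16 * h * (16 * h) ≡ 256 * (h * h)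
          e₃ = ℕSolver.solve-∀
          e₄ : ∀ b l → b * (256 * (4 * l)) ≡ 1024 * b * l
          e₄ = ℕSolver.solve-∀
          e₅ : ∀ h → 2 * h + 5 + 3 ≡ 2 * (4 + h)
          e₅ = ℕSolver.solve-∀
          2h+5≤ : 2 * h + 5 ≤ 2 * (β * K)
          2h+5≤ = ≤-trans (m≤m+n _ 3) (≤-reflexive (trans (e₅ h) (cong (2 *_) βK≡)))

        opaque
          fibre : Σ (ℕ × Residue) λ κ → τ₀ < length (filter (λ w → key w ≟ᵏ κ) words)
          fibre = pigeonhole-fibre _≟ᵏ_ words keys key τ₀
            (λ w w∈ → ∈-cartesianProduct⁺ (∈-interval⁺ 0 _ z≤n (Good.short (good w w∈))) (residue∈ (prodWord w))) enough

        κ : ℕ × Residue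
        κ = proj₁ fibre

        -- The fibre is cut to exactly τ₀ words, so that `size` can be an equation.
        F₀ F : List Word
        F₀ = filter (λ w → key w ≟ᵏ κ) words
        F = take τ₀ F₀

        ∈-take : ∀ {A : Set} n (L : List A) {x} → x ∈ take n L → x ∈ L
        ∈-take (suc n) (y ∷ L) (here e) = here e
        ∈-take (suc n) (y ∷ L) (there x∈) = there (∈-take n L x∈)

        F-mem : ∀ w → w ∈ F → w ∈ words × key w ≡ κ
        F-mem w w∈ = ∈-filter⁻ (λ w → key w ≟ᵏ κ) {xs = words} (∈-take τ₀ F₀ w∈)

        F-unique : Unique F
        F-unique = Unique.take⁺ τ₀ (Unique.filter⁺ (λ w → key w ≟ᵏ κ) words-unique)

        F-length : length F ≡ τ₀
        F-length = trans (length-take τ₀ F₀) (m≤n⇒m⊓n≡m (<⇒≤ (proj₂ fibre)))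

        first : ∀ {A : Set} (L : List A) → 1 ≤ length L → ∃ λ x → x ∈ L
        first (x ∷ _) _ = x , here refl

        opaque
          member : ∃ λ w → w ∈ F
          member = first F (subst (1 ≤_) (sym F-length) (m^n>0 b {{m^n≢0 2 β}} (K + pred K)))

        w₀ : Word
        w₀ = proj₁ member

        ℓ₀ : ℕ
        ℓ₀ = proj₁ (Good.even (good w₀ (proj₁ (F-mem w₀ (proj₂ member)))))

        len₀ : length w₀ ≡ 2 * ℓ₀
        len₀ = proj₂ (Good.even (good w₀ (proj₁ (F-mem w₀ (proj₂ member)))))

        F-good : ∀ w → w ∈ F → Good w
        F-good w w∈ = good w (proj₁ (F-mem w w∈))

        same-key : ∀ w → w ∈ F → key w ≡ key w₀
        same-key w w∈ = trans (proj₂ (F-mem w w∈)) (sym (proj₂ (F-mem w₀ (proj₂ member))))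

        F-lengths : ∀ w → w ∈ F → length w ≡ 2 * ℓ₀
        F-lengths w w∈ = trans (,-injectiveˡ (same-key w w∈)) len₀

        F-residues : ∀ w → w ∈ F → prodWord w ≈ prodWord w₀ [mod q ]
        F-residues w w∈ = residue-≈ (prodWord w) (prodWord w₀) (,-injectiveʳ (same-key w w∈))

        opaque
          order : ∃ λ n → power (prodWord w₀) (suc n) ≈ I₂ [mod q ]
          order = finite-order (prodWord w₀) (SL-prodWord ℓ₀ w₀ len₀)

        n : ℕ
        n = proj₁ order

        pow-norms : ∀ i w → w ∈ pow F (suc i) → normSq (prodWord w) ≤ (X * X) ^ suc i
        pow-norms i w w∈ with ∈-concatenations⁻ F (pow F i) w∈
        pow-norms zero w w∈ | t , _ , t∈ , here refl , refl =
          ≤-trans (≤-reflexive (cong (λ v → normSq (prodWord v)) (++-identityʳ t))) (≤-trans (Good.norm (F-good t t∈)) (≤-reflexive (sym (*-identityʳ (X * X)))))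
        pow-norms (suc i) w w∈ | t , v , t∈ , v∈ , refl =
          ≤-trans (≤-reflexive (cong normSq (prodWord-++ t v))) (≤-trans (normSq-· (prodWord t) (prodWord v)) (*-mono-≤ (Good.norm (F-good t t∈)) (pow-norms i v v∈)))

        pow-residues : ∀ i w → w ∈ pow F i → prodWord w ≈ power (prodWord w₀) i [mod q ]
        pow-residues zero w (here refl) = ≈-refl I₂
        pow-residues (suc i) w w∈ with ∈-concatenations⁻ F (pow F i) w∈
        ... | t , v , t∈ , v∈ , refl = subst (λ z → z ≈ power (prodWord w₀) (suc i) [mod q ]) (sym (prodWord-++ t v))
          (≈-·-cong (prodWord t) {prodWord w₀} {prodWord v} {power (prodWord w₀) i} (F-residues t t∈) (pow-residues i v v∈))

        pow-endings : ∀ i w → w ∈ pow F (suc i) → ∃ λ u → w ≡ u ++ 1 ∷ 1 ∷ []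
        pow-endings i w w∈ with ∈-concatenations⁻ F (pow F i) w∈
        pow-endings zero w w∈ | t , _ , t∈ , here refl , refl = let (u , e) = Good.ending (F-good t t∈) in u , trans (++-identityʳ t) e
        pow-endings (suc i) w w∈ | t , v , t∈ , v∈ , refl = let (u , e) = pow-endings i v v∈ in t ++ u , trans (cong (t ++_) e) (sym (++-assoc t u _))

      -- All words of F share one residue, so concatenating as many of them as a power of it that is
      -- ≡ 1 requires gives blocks ≡ 1 mod q. The relation b τ₀ = X² survives in powers, with b
      -- replaced by b^(n+1).
      blocks : Blocks q K
      blocks = record
        { b = b ^ suc n
        ; 2≤b = ≤-trans (≤-trans (≤-reflexive (sym (*-identityʳ 2))) (^-monoʳ-≤ 2 (≤-trans (s≤s z≤n) 4≤β))) (≤-trans (≤-reflexive (sym (*-identityʳ b))) (*-monoʳ-≤ b (m^n>0 b {{m^n≢0 2 β}} n)))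
        ; T = pow F (suc n)
        ; ℓ = suc n * ℓ₀
        ; D = 2 * H
        ; unique = Unique-pow F F-lengths F-unique (suc n)
        ; lengths = pow-length F {ℓ₀} F-lengths (suc n)
        ; digits = pow-All F (λ t t∈ → Good.digits (F-good t t∈)) (suc n)
        ; norms = λ t t∈ → ≤-trans (pow-norms n t t∈) (≤-reflexive XX)
        ; endings = pow-endings n
        ; size = trans (cong (b ^ suc n *_) (trans (length-pow F (suc n)) (cong (_^ suc n) F-length)))
            (trans (sym (^-distribʳ-* b τ₀ (suc n))) (trans (cong (_^ suc n) bτ₀) XX))
        ; residues = λ t t∈ → ≈-trans (pow-residues (suc n) t t∈) (proj₂ order) }
        where
        swap : (b ^ suc n) ^ K ≡ X ^ suc n
        swap = trans (^-*-assoc b (suc n) K) (trans (cong (b ^_) (*-comm (suc n) K)) (sym (^-*-assoc b K (suc n))))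
        XX : (X * X) ^ suc n ≡ (b ^ suc n) ^ K * (b ^ suc n) ^ K
        XX = trans (^-distribʳ-* X X (suc n)) (sym (cong₂ _*_ swap swap))

-- The family of matrices and the first two ranges of primes

module Families where

  open Counting
  open Congruences
  open Divisors
  open Words
  open Blocks
  open Quadratics
  open LargePrimes
  open import Data.Nat
  open import Data.Nat.Properties
  open import Data.Nat.Primality using (Prime; prime?)
  open import Data.Integer using (ℤ; +_)
  open import Data.Integer.Divisibility.Signed using (_∣_; _∣?_)

  module Family (q : ℕ) .{{_ : NonZero q}} (q-large : ∀ p → Prime p → 192 < p → ¬ + p ∣ + q)
      (K : ℕ) .{{_ : NonZero K}} (15≤K : 15 ≤ K) (𝔅 : Blocks q K) where

    open BlockPowers 𝔅

    opaque

      -- The constants of the middle range are gathered in c₁ and absorbed by b^c₁. The 12 in s₀ is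
      -- the constant part of 4j = 12 s + 12, the exponent of b lost with j = 3(s + 1) blocks. A =
      -- X^(2 s₀) ensures p² ≤ A for p < X^s₀.
      C₀ c₁ s₀ A : ℕ
      C₀ = collision-constant 1
      c₁ = 64 * (576 * C₀)
      s₀ = c₁ + 12
      A = X ^ s₀ * X ^ s₀

      C₀≡ : ∀ n .{{_ : NonZero n}} → collision-constant n ≡ C₀
      C₀≡ n = refl

      c₁≡ : c₁ ≡ 64 * (576 * C₀)
      c₁≡ = refl

      s₀≡ : s₀ ≡ c₁ + 12
      s₀≡ = refl

      A≡ : A ≡ X ^ s₀ * X ^ s₀
      A≡ = refl

    12≤s₀ : 12 ≤ s₀
    12≤s₀ = ≤-trans (m≤n+m 12 c₁) (≤-reflexive (sym s₀≡))

    instance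
      X≢0 : NonZero X
      X≢0 = >-nonZero 1≤X
      A≢0 : NonZero A
      A≢0 = subst NonZero (sym A≡) (m*n≢0 (X ^ s₀) (X ^ s₀) {{m^n≢0 X s₀}} {{m^n≢0 X s₀}})

    b≤X : b ≤ X
    b≤X = ≤-trans (≤-reflexive (sym (*-identityʳ b))) (^-monoʳ-≤ b (≤-trans (s≤s z≤n) 15≤K))

    2≤X : 2 ≤ X
    2≤X = ≤-trans 2≤b b≤X

    2≤X^ : ∀ s → 1 ≤ s → 2 ≤ X ^ s
    2≤X^ s 1≤s = ≤-trans 2≤X (≤-trans (≤-reflexive (sym (*-identityʳ X))) (^-monoʳ-≤ X 1≤s))

    Z≡ : ∀ j → Z j ≡ b ^ j * τ ^ j
    Z≡ j = trans (cong (_^ j) (sym size)) (^-distribʳ-* b τ j)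

    n<b^n : ∀ n → n < b ^ n
    n<b^n n = ≤-trans (n<2^n n) (^-monoˡ-≤ n 2≤b)

    -- The digits a ≡ 1 and b ≡ 0 modulo q. As b must be positive, y starts at 1 while x starts at
    -- 0.
    top bot : ℕ → ℕ
    top x = suc (q * x)
    bot y = q * y

    Index : Set
    Index = (ℕ × ℕ) × Word

    word : Index → Word
    word ((y , x) , w) = top x ∷ bot y ∷ w

    matrix : Index → Mat
    matrix z = prodWord (word z)

    wildMatrix : ℕ → ℕ → Mat
    wildMatrix x y = prodWord (top x ∷ bot y ∷ [])

    SL-wild : ∀ x y → IsSL (wildMatrix x y)
    SL-wild x y = SL-prodWord 1 (top x ∷ bot y ∷ []) refl

    Js Is : List ℕ
    Is = interval 0 A
    Js = interval 1 A

    indices : ℕ → List Index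
    indices r = cartesianProduct (cartesianProduct Js Is) (pow T r)

    ∑-indices : ∀ r (f : Index → ℕ) → ∑ (indices r) f ≡ ∑[ y ∈ Js ] ∑[ x ∈ Is ] ∑[ w ∈ pow T r ] f ((y , x) , w)
    ∑-indices r f = trans (∑-cartesianProduct (cartesianProduct Js Is) (pow T r) f) (∑-cartesianProduct Js Is _)

    length-indices : ∀ r → length (indices r) ≡ A * A * τ ^ r
    length-indices r = trans (length-cartesianProduct (cartesianProduct Js Is) (pow T r))
      (cong₂ _*_ (trans (length-cartesianProduct Js Is) (cong₂ _*_ (length-interval 1 A) (length-interval 0 A))) (length-pow T r))

    ∈-indices : ∀ r {y x w} → ((y , x) , w) ∈ indices r → (1 ≤ y × y ≤ A) × x < A × w ∈ pow T r
    ∈-indices r z∈ = let (yx∈ , w∈) = ∈-cartesianProduct⁻ (cartesianProduct Js Is) (pow T r) z∈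
                         (y∈ , x∈) = ∈-cartesianProduct⁻ Js Is yx∈
                         (l , u) = ∈-interval⁻ 1 A y∈
      in (l , s≤s⁻¹ u) , proj₂ (∈-interval⁻ 0 A x∈) , w∈

    index-length : ∀ r z → z ∈ indices r → length (word z) ≡ 2 * suc (r * ℓ)
    index-length r ((y , x) , w) z∈ =
      trans (cong (λ k → suc (suc k)) (pow-lengths r w (proj₂ (proj₂ (∈-indices r z∈))))) (sym (*-distribˡ-+ 2 1 (r * ℓ)))

    count : ℤ → ℕ → ℕ → ℕ
    count ε r p = ∑[ z ∈ indices r ] 𝟙 (bad? ε p (matrix z))

    wildPrimes : List ℕ
    wildPrimes = interval 193 (X ^ s₀ ∸ 193)

    middlePrimes : ℕ → List ℕ
    middlePrimes s = interval (X ^ s) (X ^ suc s ∸ X ^ s)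

    module Sign (ε : ℤ) (εε : ε ℤ.* ε ≡ + 1) where

      private
        not-prime : ∀ r p → ¬ Prime p → count ε r p ≡ 0
        not-prime r p ¬pp = count-none (λ z → bad? ε p (matrix z)) (indices r) λ _ _ (pp , _) → ¬pp pp

      wild-prime : ∀ r p → 192 < p → p < X ^ s₀ → count ε r p * (p * p) ≤ 12 * (A * A) * τ ^ r
      wild-prime r p 192<p p< with prime? p
      ... | no ¬pp = ≤-trans (≤-reflexive (cong (_* (p * p)) (not-prime r p ¬pp))) z≤n
      ... | yes pp = begin
        count ε r p * (p * p)
          ≡⟨ cong (_* (p * p)) (trans (∑-indices r _) (trans (∑-cong Js λ y → ∑-swap Is (pow T r) _) (∑-swap Js (pow T r) _))) ⟩
        (∑[ w ∈ pow T r ] ∑[ y ∈ Js ] ∑[ x ∈ Is ] 𝟙 (bad? ε p (matrix ((y , x) , w)))) * (p * p)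
          ≡⟨ sym (∑-*ʳ (pow T r) (p * p) _) ⟩
        ∑[ w ∈ pow T r ] ((∑[ y ∈ Js ] ∑[ x ∈ Is ] 𝟙 (bad? ε p (matrix ((y , x) , w)))) * (p * p))
          ≤⟨ ∑-bound (pow T r) (12 * (A * A)) (λ w w∈ → ≤-trans (*-monoˡ-≤ (p * p) (∑-mono Js λ y → ∑-mono Is λ x → 𝟙-mono (bad? ε p (matrix ((y , x) , w))) (W.R? w w∈ y x) proj₂)) (W.wild-count w w∈)) ⟩
        length (pow T r) * (12 * (A * A))
          ≡⟨ trans (cong (_* (12 * (A * A))) (length-pow T r)) (*-comm (τ ^ r) (12 * (A * A))) ⟩
        12 * (A * A) * τ ^ r ∎
        where
        open ≤-Reasoning
        module W (w : Word) (w∈ : w ∈ pow T r) =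
          OddPrime.Wild pp (≤-trans (s≤s (s≤s (s≤s z≤n))) 192<p) ε εε q A (q-large p pp 192<p) (≤-trans (*-mono-≤ (<⇒≤ p<) (<⇒≤ p<)) (≤-reflexive (sym A≡))) (prodWord w) (pow-SL r w w∈)

      wild-total : ∀ r → 16 * ∑ wildPrimes (count ε r) ≤ A * A * τ ^ r
      wild-total r = *-cancelˡ-≤ 12 (begin
        12 * (16 * ∑ wildPrimes (count ε r))    ≡⟨ sym (*-assoc 12 16 (∑ wildPrimes (count ε r))) ⟩
        192 * ∑ wildPrimes (count ε r)          ≤⟨ ∑-inverse-squares 192 (X ^ s₀ ∸ 193) (count ε r) (12 * (A * A) * τ ^ r) (λ p l u → wild-prime r p l (≤-trans u (≤-reflexive (m+[n∸m]≡n 193≤)))) ⟩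
        12 * (A * A) * τ ^ r                    ≡⟨ *-assoc 12 (A * A) (τ ^ r) ⟩
        12 * (A * A * τ ^ r)                    ∎)
        where
        open ≤-Reasoning
        193≤ : 193 ≤ X ^ s₀
        193≤ = begin
          193             ≤⟨ m≤m+n 193 3903 ⟩
          2 ^ 12          ≤⟨ ^-monoʳ-≤ 2 12≤s₀ ⟩
          2 ^ s₀          ≤⟨ ^-monoˡ-≤ s₀ 2≤X ⟩
          X ^ s₀          ∎

      private
        V : ℕ → ℕ
        V j = 576 * C₀ * suc j * b ^ j * (Z j * Z j)

      -- The word is split into j, j and r blocks, and the last r are held fixed. The length j = 3(s
      -- + 1) gives Z j = X^(6(s+1)) ≥ p⁶ = n³, so that the diagonal term of the collision bound
      -- does not exceed the main one.
      middle-prime : ∀ s r p → X ^ s ≤ p → p < X ^ suc s → 2 < p →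
        let j = 3 * suc s in count ε (j + (j + r)) p * (p * p) ≤ A * A * τ ^ r * V j
      middle-prime s r p X^s≤p p< 2<p with prime? p
      ... | no ¬pp = ≤-trans (≤-reflexive (cong (_* (p * p)) (not-prime (3 * suc s + (3 * suc s + r)) p ¬pp))) z≤n
      ... | yes pp = begin
        count ε (j + (j + r)) p * n
          ≡⟨ cong (_* n) (trans (∑-indices (j + (j + r)) _) (∑-cong Js λ y → ∑-cong Is λ x →
               trans (∑-pow-+ T j (j + r) _) (trans (∑-cong (pow T j) λ w₁ → trans (∑-pow-+ T j r _) (∑-swap (pow T j) (pow T r) _)) (∑-swap (pow T j) (pow T r) _)))) ⟩
        (∑[ y ∈ Js ] ∑[ x ∈ Is ] ∑[ v ∈ pow T r ] inner y x v) * n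
          ≤⟨ *-monoˡ-≤ n (∑-bound Js _ λ y _ → ∑-bound Is _ λ x _ → ∑-bound (pow T r) c (inner≤ y x)) ⟩
        (length Js * (length Is * (length (pow T r) * c))) * n
          ≡⟨ cong (_* n) (cong₂ _*_ (length-interval 1 A) (cong₂ _*_ (length-interval 0 A) (cong (_* c) (length-pow T r)))) ⟩
        A * (A * (τ ^ r * c)) * n
          ≡⟨ e₁ A (τ ^ r) c n ⟩
        A * A * τ ^ r * (c * n)
          ≤⟨ *-monoʳ-≤ (A * A * τ ^ r) c*n≤ ⟩
        A * A * τ ^ r * V j ∎
        where
        open ≤-Reasoning
        j = 3 * suc s
        n = p * p
        e₁ : ∀ A t c n → A * (A * (t * c)) * n ≡ A * A * t * (c * n)
        e₁ = ℕSolver.solve-∀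
        instance
          p≢0 : NonZero p
          p≢0 = >-nonZero (≤-trans (s≤s z≤n) 2<p)
          n≢0 : NonZero (p * p)
          n≢0 = m*n≢0 p p
        module O = OddPrime pp 2<p ε εε
        c = 288 * (n * n) * collisions n j
        γ : ℕ → ℕ → Word → Word → Word → Mat
        γ y x v w₁ w₂ = matrix ((y , x) , w₁ ++ (w₂ ++ v))
        inner : ℕ → ℕ → Word → ℕ
        inner y x v = ∑[ w₁ ∈ pow T j ] ∑[ w₂ ∈ pow T j ] 𝟙 (bad? ε p (γ y x v w₁ w₂))
        shape : ∀ y x v w₁ w₂ → γ y x v w₁ w₂ ≡ (wildMatrix x y · prodWord w₁) · (prodWord w₂ · prodWord v)
        shape y x v w₁ w₂ = trans (prodWord-++ (top x ∷ bot y ∷ []) (w₁ ++ (w₂ ++ v)))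
          (trans (cong (wildMatrix x y ·_) (trans (prodWord-++ w₁ (w₂ ++ v)) (cong (prodWord w₁ ·_) (prodWord-++ w₂ v))))
            (sym (·-assoc (wildMatrix x y) (prodWord w₁) (prodWord w₂ · prodWord v))))
        inner≤ : ∀ y x v → v ∈ pow T r → inner y x v ≤ c
        inner≤ y x v v∈ = ≤-trans
          (∑-mono (pow T j) λ w₁ → ∑-mono (pow T j) λ w₂ → 𝟙-mono (bad? ε p (γ y x v w₁ w₂)) (+ n ∣? (+ normSq (Mid.g w₁ w₂) ℤ.- + 2 ℤ.* ε))
            λ (_ , h) → subst (λ g → + n ∣ + normSq g ℤ.- + 2 ℤ.* ε) (shape y x v w₁ w₂) h)
          Mid.middle-count
          where
          module Mid = O.Middle (pow T j) prodWord (pow-SL j) (wildMatrix x y) (prodWord v) (SL-wild x y) (pow-SL r v v∈)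
        p≤ : p ≤ X ^ suc s
        p≤ = <⇒≤ p<
        n³≤Z : n * (n * n) ≤ Z j
        n³≤Z = begin
          n * (n * n)                                 ≤⟨ *-mono-≤ (*-mono-≤ p≤ p≤) (*-mono-≤ (*-mono-≤ p≤ p≤) (*-mono-≤ p≤ p≤)) ⟩
          Y * Y * (Y * Y * (Y * Y))                   ≡⟨ e₂ (Y * Y) ⟩
          (Y * Y) ^ 3                                 ≡⟨ cong (_^ 3) (sym (^-distribʳ-* X X (suc s))) ⟩
          ((X * X) ^ suc s) ^ 3                       ≡⟨ ^-*-assoc (X * X) (suc s) 3 ⟩
          (X * X) ^ (suc s * 3)                       ≡⟨ cong ((X * X) ^_) (*-comm (suc s) 3) ⟩
          Z j                                         ∎
          where
          Y = X ^ suc s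
          e₂ : ∀ y → y * (y * y) ≡ y * (y * (y * 1))
          e₂ = ℕSolver.solve-∀
        c*n≤ : c * n ≤ V j
        c*n≤ = begin
          288 * (n * n) * collisions n j * n                                     ≡⟨ e₃ n (collisions n j) ⟩
          288 * (n * (n * n) * collisions n j)                                   ≤⟨ *-monoʳ-≤ 288 (subst (λ c → n * (n * n) * collisions n j ≤ c * suc j * b ^ j * (Z j * (Z j + n * (n * n)))) (C₀≡ n) (collisions≤ n j)) ⟩
          288 * (C₀ * suc j * b ^ j * (Z j * (Z j + n * (n * n))))               ≤⟨ *-monoʳ-≤ 288 (*-monoʳ-≤ (C₀ * suc j * b ^ j) (*-monoʳ-≤ (Z j) (+-monoʳ-≤ (Z j) n³≤Z))) ⟩
          288 * (C₀ * suc j * b ^ j * (Z j * (Z j + Z j)))                       ≡⟨ e₄ C₀ (suc j) (b ^ j) (Z j) ⟩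
          V j                                                                    ∎
          where
          e₃ : ∀ n c → 288 * (n * n) * c * n ≡ 288 * (n * (n * n) * c)
          e₃ = ℕSolver.solve-∀
          e₄ : ∀ c j b z → 288 * (c * j * b * (z * (z + z))) ≡ 576 * c * j * b * (z * z)
          e₄ = ℕSolver.solve-∀

      -- The losses are b^c₁ for the constants, b^s for the power of 2, b^j for the factor j + 1,
      -- b^j from divisors and b^(2j) from replacing Z² by τ^(2j). Together they give b^(s₀ + 13 s),
      -- at most b^(14 s) for s ≥ s₀. The power 2^(s - s₀) is carried along to make the sum over s
      -- geometric.
      middle-arithmetic : ∀ s → s₀ ≤ s → let j = 3 * suc s in 64 * (V j * 2 ^ (s ∸ s₀)) ≤ X ^ s * (τ ^ j * τ ^ j)
      middle-arithmetic s s₀≤s = begin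
        64 * (V j * d)                                                       ≡⟨ cong (λ z → 64 * (576 * C₀ * suc j * b ^ j * (z * z) * d)) {Z j} {b ^ j * τ ^ j} (Z≡ j) ⟩
        64 * (576 * C₀ * suc j * b ^ j * (b ^ j * τ ^ j * (b ^ j * τ ^ j)) * d) ≡⟨ trans (e₁ 576 C₀ (suc j) (b ^ j) (τ ^ j) d) (cong (λ z → z * (d * (suc j * (b ^ j * (b ^ j * b ^ j)))) * (τ ^ j * τ ^ j)) (sym c₁≡)) ⟩
        c₁ * (d * (suc j * (b ^ j * (b ^ j * b ^ j)))) * (τ ^ j * τ ^ j)     ≤⟨ *-monoˡ-≤ (τ ^ j * τ ^ j) main ⟩
        X ^ s * (τ ^ j * τ ^ j)                                              ∎
        where
        open ≤-Reasoning
        j = 3 * suc s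
        d = 2 ^ (s ∸ s₀)
        e₁ : ∀ k C j b t d → 64 * (k * C * j * b * (b * t * (b * t)) * d) ≡ 64 * (k * C) * (d * (j * (b * (b * b)))) * (t * t)
        e₁ = ℕSolver.solve-∀
        e₂ : ∀ c s → c + (s + (3 * suc s + (3 * suc s + (3 * suc s + 3 * suc s)))) ≡ c + 12 + 13 * s
        e₂ = ℕSolver.solve-∀
        main : c₁ * (d * (suc j * (b ^ j * (b ^ j * b ^ j)))) ≤ X ^ s
        main = begin
          c₁ * (d * (suc j * (b ^ j * (b ^ j * b ^ j))))
            ≤⟨ *-mono-≤ (<⇒≤ (n<b^n c₁)) (*-mono-≤ (≤-trans (^-monoʳ-≤ 2 (m∸n≤m s s₀)) (^-monoˡ-≤ s 2≤b)) (*-monoˡ-≤ _ (n<b^n j))) ⟩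
          b ^ c₁ * (b ^ s * (b ^ j * (b ^ j * (b ^ j * b ^ j))))
            ≡⟨ sym (join5 c₁ s j) ⟩
          b ^ (c₁ + (s + (j + (j + (j + j)))))
            ≡⟨ cong (b ^_) (trans (e₂ c₁ s) (cong (λ z → z + 13 * s) (sym s₀≡))) ⟩
          b ^ (s₀ + 13 * s)
            ≤⟨ ^-monoʳ-≤ b (≤-trans (+-monoˡ-≤ (13 * s) s₀≤s) (*-monoˡ-≤ s (≤-trans (n≤1+n 14) 15≤K))) ⟩
          b ^ (K * s)
            ≡⟨ sym (^-*-assoc b K s) ⟩
          X ^ s ∎
          where
          join : ∀ m n → b ^ (m + n) ≡ b ^ m * b ^ n
          join = ^-distribˡ-+-* b
          join5 : ∀ c s j → b ^ (c + (s + (j + (j + (j + j))))) ≡ b ^ c * (b ^ s * (b ^ j * (b ^ j * (b ^ j * b ^ j))))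
          join5 c s j = trans (join c _) (cong (b ^ c *_) (trans (join s _) (cong (b ^ s *_) (trans (join j _) (cong (b ^ j *_) (trans (join j _) (cong (b ^ j *_) (join j j))))))))

      -- The X^s saved by summing 1/p² over p ≥ X^s pays for `middle-arithmetic`. The bound s < m is
      -- what leaves 6(s + 1) of the 6m blocks for the two factors.
      middle-range : ∀ m s → s₀ ≤ s → s < m → 32 * ∑ (middlePrimes s) (count ε (6 * m)) * 2 ^ (s ∸ s₀) ≤ A * A * τ ^ (6 * m)
      middle-range m s s₀≤s s<m = *-cancelˡ-≤ (X ^ s) {{m^n≢0 X s}} (begin
        X ^ s * (32 * S * d)                          ≡⟨ e₁ (X ^ s) S d ⟩
        32 * (X ^ s * S) * d                          ≤⟨ *-monoˡ-≤ d (*-monoʳ-≤ 32 (∑-inverse-squares-tail (X ^ s) (X ^ suc s ∸ X ^ s) (count ε (6 * m)) (A * A * τ ^ r * V j) (2≤X^ s 1≤s) each)) ⟩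
        32 * (2 * (A * A * τ ^ r * V j)) * d          ≡⟨ e₂ (A * A) (τ ^ r) (V j) d ⟩
        A * A * τ ^ r * (64 * (V j * d))              ≤⟨ *-monoʳ-≤ (A * A * τ ^ r) (middle-arithmetic s s₀≤s) ⟩
        A * A * τ ^ r * (X ^ s * (τ ^ j * τ ^ j))     ≡⟨ e₃ (A * A) (τ ^ r) (X ^ s) (τ ^ j) ⟩
        X ^ s * (A * A * (τ ^ j * (τ ^ j * τ ^ r)))   ≡⟨ cong (λ z → X ^ s * (A * A * z)) (trans (cong (τ ^ j *_) (sym (^-distribˡ-+-* τ j r))) (sym (^-distribˡ-+-* τ j (j + r)))) ⟩
        X ^ s * (A * A * τ ^ (j + (j + r)))           ≡⟨ cong (λ z → X ^ s * (A * A * τ ^ z)) splitting ⟩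
        X ^ s * (A * A * τ ^ (6 * m))                 ∎)
        where
        open ≤-Reasoning
        j = 3 * suc s
        r = 6 * m ∸ 6 * suc s
        d = 2 ^ (s ∸ s₀)
        S = ∑ (middlePrimes s) (count ε (6 * m))
        e₁ : ∀ x s d → x * (32 * s * d) ≡ 32 * (x * s) * d
        e₁ = ℕSolver.solve-∀
        e₂ : ∀ a t v d → 32 * (2 * (a * t * v)) * d ≡ a * t * (64 * (v * d))
        e₂ = ℕSolver.solve-∀
        e₃ : ∀ a t x y → a * t * (x * (y * y)) ≡ x * (a * (y * (y * t)))
        e₃ = ℕSolver.solve-∀
        e₄ : ∀ s r → 3 * suc s + (3 * suc s + r) ≡ 6 * suc s + r
        e₄ = ℕSolver.solve-∀
        splitting : j + (j + r) ≡ 6 * m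
        splitting = trans (e₄ s r) (m+[n∸m]≡n (*-monoʳ-≤ 6 s<m))
        12≤s : 12 ≤ s
        12≤s = ≤-trans 12≤s₀ s₀≤s
        1≤s : 1 ≤ s
        1≤s = ≤-trans (s≤s z≤n) 12≤s
        4≤X^s : 2 < X ^ s
        4≤X^s = ≤-trans (s≤s (s≤s (s≤s z≤n))) (≤-trans (^-monoʳ-≤ 2 {2} {s} (≤-trans (s≤s (s≤s z≤n)) 12≤s)) (^-monoˡ-≤ s 2≤X))
        each : ∀ p → X ^ s ≤ p → p < X ^ s + (X ^ suc s ∸ X ^ s) → count ε (6 * m) p * (p * p) ≤ A * A * τ ^ r * V j
        each p l u = subst (λ k → count ε k p * (p * p) ≤ A * A * τ ^ r * V j) splitting
          (middle-prime s r p l (subst (p <_) (m+[n∸m]≡n (^-monoʳ-≤ X (n≤1+n s))) u) (≤-trans 4≤X^s l))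

      middle-total : ∀ m → 16 * ∑[ s ∈ interval s₀ (m ∸ s₀) ] ∑ (middlePrimes s) (count ε (6 * m)) ≤ A * A * τ ^ (6 * m)
      middle-total m = *-cancelˡ-≤ 2 (begin
        2 * (16 * ∑ I S)             ≡⟨ sym (*-assoc 2 16 (∑ I S)) ⟩
        32 * ∑ I S                   ≡⟨ sym (∑-*ˡ I 32 S) ⟩
        ∑[ s ∈ I ] (32 * S s)        ≤⟨ ∑-geometric s₀ (m ∸ s₀) (λ s → 32 * S s) (A * A * τ ^ (6 * m)) (λ s l u → middle-range m s l (below s l u)) ⟩
        2 * (A * A * τ ^ (6 * m))    ∎)
        where
        open ≤-Reasoning
        I = interval s₀ (m ∸ s₀)
        S : ℕ → ℕ
        S s = ∑ (middlePrimes s) (count ε (6 * m))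
        below : ∀ s → s₀ ≤ s → s < s₀ + (m ∸ s₀) → s < m
        below s l u with s₀ ≤? m
        ... | yes s₀≤m = ≤-trans u (≤-reflexive (m+[n∸m]≡n s₀≤m))
        ... | no m<s₀ = ⊥-elim (<-irrefl refl (<-≤-trans u (≤-trans (≤-reflexive (trans (cong (λ z → s₀ + z) (m≤n⇒m∸n≡0 (<⇒≤ (≰⇒> m<s₀)))) (+-identityʳ s₀))) l)))

-- Small primes, the third range, and the surviving matrices

module Selection where

  open Counting
  open Congruences
  open Divisors
  open Words
  open Blocks
  open Quadratics
  open LargePrimes
  open Families
  open import Data.Nat
  open import Data.Nat.Properties
  open import Data.Nat.Primality using (Prime; prime?)
  open import Data.Integer using (ℤ; +_; -[1+_])
  open import Data.Integer.Divisibility.Signed using (_∣_; divides; ∣m∣n⇒∣m+n; ∣n⇒∣m*n; ∣m∣n⇒∣m-n; ∣-trans; ∣ᵤ⇒∣; ∣⇒∣ᵤ)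

  normSq-≈ : ∀ {n} x y → x ≈ y [mod n ] → Congruent n (normSq x) (normSq y)
  normSq-≈ {n} (mat a b c d) (mat a′ b′ c′ d′) (congruent p q r s) =
    ∣-≡ (sym (trans (cong₂ ℤ._-_ (expand a b c d) (expand a′ b′ c′ d′)) (e (+ a) (+ b) (+ c) (+ d) (+ a′) (+ b′) (+ c′) (+ d′))))
      (∣m∣n⇒∣m+n (∣m∣n⇒∣m+n (∣m∣n⇒∣m+n (∣n⇒∣m*n (+ a ℤ.+ + a′) p) (∣n⇒∣m*n (+ b ℤ.+ + b′) q)) (∣n⇒∣m*n (+ c ℤ.+ + c′) r)) (∣n⇒∣m*n (+ d ℤ.+ + d′) s))
    where
    expand : ∀ a b c d → + (a * a + b * b + c * c + d * d) ≡ + a ℤ.* + a ℤ.+ + b ℤ.* + b ℤ.+ + c ℤ.* + c ℤ.+ + d ℤ.* + d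
    expand a b c d = cong₂ ℤ._+_ (cong₂ ℤ._+_ (cong₂ ℤ._+_ (pos-sq a) (pos-sq b)) (pos-sq c)) (pos-sq d)
    e : ∀ a b c d a′ b′ c′ d′ → (a ℤ.* a ℤ.+ b ℤ.* b ℤ.+ c ℤ.* c ℤ.+ d ℤ.* d) ℤ.- (a′ ℤ.* a′ ℤ.+ b′ ℤ.* b′ ℤ.+ c′ ℤ.* c′ ℤ.+ d′ ℤ.* d′) ≡
      (a ℤ.+ a′) ℤ.* (a ℤ.- a′) ℤ.+ (b ℤ.+ b′) ℤ.* (b ℤ.- b′) ℤ.+ (c ℤ.+ c′) ℤ.* (c ℤ.- c′) ℤ.+ (d ℤ.+ d′) ℤ.* (d ℤ.- d′)
    e = ℤSolver.solve-∀

  SL-normSq≥2 : ∀ g → IsSL g → 2 ≤ normSq g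
  SL-normSq≥2 (mat a b c d) sl = begin
    2                                    ≤⟨ *-monoʳ-≤ 2 (s≤s z≤n) ⟩
    2 * (1 + b * c)                      ≡⟨ cong (2 *_) (sym sl) ⟩
    2 * (a * d)                          ≤⟨ 2xy≤x²+y² a d ⟩
    a * a + d * d                        ≤⟨ m≤m+n _ (b * b + c * c) ⟩
    a * a + d * d + (b * b + c * c)      ≡⟨ e (a * a) (b * b) (c * c) (d * d) ⟩
    a * a + b * b + c * c + d * d        ∎
    where
    open ≤-Reasoning
    e : ∀ a b c d → a + d + (b + c) ≡ a + b + c + d
    e = ℕSolver.solve-∀

  module Select (q : ℕ) .{{_ : NonZero q}} (q-small : ∀ p → 2 ≤ p → p ≤ 192 → p * p ℕᵈ.∣ q)
      (q-large : ∀ p → Prime p → 192 < p → ¬ + p ∣ + q)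
      (K : ℕ) .{{_ : NonZero K}} (15≤K : 15 ≤ K) (𝔅 : Blocks q K) where

    open BlockPowers 𝔅
    open Family q q-large K 15≤K 𝔅

    opaque

      -- All leading digits are at most `amax`. The norm of a matrix is at most 3 · (3 · 2) · 2 = 36
      -- times amax⁴ X^(2r), and 36 < 7² makes the inequality for the ball strict.
      amax G : ℕ
      amax = suc (q * A)
      G = 7 * (amax * amax)

      amax≡ : amax ≡ suc (q * A)
      amax≡ = refl

      G≡ : G ≡ 7 * (amax * amax)
      G≡ = refl

    instance
      amax≢0 : NonZero amax
      amax≢0 = subst NonZero (sym amax≡) _
      G≢0 : NonZero G
      G≢0 = subst NonZero (sym G≡) (m*n≢0 7 (amax * amax) {{_}} {{m*n≢0 amax amax}})

    top≤amax : ∀ {x} → x < A → top x ≤ amax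
    top≤amax x<A = ≤-trans (s≤s (*-monoʳ-≤ q (<⇒≤ x<A))) (≤-reflexive (sym amax≡))

    bot≤amax : ∀ {y} → y ≤ A → bot y ≤ amax
    bot≤amax y≤A = ≤-trans (*-monoʳ-≤ q y≤A) (≤-trans (n≤1+n (q * A)) (≤-reflexive (sym amax≡)))

    module _ (r : ℕ) where

      word-digits : ∀ z → z ∈ indices r → All (λ a → 1 ≤ a × a ≤ amax + D) (word z)
      word-digits ((y , x) , w) z∈ = let ((1≤y , y≤A) , x<A , w∈) = ∈-indices r z∈ in
        (s≤s z≤n , ≤-trans (top≤amax x<A) (m≤m+n amax D)) ∷
        (≤-trans 1≤y (m≤n*m y q) , ≤-trans (bot≤amax y≤A) (m≤m+n amax D)) ∷
        All.map (λ (l , u) → l , ≤-trans u (m≤n+m D amax)) (pow-digits r w w∈)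

      matrix-SL : ∀ z → z ∈ indices r → IsSL (matrix z)
      matrix-SL z z∈ = SL-prodWord (suc (r * ℓ)) (word z) (index-length r z z∈)

      matrices : List Mat
      matrices = map matrix (indices r)

      indices-unique : Unique (indices r)
      indices-unique = Unique.cartesianProduct⁺ (Unique.cartesianProduct⁺ (Unique-interval 1 A) (Unique-interval 0 A)) (pow-unique r)

      matrix-injective : ∀ z z′ → z ∈ indices r → z′ ∈ indices r → matrix z ≡ matrix z′ → z ≡ z′
      matrix-injective z@((y , x) , w) z′@((y′ , x′) , w′) z∈ z′∈ e =
          let ew = prodWord-injective (word z) (word z′) (All.map proj₁ (word-digits z z∈)) (All.map proj₁ (word-digits z′ z′∈))
                     (trans (index-length r z z∈) (sym (index-length r z′ z′∈))) e
              (e₁ , e′) = ∷-injective ew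
              (e₂ , e₃) = ∷-injective e′
          in cong₂ _,_ (cong₂ _,_ (*-cancelˡ-≡ y y′ q e₂) (*-cancelˡ-≡ x x′ q (suc-injective e₁))) e₃

      matrices-unique : Unique matrices
      matrices-unique = Unique-map-∈ matrix (indices r) indices-unique matrix-injective

      matrix-norm : ∀ z → z ∈ indices r → normSq (matrix z) < (G * X ^ r) * (G * X ^ r)
      matrix-norm z@((y , x) , w) z∈ = begin-strict
        normSq (matrix z)
          ≡⟨ cong normSq (prodWord-++ (top x ∷ bot y ∷ []) w) ⟩
        normSq (wildMatrix x y · prodWord w)
          ≤⟨ normSq-· (wildMatrix x y) (prodWord w) ⟩
        normSq (wildMatrix x y) * normSq (prodWord w)
          ≤⟨ *-mono-≤ (≤-trans (normSq-· (M (top x)) (M (bot y) · I₂)) (*-mono-≤ (single (top x) (top≤amax (proj₁ (proj₂ facts)))) (≤-trans (normSq-· (M (bot y)) I₂) (*-monoˡ-≤ 2 (single (bot y) (bot≤amax (proj₂ (proj₁ facts)))))))) (pow-norms r w w∈) ⟩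
        3 * (amax * amax) * (3 * (amax * amax) * 2) * (2 * Z r)
          ≡⟨ e₁ (amax * amax) (Z r) ⟩
        36 * (amax * amax * (amax * amax) * Z r)
          <⟨ *-monoˡ-< (amax * amax * (amax * amax) * Z r) {{m*n≢0 (amax * amax * (amax * amax)) (Z r) {{m*n≢0 (amax * amax) (amax * amax) {{m*n≢0 amax amax}} {{m*n≢0 amax amax}}}} {{>-nonZero (1≤Z r)}}}} (m<m+n 36 {13} (s≤s z≤n)) ⟩
        49 * (amax * amax * (amax * amax) * Z r)
          ≡⟨ cong (λ v → 49 * (amax * amax * (amax * amax) * v)) (^-distribʳ-* X X r) ⟩
        49 * (amax * amax * (amax * amax) * (X ^ r * X ^ r))
          ≡⟨ trans (e₂ (amax * amax) (X ^ r)) (cong (λ g → (g * X ^ r) * (g * X ^ r)) (sym G≡)) ⟩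
        (G * X ^ r) * (G * X ^ r) ∎
        where
        open ≤-Reasoning
        facts = ∈-indices r z∈
        w∈ = proj₂ (proj₂ facts)
        single : ∀ a → a ≤ amax → normSq (M a) ≤ 3 * (amax * amax)
        single a l = ≤-trans (≤-reflexive (e₀ (a * a))) (≤-trans (+-monoˡ-≤ 2 (*-mono-≤ l l)) (≤-trans (+-monoʳ-≤ (amax * amax) (*-monoʳ-≤ 2 {1} {amax * amax} (*-mono-≤ (>-nonZero⁻¹ amax) (>-nonZero⁻¹ amax)))) (≤-reflexive (e₃ (amax * amax)))))
          where
          e₀ : ∀ s → s + 1 + 1 + 0 ≡ s + 2
          e₀ = ℕSolver.solve-∀
          e₃ : ∀ s → s + 2 * s ≡ 3 * s
          e₃ = ℕSolver.solve-∀
        e₁ : ∀ a z → 3 * a * (3 * a * 2) * (2 * z) ≡ 36 * (a * a * z)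
        e₁ = ℕSolver.solve-∀
        e₂ : ∀ a x → 49 * (a * a * (x * x)) ≡ (7 * a * x) * (7 * a * x)
        e₂ = ℕSolver.solve-∀

      -- Modulo q only the leading digits count, and M 1 · M 0 = (1 1; 0 1) has norm 3.
      matrix-residue : ∀ z → z ∈ indices r → Congruent q (normSq (matrix z)) 3
      matrix-residue z@((y , x) , w) z∈ = normSq-≈ (matrix z) (mat 1 1 0 1)
        (subst (λ g → g ≈ mat 1 1 0 1 [mod q ]) (sym (prodWord-++ (top x ∷ bot y ∷ []) w))
          (≈-·-cong (wildMatrix x y) {M 1 · (M 0 · I₂)} {prodWord w} {I₂}
            (≈-·-cong (M (top x)) {M 1} {M (bot y) · I₂} {M 0 · I₂} (digit (top x) 1 (divides (+ x) (e₁ (+ q) (+ x) (ℤ.pos-* q x))))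
              (≈-·-cong (M (bot y)) {M 0} {I₂} {I₂} (digit (bot y) 0 (divides (+ y) (e₂ (+ q) (+ y) (ℤ.pos-* q y)))) (≈-refl I₂)))
            (pow-residues r w (proj₂ (proj₂ (∈-indices r z∈))))))
        where
        digit : ∀ a c → Congruent q a c → M a ≈ M c [mod q ]
        digit a c h = congruent h (Congruent-refl 1) (Congruent-refl 1) (Congruent-refl 0)
        e₁ : ∀ Q Y {Z} → Z ≡ Q ℤ.* Y → (+ 1 ℤ.+ Z) ℤ.- + 1 ≡ Y ℤ.* Q
        e₁ Q Y refl = i Q Y
          where
          i : ∀ Q Y → (+ 1 ℤ.+ Q ℤ.* Y) ℤ.- + 1 ≡ Y ℤ.* Q
          i = ℤSolver.solve-∀
        e₂ : ∀ Q Y {Z} → Z ≡ Q ℤ.* Y → Z ℤ.- + 0 ≡ Y ℤ.* Q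
        e₂ Q Y refl = i Q Y
          where
          i : ∀ Q Y → Q ℤ.* Y ℤ.- + 0 ≡ Y ℤ.* Q
          i = ℤSolver.solve-∀

      -- As q is even and t ≡ 3 mod q, t is odd; the count of representations of t - 2 and t + 2 as
      -- sums of two squares relies on this.
      matrix-odd : ∀ z → z ∈ indices r → ∃ λ m → normSq (matrix z) ≡ 2 + m × 1 ≤ m × ¬ 2 ℕᵈ.∣ m
      matrix-odd z z∈ = normSq (matrix z) ∸ 2 , t≡ , n≢0⇒n>0 (λ e → odd (subst (2 ℕᵈ.∣_) (sym e) (ℕᵈ.divides 0 refl))) , odd
        where
        t≡ : normSq (matrix z) ≡ 2 + (normSq (matrix z) ∸ 2)
        t≡ = sym (m+[n∸m]≡n (SL-normSq≥2 (matrix z) (matrix-SL z z∈)))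
        odd : ¬ 2 ℕᵈ.∣ normSq (matrix z) ∸ 2
        odd h = 2∤3 (∣⇒∣ᵤ (∣-≡ (e (+ normSq (matrix z))) (∣m∣n⇒∣m-n 2∣t (∣-trans 2∣q (matrix-residue z z∈)))))
          where
          2∣t : + 2 ∣ + normSq (matrix z)
          2∣t = ∣ᵤ⇒∣ (subst (2 ℕᵈ.∣_) (sym t≡) (ℕᵈ.∣m∣n⇒∣m+n (ℕᵈ.divides 1 refl) h))
          2∣q : + 2 ∣ + q
          2∣q = ∣ᵤ⇒∣ (ℕᵈ.∣-trans (ℕᵈ.divides 2 refl) (q-small 2 ≤-refl (s≤s (s≤s z≤n))))
          e : ∀ t → t ℤ.- (t ℤ.- + 3) ≡ + 3
          e = ℤSolver.solve-∀
          2∤3 : ¬ 2 ℕᵈ.∣ 3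
          2∤3 (ℕᵈ.divides 0 ())
          2∤3 (ℕᵈ.divides 1 ())
          2∤3 (ℕᵈ.divides (suc (suc k)) ())

      small-primes : ∀ z → z ∈ indices r → ∀ p → 2 ≤ p → p ≤ 192 → ¬ p * p ℕᵈ.∣ disc (matrix z)
      small-primes z z∈ p 2≤p p≤ h = five p 2≤p (∣⇒∣ᵤ (∣-≡ (e (+ t)) (∣m∣n⇒∣m-n h′ (∣n⇒∣m*n (+ t ℤ.+ + 3) (∣-trans (∣ᵤ⇒∣ (q-small p 2≤p p≤)) (matrix-residue z z∈))))))
        where
        t = normSq (matrix z)
        4≤tt : 4 ≤ t * t
        4≤tt = *-mono-≤ (SL-normSq≥2 (matrix z) (matrix-SL z z∈)) (SL-normSq≥2 (matrix z) (matrix-SL z z∈))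
        h′ : + (p * p) ∣ + t ℤ.* + t ℤ.- + 4
        h′ = ∣-≡ (trans (sym (trans (ℤ.m-n≡m⊖n (t * t) 4) (ℤ.⊖-≥ 4≤tt))) (cong (λ v → v ℤ.- + 4) (ℤ.pos-* t t))) (∣ᵤ⇒∣ h)
        e : ∀ t → (t ℤ.* t ℤ.- + 4) ℤ.- (t ℤ.+ + 3) ℤ.* (t ℤ.- + 3) ≡ + 5
        e = ℤSolver.solve-∀
        five : ∀ p → 2 ≤ p → ¬ p * p ℕᵈ.∣ 5
        five 1 (s≤s ()) _
        five 2 _ (ℕᵈ.divides 0 ())
        five 2 _ (ℕᵈ.divides 1 ())
        five 2 _ (ℕᵈ.divides (suc (suc k)) ())
        five (suc (suc (suc p))) _ d = <⇒≱ (≤-trans (s≤s (s≤s (s≤s (s≤s (s≤s (s≤s z≤n)))))) (*-mono-≤ {3} {3 + p} {3} {3 + p} (s≤s (s≤s (s≤s z≤n))) (s≤s (s≤s (s≤s z≤n))))) (ℕᵈ.∣⇒≤ d)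

      -- With t = 2 + m the number is m (4 + m). A prime s > 192 does not divide both factors, so s²
      -- divides one of them, which makes s bad for one sign. Then s² ≤ t + 2 ≤ N² + 1, hence s ≤ N,
      -- and finitely many primes are to be excluded.
      squareFree : ∀ N z → z ∈ indices r → normSq (matrix z) < N * N →
        (∀ ε p → ε ≡ + 1 ⊎ ε ≡ -[1+ 0 ] → 192 < p → p ≤ N → ¬ Bad ε p (matrix z)) → SquareFree (disc (matrix z))
      squareFree N z z∈ t<NN none p pp∣ with p ≟ 1
      ... | yes e = e
      ... | no p≢1 = ⊥-elim (main p p≢1 pp∣)
        where
        t = normSq (matrix z)
        m = proj₁ (matrix-odd z z∈)
        t≡ = proj₁ (proj₂ (matrix-odd z z∈))
        1≤m = proj₁ (proj₂ (proj₂ (matrix-odd z z∈)))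
        disc≡ : disc (matrix z) ≡ (4 + m) * m
        disc≡ = trans (cong (λ v → v * v ∸ 4) t≡) (trans (cong (_∸ 4) (e m)) (m+n∸n≡m ((4 + m) * m) 4))
          where
          e : ∀ m → (2 + m) * (2 + m) ≡ (4 + m) * m + 4
          e = ℕSolver.solve-∀
        instance
          m≢0 : NonZero m
          m≢0 = >-nonZero 1≤m
        bounded : ∀ p k → p * p ℕᵈ.∣ k → 1 ≤ k → k ≤ 4 + m → p ≤ N
        bounded p k d 1≤k k≤ with p ≤? N
        ... | yes l = l
        ... | no g = ⊥-elim (<-irrefl refl (begin-strict
            N * N + 1           <⟨ n<1+n _ ⟩
            suc (N * N + 1)     ≡⟨ e₁ (N * N) ⟩
            2 + N * N           ≤⟨ wide N t<NN ⟩
            suc N * suc N       ≤⟨ *-mono-≤ (≰⇒> g) (≰⇒> g) ⟩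
            p * p               ≤⟨ ℕᵈ.∣⇒≤ {{>-nonZero 1≤k}} d ⟩
            k                   ≤⟨ k≤ ⟩
            2 + (2 + m)         ≡⟨ cong (λ v → 2 + v) (sym t≡) ⟩
            2 + t               ≤⟨ +-monoʳ-≤ 1 t<NN ⟩
            1 + N * N           ≡⟨ +-comm 1 (N * N) ⟩
            N * N + 1           ∎))
          where
          open ≤-Reasoning
          e₁ : ∀ x → suc (x + 1) ≡ 2 + x
          e₁ = ℕSolver.solve-∀
          wide : ∀ N → t < N * N → 2 + N * N ≤ suc N * suc N
          wide zero ()
          wide (suc N) _ = ≤-trans (m≤m+n _ (1 + 2 * N)) (≤-reflexive (e₂ N))
            where
            e₂ : ∀ N → 2 + suc N * suc N + (1 + 2 * N) ≡ suc (suc N) * suc (suc N)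
            e₂ = ℕSolver.solve-∀
        main : ∀ p → ¬ p ≡ 1 → p * p ℕᵈ.∣ disc (matrix z) → ⊥
        main zero _ h = <-irrefl (sym (trans (sym disc≡) (ℕᵈ.0∣⇒≡0 h))) (*-mono-≤ {1} {4 + m} {1} {m} (s≤s z≤n) 1≤m)
        main 1 ne _ = ne refl
        main p@(suc (suc _)) _ h with prime-divisor p (s≤s (s≤s z≤n))
        ... | s , sp , s∣p with s ≤? 192
        ... | yes s≤ = small-primes z z∈ s (2≤prime sp) s≤ (ℕᵈ.∣-trans (ℕᵈ.*-pres-∣ s∣p s∣p) h)
        ... | no s≰ with s ℕᵈ.∣? 4 + m
        ... | no s∤ = none (+ 1) s (inj₁ refl) (≰⇒> s≰) (bounded s m ss∣m 1≤m (m≤n+m m 4)) (sp , ∣-≡ eq (∣ᵤ⇒∣ {+ (s * s)} {+ m} ss∣m))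
          where
          ss∣m : s * s ℕᵈ.∣ m
          ss∣m = ∣⇒∣ᵤ (PrimeModulus.cancel-unit sp (+ (4 + m)) (+ m) (λ d → s∤ (∣⇒∣ᵤ d))
            (∣-≡ (ℤ.pos-* (4 + m) m) (∣ᵤ⇒∣ {+ (s * s)} {+ ((4 + m) * m)} (subst (s * s ℕᵈ.∣_) disc≡ (ℕᵈ.∣-trans (ℕᵈ.*-pres-∣ s∣p s∣p) h)))))
          eq : + m ≡ + t ℤ.- + 2 ℤ.* + 1
          eq = trans (i (+ m)) (cong (λ v → + v ℤ.- + 2 ℤ.* + 1) (sym t≡))
            where
            i : ∀ m → m ≡ (+ 2 ℤ.+ m) ℤ.- + 2 ℤ.* + 1
            i = ℤSolver.solve-∀
        ... | yes s∣ = none -[1+ 0 ] s (inj₂ refl) (≰⇒> s≰) (bounded s (4 + m) ss∣ (s≤s z≤n) ≤-refl) (sp , ∣-≡ eq (∣ᵤ⇒∣ {+ (s * s)} {+ (4 + m)} ss∣))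
          where
          s∤m : ¬ s ℕᵈ.∣ m
          s∤m d = s≰ (≤-trans (ℕᵈ.∣⇒≤ (ℕᵈ.∣m+n∣m⇒∣n (subst (s ℕᵈ.∣_) (+-comm 4 m) s∣) d)) (s≤s (s≤s (s≤s (s≤s z≤n)))))
          ss∣ : s * s ℕᵈ.∣ 4 + m
          ss∣ = ∣⇒∣ᵤ (PrimeModulus.cancel-unit sp (+ m) (+ (4 + m)) (λ d → s∤m (∣⇒∣ᵤ d))
            (∣-≡ (trans (cong +_ (*-comm (4 + m) m)) (ℤ.pos-* m (4 + m))) (∣ᵤ⇒∣ {+ (s * s)} {+ ((4 + m) * m)} (subst (s * s ℕᵈ.∣_) disc≡ (ℕᵈ.∣-trans (ℕᵈ.*-pres-∣ s∣p s∣p) h)))))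
          eq : + (4 + m) ≡ + t ℤ.- + 2 ℤ.* -[1+ 0 ]
          eq = trans (i (+ m)) (cong (λ v → + v ℤ.- + 2 ℤ.* -[1+ 0 ]) (sym t≡))
            where
            i : ∀ m → + 4 ℤ.+ m ≡ (+ 2 ℤ.+ m) ℤ.- (+ 2 ℤ.* -[1+ 0 ])
            i = ℤSolver.solve-∀

    opaque

      -- V₀ X^(12 m) bounds 3 N² and so all numbers whose divisors are counted. C₃ gathers the
      -- constants of the large range; m ≥ m₀ ≥ C₃ lets one factor b^m absorb them, and m₀ ≥ s₀
      -- makes the ranges of primes adjoin.
      G₁₂ V₀ C₂ C₃ m₀ : ℕ
      G₁₂ = proj₁ (divisors≤ 12)
      V₀ = 3 * (G * G) * X ^ 12
      C₂ = G₁₂ * V₀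
      C₃ = 1024 * (C₂ * C₂ * (C₂ * C₂)) * (G * G * X ^ 12)
      m₀ = C₃ + s₀

      divisors≤₁₂ : ∀ i k → 1 ≤ k → k ≤ V₀ * X ^ (12 * i) → #divisors k ≤ C₂ * b ^ i
      divisors≤₁₂ i k = proj₂ (divisors≤ 12) i V₀ k

      V₀≡ : V₀ ≡ 3 * (G * G) * X ^ 12
      V₀≡ = refl

      C₃≡ : C₃ ≡ 1024 * (C₂ * C₂ * (C₂ * C₂)) * (G * G * X ^ 12)
      C₃≡ = refl

      m₀≡ : m₀ ≡ C₃ + s₀
      m₀≡ = refl

    module _ (m N : ℕ) (m₀≤m : m₀ ≤ m) (lower : G * X ^ (6 * m) ≤ N) (upper : N < G * X ^ (6 * suc m)) where

      private
        r = 6 * m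

        s₀≤m : s₀ ≤ m
        s₀≤m = ≤-trans (≤-trans (m≤n+m s₀ C₃) (≤-reflexive (sym m₀≡))) m₀≤m

        1≤G : 1 ≤ G
        1≤G = >-nonZero⁻¹ G

        X^m≤N : X ^ m ≤ N
        X^m≤N = begin
          X ^ m              ≤⟨ ^-monoʳ-≤ X (m≤n*m m 6) ⟩
          X ^ (6 * m)        ≡⟨ sym (*-identityˡ _) ⟩
          1 * X ^ (6 * m)    ≤⟨ *-monoˡ-≤ (X ^ (6 * m)) 1≤G ⟩
          G * X ^ (6 * m)    ≤⟨ lower ⟩
          N                  ∎
          where open ≤-Reasoning

        1≤N : 1 ≤ N
        1≤N = ≤-trans (m^n>0 X m) X^m≤N

        NN≤ : N * N ≤ G * G * X ^ 12 * X ^ (12 * m)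
        NN≤ = begin
          N * N                                             ≤⟨ *-mono-≤ (<⇒≤ upper) (<⇒≤ upper) ⟩
          G * X ^ (6 * suc m) * (G * X ^ (6 * suc m))       ≡⟨ [m*n]*[o*p]≡[m*o]*[n*p] G (X ^ (6 * suc m)) G (X ^ (6 * suc m)) ⟩
          G * G * (X ^ (6 * suc m) * X ^ (6 * suc m))       ≡⟨ cong (G * G *_) (trans (sym (^-distribˡ-+-* X (6 * suc m) (6 * suc m))) (trans (cong (X ^_) (e m)) (^-distribˡ-+-* X 12 (12 * m)))) ⟩
          G * G * (X ^ 12 * X ^ (12 * m))                   ≡⟨ sym (*-assoc (G * G) (X ^ 12) (X ^ (12 * m))) ⟩
          G * G * X ^ 12 * X ^ (12 * m)                     ∎
          where
          open ≤-Reasoning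
          e : ∀ m → 6 * suc m + 6 * suc m ≡ 12 + 12 * m
          e = ℕSolver.solve-∀

        Δ : ℕ
        Δ = C₂ * b ^ m

        Δ-bound : ∀ k → 1 ≤ k → k ≤ 2 + N * N → #divisors k ≤ Δ
        Δ-bound k 1≤k k≤ = divisors≤₁₂ m k 1≤k (begin
          k                                          ≤⟨ k≤ ⟩
          2 + N * N                                  ≤⟨ +-monoˡ-≤ (N * N) (*-monoʳ-≤ 2 (*-mono-≤ 1≤N 1≤N)) ⟩
          2 * (N * N) + N * N                        ≡⟨ e₁ (N * N) ⟩
          3 * (N * N)                                ≤⟨ *-monoʳ-≤ 3 NN≤ ⟩
          3 * (G * G * X ^ 12 * X ^ (12 * m))        ≡⟨ trans (e₂ (G * G) (X ^ 12) (X ^ (12 * m))) (cong (_* X ^ (12 * m)) (sym V₀≡)) ⟩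
          V₀ * X ^ (12 * m)                          ∎)
          where
          open ≤-Reasoning
          e₁ : ∀ x → 2 * x + x ≡ 3 * x
          e₁ = ℕSolver.solve-∀
          e₂ : ∀ g x y → 3 * (g * x * y) ≡ 3 * g * x * y
          e₂ = ℕSolver.solve-∀

        largePrimes : List ℕ
        largePrimes = interval (X ^ m) (suc N ∸ X ^ m)

        in-ball : ∀ z → z ∈ indices r → normSq (matrix z) < N * N
        in-ball z z∈ = <-≤-trans (matrix-norm r z z∈) (*-mono-≤ lower lower)

        large-prime : ∀ ε p → p ≤ N → count ε r p * (p * p) ≤ 2 * (N * N) * (16 * (Δ * Δ * (Δ * Δ)))
        large-prime ε p p≤N with prime? p
        ... | no ¬pp = ≤-trans (≤-reflexive (cong (_* (p * p)) (count-none (λ z → bad? ε p (matrix z)) (indices r) λ _ _ (pp , _) → ¬pp pp))) z≤n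
        ... | yes pp = begin
          count ε r p * (p * p)
            ≡⟨ cong (_* (p * p)) (sym (∑-map (indices r) matrix (λ g → 𝟙 (bad? ε p g)))) ⟩
          (∑[ g ∈ matrices r ] 𝟙 (bad? ε p g)) * (p * p)
            ≤⟨ large-count ε p (N * N) Δ pp Δ-bound (matrices r) (matrices-unique r) facts ⟩
          (N * N + p * p) * (16 * (Δ * Δ * (Δ * Δ)))
            ≤⟨ *-monoˡ-≤ (16 * (Δ * Δ * (Δ * Δ))) (+-monoʳ-≤ (N * N) (≤-trans (*-mono-≤ p≤N p≤N) (≤-reflexive (sym (+-identityʳ (N * N)))))) ⟩
          2 * (N * N) * (16 * (Δ * Δ * (Δ * Δ))) ∎
          where
          open ≤-Reasoning
          facts : ∀ g → g ∈ matrices r → IsSL g × normSq g ≤ N * N × ∃ λ m → normSq g ≡ 2 + m × 1 ≤ m × ¬ 2 ℕᵈ.∣ m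
          facts g g∈ with ∈-map⁻ matrix g∈
          ... | z , z∈ , refl = matrix-SL r z z∈ , <⇒≤ (in-ball z z∈) , matrix-odd r z z∈

        -- The sum is about N² Δ⁴ / X^m. The loss is b^(4m) from the divisor bounds, b^m for the
        -- constants and b^(6m) because τ^(6m) = X^(12m) / b^(6m) is what it is compared with,
        -- altogether b^(11m) ≤ X^m.
        large-total : ∀ ε → 16 * ∑ largePrimes (count ε r) ≤ A * A * τ ^ r
        large-total ε = *-cancelˡ-≤ (X ^ m) {{m^n≢0 X m}} (begin
          X ^ m * (16 * S)
            ≡⟨ e₁ (X ^ m) S ⟩
          16 * (X ^ m * S)
            ≤⟨ *-monoʳ-≤ 16 (∑-inverse-squares-tail (X ^ m) (suc N ∸ X ^ m) (count ε r) _ (2≤X^ m 1≤m) λ p _ u → large-prime ε p (s≤s⁻¹ (subst (p <_) (m+[n∸m]≡n (≤-trans X^m≤N (n≤1+n N))) u))) ⟩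
          16 * (2 * (2 * (N * N) * (16 * (Δ * Δ * (Δ * Δ)))))
            ≡⟨ e₂ (N * N) C₂ (b ^ m) ⟩
          1024 * (C₂ * C₂ * (C₂ * C₂)) * (N * N) * (b ^ m * (b ^ m * (b ^ m * b ^ m)))
            ≤⟨ *-monoˡ-≤ _ (*-monoʳ-≤ (1024 * (C₂ * C₂ * (C₂ * C₂))) NN≤) ⟩
          1024 * (C₂ * C₂ * (C₂ * C₂)) * (G * G * X ^ 12 * X ^ (12 * m)) * (b ^ m * (b ^ m * (b ^ m * b ^ m)))
            ≡⟨ trans (e₃ (1024 * (C₂ * C₂ * (C₂ * C₂))) (G * G * X ^ 12) (X ^ (12 * m)) (b ^ m * (b ^ m * (b ^ m * b ^ m)))) (cong (λ z → z * (b ^ m * (b ^ m * (b ^ m * b ^ m))) * X ^ (12 * m)) (sym C₃≡)) ⟩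
          C₃ * (b ^ m * (b ^ m * (b ^ m * b ^ m))) * X ^ (12 * m)
            ≤⟨ *-monoˡ-≤ (X ^ (12 * m)) (*-monoˡ-≤ _ (≤-trans (≤-trans (≤-trans (m≤m+n C₃ s₀) (≤-reflexive (sym m₀≡))) m₀≤m) (<⇒≤ (n<b^n m)))) ⟩
          b ^ m * (b ^ m * (b ^ m * (b ^ m * b ^ m))) * X ^ (12 * m)
            ≡⟨ cong₂ _*_ (sym (join m)) X^12m ⟩
          b ^ (5 * m) * (b ^ (6 * m) * τ ^ r)
            ≡⟨ trans (sym (*-assoc (b ^ (5 * m)) (b ^ (6 * m)) (τ ^ r))) (cong (_* τ ^ r) (sym (^-distribˡ-+-* b (5 * m) (6 * m)))) ⟩
          b ^ (5 * m + 6 * m) * τ ^ r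
            ≤⟨ *-monoˡ-≤ (τ ^ r) (^-monoʳ-≤ b (≤-trans (≤-reflexive (sym (*-distribʳ-+ m 5 6))) (*-monoˡ-≤ m (≤-trans (m≤m+n 11 4) 15≤K)))) ⟩
          b ^ (K * m) * τ ^ r
            ≡⟨ cong (_* τ ^ r) (sym (^-*-assoc b K m)) ⟩
          X ^ m * τ ^ r
            ≤⟨ *-monoʳ-≤ (X ^ m) (≤-trans (≤-reflexive (sym (*-identityˡ (τ ^ r)))) (*-monoˡ-≤ (τ ^ r) {1} {A * A} (*-mono-≤ (>-nonZero⁻¹ A) (>-nonZero⁻¹ A)))) ⟩
          X ^ m * (A * A * τ ^ r) ∎)
          where
          open ≤-Reasoning
          S = ∑ largePrimes (count ε r)
          1≤m : 1 ≤ m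
          1≤m = ≤-trans (≤-trans (s≤s z≤n) 12≤s₀) s₀≤m
          e₁ : ∀ x s → x * (16 * s) ≡ 16 * (x * s)
          e₁ = ℕSolver.solve-∀
          e₂ : ∀ n c b → 16 * (2 * (2 * n * (16 * (c * b * (c * b) * (c * b * (c * b)))))) ≡ 1024 * (c * c * (c * c)) * n * (b * (b * (b * b)))
          e₂ = ℕSolver.solve-∀
          e₃ : ∀ a g x y → a * (g * x) * y ≡ a * g * y * x
          e₃ = ℕSolver.solve-∀
          join : ∀ m → b ^ (5 * m) ≡ b ^ m * (b ^ m * (b ^ m * (b ^ m * b ^ m)))
          join m = trans (cong (b ^_) (i m)) (trans (d m _) (cong (b ^ m *_) (trans (d m _) (cong (b ^ m *_) (trans (d m _) (cong (b ^ m *_) (d m m)))))))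
            where
            d = ^-distribˡ-+-* b
            i : ∀ m → 5 * m ≡ m + (m + (m + (m + m)))
            i = ℕSolver.solve-∀
          X^12m : X ^ (12 * m) ≡ b ^ (6 * m) * τ ^ r
          X^12m = trans (cong (X ^_) (i m)) (trans (^-distribˡ-+-* X (6 * m) (6 * m)) (trans (sym (^-distribʳ-* X X (6 * m))) (Z≡ (6 * m))))
            where
            i : ∀ m → 12 * m ≡ 6 * m + 6 * m
            i = ℕSolver.solve-∀

        middles : List ℕ
        middles = interval s₀ (m ∸ s₀)

        obstructions : ℤ → Index → ℕ
        obstructions ε z = ∑[ p ∈ wildPrimes ] 𝟙 (bad? ε p (matrix z)) +
          (∑[ s ∈ middles ] ∑[ p ∈ middlePrimes s ] 𝟙 (bad? ε p (matrix z)) + ∑[ p ∈ largePrimes ] 𝟙 (bad? ε p (matrix z)))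

        obstructions-total : ∀ ε → ε ℤ.* ε ≡ + 1 → 16 * ∑ (indices r) (obstructions ε) ≤ 3 * (A * A * τ ^ r)
        obstructions-total ε εε = begin
          16 * ∑ L (obstructions ε)
            ≡⟨ cong (16 *_) (trans (∑-+ L _ _) (cong₂ _+_ (∑-swap L wildPrimes _) (trans (∑-+ L _ _)
                 (cong₂ _+_ (trans (∑-swap L middles _) (∑-cong middles λ s → ∑-swap L (middlePrimes s) _)) (∑-swap L largePrimes _))))) ⟩
          16 * (a + (c + d))
            ≡⟨ e a c d ⟩
          16 * a + (16 * c + (16 * d + 0))
            ≤⟨ +-mono-≤ (Sign.wild-total ε εε r) (+-mono-≤ (Sign.middle-total ε εε m) (+-monoˡ-≤ 0 (large-total ε))) ⟩
          3 * (A * A * τ ^ r) ∎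
          where
          open ≤-Reasoning
          L = indices r
          a = ∑ wildPrimes (count ε r)
          c = ∑[ s ∈ middles ] ∑ (middlePrimes s) (count ε r)
          d = ∑ largePrimes (count ε r)
          e : ∀ a c d → 16 * (a + (c + d)) ≡ 16 * a + (16 * c + (16 * d + 0))
          e = ℕSolver.solve-∀

        locate : ∀ p k → X ^ s₀ ≤ p → p < X ^ (s₀ + k) → ∃ λ s → s₀ ≤ s × s < s₀ + k × X ^ s ≤ p × p < X ^ suc s
        locate p zero l u = ⊥-elim (<-irrefl refl (<-≤-trans u (≤-trans (≤-reflexive (cong (X ^_) (+-identityʳ s₀))) l)))
        locate p (suc k) l u with X ^ (s₀ + k) ≤? p
        ... | yes l′ = s₀ + k , m≤m+n s₀ k , ≤-reflexive (sym (+-suc s₀ k)) , l′ , subst (λ v → p < X ^ v) (+-suc s₀ k) u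
        ... | no g = let (s , a , c , d , e) = locate p k l (≰⇒> g) in s , a , ≤-trans c (+-monoʳ-≤ s₀ (n≤1+n k)) , d , e

        unobstructed : ∀ ε z → obstructions ε z ≡ 0 → ∀ p → 192 < p → p ≤ N → ¬ Bad ε p (matrix z)
        unobstructed ε z none p 192<p p≤N bad = range (p <? X ^ s₀) (p <? X ^ m)
          where
          contra : ∀ {x} → x ≡ 0 → 𝟙 (bad? ε p (matrix z)) ≤ x → ⊥
          contra refl h = <-irrefl refl (≤-trans (≤-reflexive (sym (𝟙-yes (bad? ε p (matrix z)) bad))) h)
          rest = m+n≡0⇒n≡0 (∑[ p ∈ wildPrimes ] 𝟙 (bad? ε p (matrix z))) none
          range : Dec (p < X ^ s₀) → Dec (p < X ^ m) → ⊥
          range (yes p<) _ = contra (m+n≡0⇒m≡0 _ none)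
            (∑-term wildPrimes _ (∈-interval⁺ 193 (X ^ s₀ ∸ 193) 192<p (≤-trans p< (m≤n+m∸n (X ^ s₀) 193))))
          range (no p≥) (yes p<) =
            let (s , l , u , l′ , u′) = locate p (m ∸ s₀) (≮⇒≥ p≥) (subst (λ v → p < X ^ v) (sym (m+[n∸m]≡n s₀≤m)) p<) in
            contra (m+n≡0⇒m≡0 _ rest)
              (≤-trans (∑-term (middlePrimes s) _ (∈-interval⁺ (X ^ s) _ l′ (≤-trans u′ (m≤n+m∸n (X ^ suc s) (X ^ s)))))
                (∑-term middles (λ s → ∑[ p ∈ middlePrimes s ] 𝟙 (bad? ε p (matrix z))) (∈-interval⁺ s₀ (m ∸ s₀) l u)))
          range (no _) (no p≥) = contra (m+n≡0⇒n≡0 (∑[ s ∈ middles ] ∑[ p ∈ middlePrimes s ] 𝟙 (bad? ε p (matrix z))) rest)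
            (∑-term largePrimes _ (∈-interval⁺ (X ^ m) _ (≮⇒≥ p≥) (≤-trans (s≤s p≤N) (m≤n+m∸n (suc N) (X ^ m)))))

        both : Index → ℕ
        both z = obstructions (+ 1) z + obstructions -[1+ 0 ] z

        clear? : ∀ z → Dec (both z ≡ 0)
        clear? z = both z ≟ 0

        selected : List Index
        selected = filter clear? (indices r)

        -- A union bound: an index is lost only if it has an obstruction, and the two signs have at
        -- most 3/16 each per index on average. So 10/16 of the indices remain, of which 8/16 are
        -- claimed.
        selected-many : A * A * τ ^ r ≤ 2 * length selected
        selected-many = *-cancelˡ-≤ 8 (+-cancelʳ-≤ (6 * W) (8 * W) _ (≤-trans (+-monoˡ-≤ (6 * W) (*-monoˡ-≤ W (m≤m+n 8 2))) (begin
          10 * W + 6 * W                                            ≡⟨ sym (*-distribʳ-+ W 10 6) ⟩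
          16 * W                                                    ≡⟨ cong (16 *_) (trans (sym (length-indices r)) (trans (sym (*-identityʳ _)) (sym (∑-const L 1)))) ⟩
          16 * ∑[ z ∈ L ] 1                                         ≤⟨ *-monoʳ-≤ 16 (∑-mono L one) ⟩
          16 * ∑[ z ∈ L ] (𝟙 (clear? z) + both z)                   ≡⟨ cong (16 *_) (trans (∑-+ L _ _) (cong₂ _+_ (sym (length-filter clear? L)) (∑-+ L _ _))) ⟩
          16 * (length selected + (o₊ + o₋))                        ≡⟨ e₁ (length selected) o₊ o₋ ⟩
          8 * (2 * length selected) + (16 * o₊ + 16 * o₋)           ≤⟨ +-monoʳ-≤ (8 * (2 * length selected)) (+-mono-≤ (obstructions-total (+ 1) refl) (obstructions-total -[1+ 0 ] refl)) ⟩
          8 * (2 * length selected) + (3 * W + 3 * W)               ≡⟨ cong (λ v → 8 * (2 * length selected) + v) (sym (*-distribʳ-+ W 3 3)) ⟩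
          8 * (2 * length selected) + 6 * W                         ∎)))
          where
          open ≤-Reasoning
          L = indices r
          W = A * A * τ ^ r
          o₊ = ∑ L (obstructions (+ 1))
          o₋ = ∑ L (obstructions -[1+ 0 ])
          e₁ : ∀ l a c → 16 * (l + (a + c)) ≡ 8 * (2 * l) + (16 * a + 16 * c)
          e₁ = ℕSolver.solve-∀
          one : ∀ z → 1 ≤ 𝟙 (clear? z) + both z
          one z with both z
          ... | zero = s≤s z≤n
          ... | suc _ = s≤s z≤n

      selection : Σ (List Mat) λ L → Unique L × All (λ γ → InΓ (amax + D) γ × InB N γ × SquareFree (disc γ)) L × A * A * τ ^ (6 * m) ≤ 2 * length L
      selection = map matrix selected , unique-map , All.tabulate good , ≤-trans selected-many (≤-reflexive (cong (2 *_) (sym (length-map matrix selected))))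
        where
        mem : ∀ {z} → z ∈ selected → z ∈ indices r × both z ≡ 0
        mem z∈ = ∈-filter⁻ clear? {xs = indices r} z∈
        unique-map : Unique (map matrix selected)
        unique-map = Unique-map-∈ matrix selected (Unique.filter⁺ clear? (indices-unique r))
          λ z z′ z∈ z′∈ → matrix-injective r z z′ (proj₁ (mem z∈)) (proj₁ (mem z′∈))
        good : ∀ {γ} → γ ∈ map matrix selected → InΓ (amax + D) γ × InB N γ × SquareFree (disc γ)
        good γ∈ with ∈-map⁻ matrix γ∈
        ... | z , z∈ , refl = let (z∈I , e) = mem z∈ in
          (word z , word-digits r z z∈I , (r * ℓ , index-length r z z∈I) , refl) , in-ball z z∈I ,
          squareFree r N z z∈I (in-ball z z∈I) λ where
            ε p (inj₁ refl) l u → unobstructed (+ 1) z (m+n≡0⇒m≡0 _ e) p l u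
            ε p (inj₂ refl) l u → unobstructed -[1+ 0 ] z (m+n≡0⇒n≡0 (obstructions (+ 1) z) e) p l u

-- Choice of the modulus and translation into powers of N

module Final where

  open Divisors using (n<2^n; ^-distribʳ-*)
  open Blocks
  open Construction
  open Families
  open Selection
  open import Data.Nat
  open import Data.Nat.Properties
  open import Data.Nat.Primality using (Prime; euclidsLemma; ¬prime[1])
  open import Data.Integer using (+_)
  open import Data.Integer.Divisibility.Signed using (_∣_; ∣⇒∣ᵤ)

  prime∣!⇒≤ : ∀ {p} n → Prime p → p ℕᵈ.∣ n ! → p ≤ n
  prime∣!⇒≤ zero pp h with ℕᵈ.∣1⇒≡1 h
  ... | refl = ⊥-elim (¬prime[1] pp)
  prime∣!⇒≤ (suc n) pp h with euclidsLemma (suc n) (n !) pp h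
  ... | inj₁ d = ℕᵈ.∣⇒≤ d
  ... | inj₂ d = ≤-trans (prime∣!⇒≤ n pp d) (n≤1+n n)

  -- `small` removes the primes up to P by the residue of t. `large` is needed because the leading
  -- digits move in steps of q, which must be invertible modulo every other prime.
  record SieveModulus (P : ℕ) : Set where
    field
      q : ℕ
      q≢0 : NonZero q
      small : ∀ p → 2 ≤ p → p ≤ P → p * p ℕᵈ.∣ q
      large : ∀ p → Prime p → P < p → ¬ + p ∣ + q

  opaque
    sieveModulus : ∀ P → SieveModulus P
    sieveModulus P = record
      { q = P ! * P !
      ; q≢0 = m*n≢0 (P !) (P !) {{P !≢0}} {{P !≢0}}
      ; small = λ { (suc p) _ l → ℕᵈ.*-pres-∣ (factor p l) (factor p l) }
      ; large = λ p pp P<p h → <⇒≱ P<p (either p pp (euclidsLemma (P !) (P !) pp (∣⇒∣ᵤ h))) }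
      where
      factor : ∀ p → suc p ≤ P → suc p ℕᵈ.∣ P !
      factor p l = ℕᵈ.∣-trans (ℕᵈ.m∣m*n {suc p} (p !)) (ℕᵈ.m≤n⇒m!∣n! l)
      either : ∀ p → Prime p → p ℕᵈ.∣ P ! ⊎ p ℕᵈ.∣ P ! → p ≤ P
      either p pp (inj₁ d) = prime∣!⇒≤ P pp d
      either p pp (inj₂ d) = prime∣!⇒≤ P pp d

  bracket : ∀ (f : ℕ → ℕ) N m n → f m ≤ N → N < f (m + n) → ∃ λ k → m ≤ k × f k ≤ N × N < f (suc k)
  bracket f N m zero l u = ⊥-elim (<-irrefl refl (<-≤-trans u (≤-trans (≤-reflexive (cong f (+-identityʳ m))) l)))
  bracket f N m (suc n) l u with f (m + n) ≤? N
  ... | yes l′ = m + n , m≤m+n m n , l′ , subst (λ v → N < f v) (+-suc m n) u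
  ... | no g = bracket f N m n l (≰⇒> g)

  module Conclusion (sm : SieveModulus 192) (p q : ℕ) (𝔅 : Blocks (SieveModulus.q sm) (15 + suc q)) where

    private
      Q K : ℕ
      Q = suc q
      K = 15 + Q
      instance
        modulus≢0 : NonZero (SieveModulus.q sm)
        modulus≢0 = SieveModulus.q≢0 sm

    open BlockPowers 𝔅
    open Family (SieveModulus.q sm) (SieveModulus.large sm) K (m≤m+n 15 Q) 𝔅
    open Select (SieveModulus.q sm) (SieveModulus.small sm) (SieveModulus.large sm) K (m≤m+n 15 Q) 𝔅

    private
      C₄ : ℕ
      C₄ = G * X ^ 6

      -- X² = b τ and b^Q ≤ b^K = X.
      X^≤τ^ : X ^ (Q + q) ≤ τ ^ Q
      X^≤τ^ = *-cancelˡ-≤ X (begin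
        X ^ suc (Q + q)        ≡⟨ cong (X ^_) (sym (+-suc Q q)) ⟩
        X ^ (Q + Q)            ≡⟨ ^-distribˡ-+-* X Q Q ⟩
        X ^ Q * X ^ Q          ≡⟨ sym (^-distribʳ-* X X Q) ⟩
        (X * X) ^ Q            ≡⟨ Z≡ Q ⟩
        b ^ Q * τ ^ Q          ≤⟨ *-monoˡ-≤ (τ ^ Q) (^-monoʳ-≤ b (m≤n+m Q 15)) ⟩
        X * τ ^ Q              ∎)
        where open ≤-Reasoning

      -- A larger p only lowers the exponent on the left, so it suffices to reach 2Q - 1 = Q + q,
      -- that is η = 1/Q. N exceeds X^(6m) by at most the factor `C₄`, which turns into the implied
      -- constant.
      count-bound : ∀ m N l → 1 ≤ N → N < G * X ^ (6 * suc m) → A * A * τ ^ (6 * m) ≤ 2 * l →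
        N ^ (2 * Q ∸ suc p) ≤ l ^ Q * suc (2 * (C₄ * C₄)) ^ Q
      count-bound m N l 1≤N N< many = begin
        N ^ (2 * Q ∸ suc p)                       ≤⟨ ^-monoʳ-≤ N {{>-nonZero 1≤N}} exponent ⟩
        N ^ (Q + q)                               ≤⟨ ^-monoˡ-≤ (Q + q) N≤ ⟩
        (C₄ * X ^ (6 * m)) ^ (Q + q)              ≡⟨ ^-distribʳ-* C₄ (X ^ (6 * m)) (Q + q) ⟩
        C₄ ^ (Q + q) * (X ^ (6 * m)) ^ (Q + q)    ≤⟨ *-mono-≤ (^-monoʳ-≤ C₄ {{C₄≢0}} (+-monoʳ-≤ Q (n≤1+n q))) powers ⟩
        C₄ ^ (Q + Q) * (τ ^ (6 * m)) ^ Q          ≤⟨ *-monoʳ-≤ (C₄ ^ (Q + Q)) (^-monoˡ-≤ Q τ≤) ⟩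
        C₄ ^ (Q + Q) * (2 * l) ^ Q                ≡⟨ cong (_* (2 * l) ^ Q) (trans (^-distribˡ-+-* C₄ Q Q) (sym (^-distribʳ-* C₄ C₄ Q))) ⟩
        (C₄ * C₄) ^ Q * (2 * l) ^ Q               ≡⟨ sym (^-distribʳ-* (C₄ * C₄) (2 * l) Q) ⟩
        (C₄ * C₄ * (2 * l)) ^ Q                   ≡⟨ cong (_^ Q) (e (C₄ * C₄) l) ⟩
        (l * (2 * (C₄ * C₄))) ^ Q                 ≤⟨ ^-monoˡ-≤ Q (*-monoʳ-≤ l (n≤1+n (2 * (C₄ * C₄)))) ⟩
        (l * suc (2 * (C₄ * C₄))) ^ Q             ≡⟨ ^-distribʳ-* l (suc (2 * (C₄ * C₄))) Q ⟩
        l ^ Q * suc (2 * (C₄ * C₄)) ^ Q           ∎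
        where
        open ≤-Reasoning
        e : ∀ c l → c * (2 * l) ≡ l * (2 * c)
        e = ℕSolver.solve-∀
        C₄≢0 : NonZero C₄
        C₄≢0 = m*n≢0 G (X ^ 6) {{G≢0}} {{m^n≢0 X 6}}
        exponent : 2 * Q ∸ suc p ≤ Q + q
        exponent = ≤-trans (∸-monoʳ-≤ (2 * Q) (s≤s (z≤n {p}))) (≤-reflexive (trans (cong (λ v → q + v) (+-identityʳ Q)) (+-suc q q)))
        N≤ : N ≤ C₄ * X ^ (6 * m)
        N≤ = ≤-trans (<⇒≤ N<) (≤-reflexive (trans (cong (G *_) (trans (cong (X ^_) (*-distribˡ-+ 6 1 m)) (^-distribˡ-+-* X 6 (6 * m)))) (sym (*-assoc G (X ^ 6) (X ^ (6 * m))))))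
        τ≤ : τ ^ (6 * m) ≤ 2 * l
        τ≤ = ≤-trans (m≤n*m (τ ^ (6 * m)) (A * A) {{m*n≢0 A A}}) many
        swap : ∀ y k → (y ^ (6 * m)) ^ k ≡ (y ^ k) ^ (6 * m)
        swap y k = trans (^-*-assoc y (6 * m) k) (trans (cong (y ^_) (*-comm (6 * m) k)) (sym (^-*-assoc y k (6 * m))))
        powers : (X ^ (6 * m)) ^ (Q + q) ≤ (τ ^ (6 * m)) ^ Q
        powers = ≤-trans (≤-reflexive (swap X (Q + q))) (≤-trans (^-monoˡ-≤ (6 * m) X^≤τ^) (≤-reflexive (sym (swap τ Q))))

    conclusion : Σ ℕ λ A → 1 ≤ A × (Σ ℕ λ m → Σ ℕ λ N₀ → (N : ℕ) → N₀ ≤ N →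
      Σ (List Mat) λ L → Unique L ×
      All (λ γ → InΓ A γ × InB N γ × SquareFree (disc γ)) L ×
      N ^ (2 * suc q ∸ suc p) ≤ (length L) ^ (suc q) * (suc m) ^ (suc q))
    conclusion = amax + D , ≤-trans (>-nonZero⁻¹ amax) (m≤m+n amax D) , 2 * (C₄ * C₄) , f m₀ , λ N N₀≤N →
      let (m , m₀≤m , lower , upper) = bracket f N m₀ N N₀≤N (far N)
          (L , unique , good , many) = selection m N m₀≤m lower upper
      in L , unique , good , count-bound m N (length L) (≤-trans (f≥1 m₀) N₀≤N) upper many
      where
      f : ℕ → ℕ
      f m = G * X ^ (6 * m)
      f≥1 : ∀ m → 1 ≤ f m
      f≥1 m = *-mono-≤ (>-nonZero⁻¹ G) (m^n>0 X (6 * m))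
      far : ∀ N → N < f (m₀ + N)
      far N = begin-strict
        N                         <⟨ n<2^n N ⟩
        2 ^ N                     ≤⟨ ^-monoˡ-≤ N 2≤X ⟩
        X ^ N                     ≤⟨ ^-monoʳ-≤ X (≤-trans (m≤n+m N m₀) (m≤n*m (m₀ + N) 6)) ⟩
        X ^ (6 * (m₀ + N))        ≤⟨ m≤n*m (X ^ (6 * (m₀ + N))) G ⟩
        f (m₀ + N)                ∎
        where open ≤-Reasoning

open import Data.Nat using (ℕ; suc; _+_; _*_; _∸_; _^_; _≤_; _<_)

-- Here η = (p + 1)/(q + 1), and the implied constant is 1/(m + 1); the inequality N^(2 - η) ≤ (m +
-- 1) |L| is raised to the power q + 1 to have natural exponents. The list of distinct matrices
-- bounds the cardinality from below.
theorem1p8 : (p q : ℕ) →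
    Σ ℕ λ A → 1 ≤ A × (Σ ℕ λ m → Σ ℕ λ N₀ → (N : ℕ) → N₀ ≤ N →
    Σ (List Mat) λ L → Unique L ×
    All (λ γ → InΓ A γ × InB N γ × SquareFree (disc γ)) L ×
    N ^ (2 * suc q ∸ suc p) ≤ (length L) ^ (suc q) * (suc m) ^ (suc q))
-- K = 15 + (q + 1): the 15 covers the losses in the sieve, and K ≥ q + 1 makes the density exponent
-- 2 - 1/K of the blocks at least 2 - 1/(q + 1).
theorem1p8 p q = Final.Conclusion.conclusion sm p q (Construction.Build.blocks (Final.SieveModulus.q sm) {{Final.SieveModulus.q≢0 sm}} (15 + suc q))
  where sm = Final.sieveModulus 192
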